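{- Let $n$ and $h$ be positive integers and put $m=\operatorname{lcm}(n,h)$. Let $u$ be the largest divisor of $n$ which is self-conjugate modulo $m$, and write $u=w^2k$ where $k$ is the square-free part of $u$. Let $t$ and $r$ be the numbers of distinct prime divisors of $h$ and $k$, respectively. Suppose a $\mathrm{BH}(\mathbb{Z}_n,h)$ matrix exists. Then: (a) if $k$ is odd, $w\leq 2^{t-r-1+\delta_{rt}}\gcd(h,u)\sqrt{k/\varphi(k)}$; (b) if $k$ is even, $w\leq 2^{t-r-1}\gcd(h,u)\sqrt{2k/\varphi(k)}$.
   Context: For a finite abelian group $(G,+)$ and a positive integer $h$, a $\mathrm{BH}(G,h)$ matrix is a $|G|\times|G|$ matrix $H=(a_{g,k})_{g,k\in G}$ whose entries are complex $h$th roots of unity, which is $G$-invariant (i.e. $a_{g+l,k+l}=a_{g,k}$ for all $g,k,l\in G$), and satisfies $HH^*=|G|I$. $\mathbb{Z}_n$ is the cyclic group of order $n$. A prime $p$ is self-conjugate modulo $N$ if, writing $N=p^aN'$ with $\gcd(p,N')=1$, there is an integer $j$ with $p^j\equiv -1\pmod{N'}$; a positive integer is self-conjugate modulo $N$ if every prime divisor of it is (so $1$ qualifies). The square-free part of an integer $x$ is the product of all primes $p$ for which $\nu_p(x)$ is odd. $\varphi$ is Euler's function, and $\delta_{rt}=1$ if $r=t$ and $0$ otherwise. -}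

module Defs where

open import Level using (Level)
open import Data.Nat using (ℕ; zero; suc; _+_; _*_; _∸_; _^_; _≤_; _<_; NonZero; _≟_)
open import Data.Nat.Divisibility using (_∣_; _∣?_)
open import Data.Nat.DivMod using (_mod_)
open import Data.Nat.Primality using (Prime; prime?)
open import Data.Nat.Coprimality using (Coprime; coprime?)
open import Data.Fin using (Fin; toℕ)
open import Data.List using (List; length; filter; upTo; map)
open import Data.Product using (Σ; ∃; ∃-syntax; _×_; _,_)
open import Data.Sum using (_⊎_)
open import Data.Bool using (if_then_else_)
open import Relation.Nullary using (¬_)
open import Relation.Nullary.Decidable using (_×-dec_; ⌊_⌋)
open import Relation.Binary.PropositionalEquality using (_≡_)
open import Function.Bundles using (_⇔_)
open import Algebra.Bundles using (CommutativeRing; Semiring)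
import Algebra.Definitions.RawSemiring as RS

SelfConjPrime : ℕ → ℕ → Set
SelfConjPrime p N =
  ∃[ a ] ∃[ N' ] (N ≡ p ^ a * N') × (¬ (p ∣ N')) × (∃[ j ] (N' ∣ p ^ j + 1))

SelfConj : ℕ → ℕ → Set
SelfConj x N = (1 ≤ x) × (∀ p → Prime p → p ∣ x → SelfConjPrime p N)

OddValuation : ℕ → ℕ → Set
OddValuation p x = ∃[ e ] (p ^ (2 * e + 1) ∣ x) × (¬ (p ^ (2 * e + 2) ∣ x))

IsSquareFreePart : ℕ → ℕ → Set
IsSquareFreePart k x =
  (1 ≤ k) × (∀ p → Prime p → ¬ (p * p ∣ k))
          × (∀ p → Prime p → (p ∣ k ⇔ OddValuation p x))

ω : ℕ → ℕ
ω x = length (filter (λ p → prime? p ×-dec p ∣? x) (upTo (suc x)))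

φ : ℕ → ℕ
φ k = length (filter (λ i → coprime? i k) (map suc (upTo k)))

δ : ℕ → ℕ → ℕ
δ r t = if ⌊ r ≟ t ⌋ then 1 else 0

addℤ : (n : ℕ) .{{_ : NonZero n}} → Fin n → Fin n → Fin n
addℤ n x y = (toℕ x + toℕ y) mod n

-- BH(ℤ_n, h) matrices.
-- Entries are h-th roots of unity ζ^e, recorded by the exponent e : Fin h.
-- The complex numbers are replaced by an arbitrary integral domain R of
-- characteristic 0 containing an element ζ of multiplicative order
-- exactly h (e.g. ℂ with ζ = e^{2πi/h}).

module _ {c ℓ : Level} (R : CommutativeRing c ℓ) where
  open CommutativeRing R using (Carrier; _≈_; 0#; 1#; semiring) renaming (_*_ to _*ᴿ_)
  open RS (Semiring.rawSemiring semiring) using (sum) renaming (_^_ to _^ᴿ_; _×_ to _·_)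

  IntegralDomain : Set (c Level.⊔ ℓ)
  IntegralDomain = ∀ x y → x *ᴿ y ≈ 0# → (x ≈ 0#) ⊎ (y ≈ 0#)

  CharZero : Set ℓ
  CharZero = ∀ m → m · 1# ≈ 0# → m ≡ 0

  PrimitiveRoot : ℕ → Carrier → Set ℓ
  PrimitiveRoot h ζ = (ζ ^ᴿ h ≈ 1#) × (∀ j → 0 < j → j < h → ¬ (ζ ^ᴿ j ≈ 1#))

  -- H : Fin n → Fin n → Fin h is a BH(ℤ_n, h) matrix, the (g,k) entry
  -- being ζ^(H g k); complex conjugation of ζ^b is ζ^(h - b).
  IsBH : (n h : ℕ) .{{_ : NonZero n}} → Carrier → (Fin n → Fin n → Fin h) → Set ℓ
  IsBH n h ζ H =
    (∀ g k l → H (addℤ n g l) (addℤ n k l) ≡ H g k)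
    × (∀ g g' → g ≡ g' → entry g g' ≈ n · 1#)
    × (∀ g g' → ¬ (g ≡ g') → entry g g' ≈ 0#)
    where
      entry : Fin n → Fin n → Carrier
      entry g g' = sum (λ k → ζ ^ᴿ (toℕ (H g k) + (h ∸ toℕ (H g' k))))

  BHExists : (n h : ℕ) .{{_ : NonZero n}} → Carrier → Set ℓ
  BHExists n h ζ = Σ (Fin n → Fin n → Fin h) (IsBH n h ζ)

{-# OPTIONS --safe #-}
-- The stronger bound w ≤ gcd(h,u) holds, and every prime dividing u divides h, so that r ≤ t.
--
-- Let d = gcd(h,u) and let D = Σ ζ^(H₀ₖ) x^k be the first row of the matrix, viewed in
-- B = ℤ[ζ][x] / (x^(n/d) - ζ^(h/d)); then D D̄ = n.  For a prime p ∣ u the p-power roots of unity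
-- among the ζ^i x^l form a cyclic group ⟨η⟩, p is associate to a power of π = η - 1, and
-- self-conjugacy says that conjugation is a power of the Frobenius on the reduced ring B/π.
-- Hence p² ∣ X X̄ implies p ∣ X, and so w ∣ D.  The coefficients of D in the basis 1, …, x^(n/d-1) are
-- sums of d roots of unity in ℤ[ζ], divisible by w and not all zero.  The N-th power of such a
-- sum is divisible by w^N and has coordinates of size O(d^N), so w ≤ d.
--
-- If p ∣ u but p ∤ h, the same descent applied to the row sum rules out p² ∤ n, and applied
-- modulo the p-th cyclotomic polynomial in x^(n/p) it shows that row entries at distance n/p are
-- congruent modulo p, hence equal; then D vanishes there, contradicting D D̄ = n.
--
-- No field containing all n-th roots of unity is available, nor is equality in R decidable: rings
-- such as B are quotients of formal sums by annihilators of functionals with values in R, and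
-- classical reasoning is confined to double negations of decidable statements.
module Submission where

open import Defs
open import Level using (Level; 0ℓ; _⊔_)
open import Data.Bool.Base using (Bool; true; false)
open import Data.Empty using (⊥; ⊥-elim)
open import Data.Fin.Base using (Fin; zero; suc; toℕ; inject₁; fromℕ)
open import Data.Fin.Properties using (toℕ-injective; toℕ-inject₁; toℕ-fromℕ; toℕ-fromℕ<; toℕ<n)
open import Data.Integer as ℤ using (ℤ; 0ℤ; 1ℤ; -[1+_])
import Data.Integer.Properties as ℤ
open import Data.List.Base using (List; []; _∷_; _∷ʳ_; map; filter; length; upTo)
open import Data.List.Properties using (upTo-∷ʳ; filter-++; length-++; length-filter; length-map; length-upTo; map-++)
open import Data.List.Relation.Unary.All as All using (All; []; _∷_)
import Data.List.Relation.Unary.All.Properties as All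
open import Data.Maybe.Base as Maybe using (Maybe)
open import Data.Nat as ℕ using (ℕ; zero; suc; NonZero)
open import Data.Nat.Combinatorics using (_C_; nCn≡1; nC1≡n; nCk+nC[k+1]≡[n+1]C[k+1]; k>n⇒nCk≡0; nCk≡nC[n∸k])
open import Data.Nat.Coprimality using (Coprime; coprime?; coprime-divisor; coprime-Bézout)
open import Data.Nat.Divisibility as ℕ using (divides)
open import Data.Nat.DivMod as ℕ using (_mod_)
open import Data.Nat.GCD using (gcd; gcd[m,n]∣m; gcd[m,n]∣n; gcd-greatest; gcd[m,n]≢0; module Bézout)
open import Data.Nat.Induction using (<-rec)
open import Data.Nat.LCM using (lcm; m∣lcm[m,n]; n∣lcm[m,n])
open import Data.Nat.ListAction using (product)
open import Data.Nat.Primality using (Prime; prime?; euclidsLemma; prime⇒nonZero; prime⇒nonTrivial; prime⇒irreducible)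
open import Data.Nat.Primality.Factorisation using (PrimeFactorisation; factorise)
import Data.Nat.Properties as ℕ
open import Data.Nat.Tactic.RingSolver using (solve-∀)
open import Data.Product using (∃-syntax; Σ-syntax; _×_; _,_; proj₁; proj₂)
open import Data.Sum using (_⊎_; inj₁; inj₂)
open import Data.Unit.Base using (⊤; tt)
open import Relation.Binary.Consequences using (dec⇒weaklyDec)
open import Relation.Binary.PropositionalEquality as ≡ using (_≡_)
import Relation.Binary.Reasoning.Setoid
open import Relation.Nullary using (¬_; Dec; yes; no)
open import Relation.Nullary.Decidable using (decidable-stable; ¬¬-excluded-middle; _×-dec_)
open import Relation.Unary using (Pred; Decidable)
open import Algebra.Bundles using (CommutativeMonoid; CommutativeRing)
import Algebra.Properties.CommutativeMonoid.Sum
import Algebra.Properties.CommutativeSemigroup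
import Algebra.Properties.CommutativeSemiring.Binomial
import Algebra.Properties.CommutativeSemiring.Exp
import Algebra.Properties.Ring
import Algebra.Properties.Semiring.Exp
import Algebra.Properties.Semiring.Mult
import Algebra.Properties.Semiring.Sum
import Algebra.Solver.Ring
open import Algebra.Solver.Ring.AlmostCommutativeRing using (fromCommutativeRing; _-Raw-AlmostCommutative⟶_)

-- Formal sums and monoid rings

-- The bound w ≤ gcd(h,u) suffices because φ(k) ≤ k, with 2φ(k) ≤ k for even k, and because r + 1 ≤
-- t + δ once r ≤ t.
--
-- The relation x^(n/d) = ζ^(h/d) has two purposes. It leaves d terms in each coefficient of D, so
-- that comparing sizes ends in w ≤ d. It also makes the p-part of the monomial group cyclic: with
-- x^n = 1 alone and p dividing both n and h, the p-parts of ⟨ζ⟩ and ⟨x⟩ are independent, and no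
-- single η has all p-power monomials among its powers. Cyclicity holds when p does not divide both
-- h/d and n/d, and this is where the maximality of u enters: it gives p ∤ n/u, while h/d and u/d
-- are coprime.
--
-- The ring R carries no absolute value. Sizes are measured by integer functionals instead, whose
-- values on a formal sum are bounded by a constant times its number of terms; ring elements are
-- therefore carried as formal sums.

private
  variable
    𝔾 𝔾′ : Set

infixl 6 _⊕_
infix 8 ⊖_

-- Sums are left unnormalised: equality is imposed only through evaluation, and the number of terms
-- `size` stays available as a measure of magnitude.
data FormalSum (𝔾 : Set) : Set where
  𝟘   : FormalSum 𝔾
  ⟨_⟩ : 𝔾 → FormalSum 𝔾
  _⊕_ : FormalSum 𝔾 → FormalSum 𝔾 → FormalSum 𝔾
  ⊖_  : FormalSum 𝔾 → FormalSum 𝔾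

bind : FormalSum 𝔾 → (𝔾 → FormalSum 𝔾′) → FormalSum 𝔾′
bind 𝟘       σ = 𝟘
bind ⟨ g ⟩   σ = σ g
bind (P ⊕ Q) σ = bind P σ ⊕ bind Q σ
bind (⊖ P)   σ = ⊖ bind P σ

size : FormalSum 𝔾 → ℕ
size 𝟘       = 0
size ⟨ g ⟩   = 1
size (P ⊕ Q) = size P ℕ.+ size Q
size (⊖ P)   = size P

⨁ : ∀ {n} → (Fin n → FormalSum 𝔾) → FormalSum 𝔾
⨁ {n = zero}  F = 𝟘
⨁ {n = suc n} F = F zero ⊕ ⨁ (λ i → F (suc i))

size-bind : ∀ k {σ : 𝔾 → FormalSum 𝔾′} → (∀ g → size (σ g) ≡ k) → ∀ P → size (bind P σ) ≡ size P ℕ.* k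
size-bind k e 𝟘       = ≡.refl
size-bind k e ⟨ g ⟩   = ≡.trans (e g) (≡.sym (ℕ.*-identityˡ k))
size-bind k e (P ⊕ Q) = ≡.trans (≡.cong₂ ℕ._+_ (size-bind k e P) (size-bind k e Q))
                          (≡.sym (ℕ.*-distribʳ-+ k (size P) (size Q)))
size-bind k e (⊖ P)   = size-bind k e P

infixl 6 _⊹_
-- A pair (i, l) stands for the monomial ζ^i x^l. Exponents stay natural numbers, so inverses are
-- written as high powers.
_⊹_ : ℕ × ℕ → ℕ × ℕ → ℕ × ℕ
(i , l) ⊹ (i′ , l′) = i ℕ.+ i′ , l ℕ.+ l′

⊹-assoc : ∀ g g′ g″ → (g ⊹ g′) ⊹ g″ ≡ g ⊹ (g′ ⊹ g″)
⊹-assoc (i , l) (i′ , l′) (i″ , l″) = ≡.cong₂ _,_ (ℕ.+-assoc i i′ i″) (ℕ.+-assoc l l′ l″)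

⊹-comm : ∀ g g′ → g ⊹ g′ ≡ g′ ⊹ g
⊹-comm (i , l) (i′ , l′) = ≡.cong₂ _,_ (ℕ.+-comm i i′) (ℕ.+-comm l l′)

module Evaluation {c ℓ : Level} (R : CommutativeRing c ℓ) where
  open CommutativeRing R
  open Algebra.Properties.Ring ring
  open Algebra.Properties.Semiring.Mult semiring using () renaming (_×_ to _·_)
  open Algebra.Properties.Semiring.Sum semiring using (sum)
  open Algebra.Properties.CommutativeSemigroup (CommutativeRing.+-commutativeSemigroup R) using (interchange)
  open Relation.Binary.Reasoning.Setoid setoid

  ev : (𝔾 → Carrier) → FormalSum 𝔾 → Carrier
  ev f 𝟘       = 0#
  ev f ⟨ g ⟩   = f g
  ev f (P ⊕ Q) = ev f P + ev f Q
  ev f (⊖ P)   = - ev f P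

  ev-cong : {f f′ : 𝔾 → Carrier} → (∀ g → f g ≈ f′ g) → ∀ P → ev f P ≈ ev f′ P
  ev-cong e 𝟘       = refl
  ev-cong e ⟨ g ⟩   = e g
  ev-cong e (P ⊕ Q) = +-cong (ev-cong e P) (ev-cong e Q)
  ev-cong e (⊖ P)   = -‿cong (ev-cong e P)

  ev-bind : (f : 𝔾′ → Carrier) (σ : 𝔾 → FormalSum 𝔾′) → ∀ P →
            ev f (bind P σ) ≈ ev (λ g → ev f (σ g)) P
  ev-bind f σ 𝟘       = refl
  ev-bind f σ ⟨ g ⟩   = refl
  ev-bind f σ (P ⊕ Q) = +-cong (ev-bind f σ P) (ev-bind f σ Q)
  ev-bind f σ (⊖ P)   = -‿cong (ev-bind f σ P)

  ev-0 : (P : FormalSum 𝔾) → ev (λ _ → 0#) P ≈ 0#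
  ev-0 𝟘       = refl
  ev-0 ⟨ g ⟩   = refl
  ev-0 (P ⊕ Q) = trans (+-cong (ev-0 P) (ev-0 Q)) (+-identityˡ 0#)
  ev-0 (⊖ P)   = trans (-‿cong (ev-0 P)) -0#≈0#

  ev-+ : (f f′ : 𝔾 → Carrier) → ∀ P → ev (λ g → f g + f′ g) P ≈ ev f P + ev f′ P
  ev-+ f f′ 𝟘       = sym (+-identityˡ 0#)
  ev-+ f f′ ⟨ g ⟩   = refl
  ev-+ f f′ (P ⊕ Q) = trans (+-cong (ev-+ f f′ P) (ev-+ f f′ Q)) (interchange _ _ _ _)
  ev-+ f f′ (⊖ P)   = trans (-‿cong (ev-+ f f′ P)) (sym (-‿+-comm _ _))

  ev-neg : (f : 𝔾 → Carrier) → ∀ P → ev (λ g → - f g) P ≈ - ev f P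
  ev-neg f 𝟘       = sym -0#≈0#
  ev-neg f ⟨ g ⟩   = refl
  ev-neg f (P ⊕ Q) = trans (+-cong (ev-neg f P) (ev-neg f Q)) (-‿+-comm _ _)
  ev-neg f (⊖ P)   = -‿cong (ev-neg f P)

  ev-*ˡ : ∀ a (f : 𝔾 → Carrier) P → ev (λ g → a * f g) P ≈ a * ev f P
  ev-*ˡ a f 𝟘       = sym (zeroʳ a)
  ev-*ˡ a f ⟨ g ⟩   = refl
  ev-*ˡ a f (P ⊕ Q) = trans (+-cong (ev-*ˡ a f P) (ev-*ˡ a f Q)) (sym (distribˡ a _ _))
  ev-*ˡ a f (⊖ P)   = trans (-‿cong (ev-*ˡ a f P)) (-‿distribʳ-* a _)

  ev-· : ∀ n (f : 𝔾 → Carrier) P → ev (λ g → n · f g) P ≈ n · ev f P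
  ev-· zero    f P = ev-0 P
  ev-· (suc n) f P = trans (ev-+ f _ P) (+-congˡ (ev-· n f P))

  ev-swap : (F : 𝔾 → 𝔾′ → Carrier) → ∀ P Q →
            ev (λ g → ev (F g) Q) P ≈ ev (λ g′ → ev (λ g → F g g′) P) Q
  ev-swap F 𝟘       Q = sym (ev-0 Q)
  ev-swap F ⟨ g ⟩   Q = refl
  ev-swap F (P ⊕ P′) Q = trans (+-cong (ev-swap F P Q) (ev-swap F P′ Q)) (sym (ev-+ _ _ Q))
  ev-swap F (⊖ P)   Q = trans (-‿cong (ev-swap F P Q)) (sym (ev-neg _ Q))

  ev-⨁ : (f : 𝔾 → Carrier) → ∀ {n} (F : Fin n → FormalSum 𝔾) → ev f (⨁ F) ≈ sum (λ i → ev f (F i))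
  ev-⨁ f {zero}  F = refl
  ev-⨁ f {suc n} F = +-congˡ (ev-⨁ f (λ i → F (suc i)))

  opaque
    convolve : (𝔾 → 𝔾 → 𝔾) → FormalSum 𝔾 → FormalSum 𝔾 → FormalSum 𝔾
    convolve _∙_ P Q = bind P (λ g → bind Q (λ g′ → ⟨ g ∙ g′ ⟩))

    ev-convolve : (_∙_ : 𝔾 → 𝔾 → 𝔾) (f : 𝔾 → Carrier) → ∀ P Q →
                  ev f (convolve _∙_ P Q) ≈ ev (λ g → ev (λ g′ → f (g ∙ g′)) Q) P
    ev-convolve _∙_ f P Q = trans (ev-bind f _ P) (ev-cong (λ g → ev-bind f _ Q) P)

    size-convolve : (_∙_ : 𝔾 → 𝔾 → 𝔾) → ∀ P Q → size (convolve _∙_ P Q) ≡ size P ℕ.* size Q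
    size-convolve _∙_ P Q = size-bind (size Q) (λ g → ≡.trans (size-bind 1 (λ g′ → ≡.refl) Q) (ℕ.*-identityʳ _)) P

  -- The quotient of the integral monoid ring of ℕ × ℕ by the annihilator of the family s of
  -- R-valued functions.
  module MonoidRing {I : Set} (s : I → ℕ × ℕ → Carrier) where
    infix 4 _≋_
    -- All translates by g are tested because the kernel of a functional alone is not an ideal; in
    -- `⊛-congˡ` each term of the other factor just translates the test.
    record _≋_ (P Q : FormalSum (ℕ × ℕ)) : Set ℓ where
      constructor mk≋
      field at : ∀ ι g → ev (λ g′ → s ι (g ⊹ g′)) P ≈ ev (λ g′ → s ι (g ⊹ g′)) Q
    open _≋_ public

    infixl 7 _⊛_
    _⊛_ : FormalSum (ℕ × ℕ) → FormalSum (ℕ × ℕ) → FormalSum (ℕ × ℕ)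
    _⊛_ = convolve _⊹_

    ev-⊛ : ∀ ι g P Q → ev (λ g′ → s ι (g ⊹ g′)) (P ⊛ Q) ≈
                       ev (λ g′ → ev (λ g″ → s ι (g ⊹ g′ ⊹ g″)) Q) P
    ev-⊛ ι g P Q = trans (ev-convolve _⊹_ _ P Q)
      (ev-cong (λ g′ → ev-cong (λ g″ → reflexive (≡.cong (s ι) (≡.sym (⊹-assoc g g′ g″)))) Q) P)

    ⊛-comm : ∀ P Q → P ⊛ Q ≋ Q ⊛ P
    ⊛-comm P Q .at ι g = begin
      ev (λ g′ → s ι (g ⊹ g′)) (P ⊛ Q)                      ≈⟨ ev-convolve _⊹_ _ P Q ⟩
      ev (λ g′ → ev (λ g″ → s ι (g ⊹ (g′ ⊹ g″))) Q) P       ≈⟨ ev-swap _ P Q ⟩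
      ev (λ g″ → ev (λ g′ → s ι (g ⊹ (g′ ⊹ g″))) P) Q
        ≈⟨ ev-cong (λ g″ → ev-cong (λ g′ → reflexive (≡.cong (λ x → s ι (g ⊹ x)) (⊹-comm g′ g″))) P) Q ⟩
      ev (λ g″ → ev (λ g′ → s ι (g ⊹ (g″ ⊹ g′))) P) Q       ≈⟨ ev-convolve _⊹_ _ Q P ⟨
      ev (λ g′ → s ι (g ⊹ g′)) (Q ⊛ P)                      ∎

    ⊛-congˡ : ∀ P {Q Q′} → Q ≋ Q′ → P ⊛ Q ≋ P ⊛ Q′
    ⊛-congˡ P {Q} {Q′} e .at ι g = begin
      ev (λ g′ → s ι (g ⊹ g′)) (P ⊛ Q)                 ≈⟨ ev-⊛ ι g P Q ⟩
      ev (λ g′ → ev (λ g″ → s ι (g ⊹ g′ ⊹ g″)) Q) P    ≈⟨ ev-cong (λ g′ → e .at ι (g ⊹ g′)) P ⟩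
      ev (λ g′ → ev (λ g″ → s ι (g ⊹ g′ ⊹ g″)) Q′) P   ≈⟨ ev-⊛ ι g P Q′ ⟨
      ev (λ g′ → s ι (g ⊹ g′)) (P ⊛ Q′)                ∎

    ≋-trans : ∀ {P Q S} → P ≋ Q → Q ≋ S → P ≋ S
    ≋-trans e e′ .at ι g = trans (e .at ι g) (e′ .at ι g)

    ⊛-cong : ∀ {P P′ Q Q′} → P ≋ P′ → Q ≋ Q′ → P ⊛ Q ≋ P′ ⊛ Q′
    ⊛-cong {P} {P′} {Q} {Q′} e e′ =
      ≋-trans (⊛-congˡ P e′) (≋-trans (⊛-comm P Q′) (≋-trans (⊛-congˡ Q′ e) (⊛-comm Q′ P′)))

    ⊛-assoc : ∀ P Q S → (P ⊛ Q) ⊛ S ≋ P ⊛ (Q ⊛ S)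
    ⊛-assoc P Q S .at ι g = begin
      ev (λ g′ → s ι (g ⊹ g′)) ((P ⊛ Q) ⊛ S)
        ≈⟨ ev-convolve _⊹_ _ (P ⊛ Q) S ⟩
      ev (λ g′ → ev (λ g″ → s ι (g ⊹ (g′ ⊹ g″))) S) (P ⊛ Q)
        ≈⟨ ev-convolve _⊹_ _ P Q ⟩
      ev (λ g₁ → ev (λ g₂ → ev (λ g₃ → s ι (g ⊹ (g₁ ⊹ g₂ ⊹ g₃))) S) Q) P
        ≈⟨ ev-cong (λ g₁ → ev-cong (λ g₂ → ev-cong (λ g₃ →
             reflexive (≡.cong (λ x → s ι (g ⊹ x)) (⊹-assoc g₁ g₂ g₃))) S) Q) P ⟩
      ev (λ g₁ → ev (λ g₂ → ev (λ g₃ → s ι (g ⊹ (g₁ ⊹ (g₂ ⊹ g₃)))) S) Q) P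
        ≈⟨ ev-cong (λ g₁ → ev-convolve _⊹_ _ Q S) P ⟨
      ev (λ g₁ → ev (λ g₂ → s ι (g ⊹ (g₁ ⊹ g₂))) (Q ⊛ S)) P
        ≈⟨ ev-convolve _⊹_ _ P (Q ⊛ S) ⟨
      ev (λ g′ → s ι (g ⊹ g′)) (P ⊛ (Q ⊛ S)) ∎

    ⊛-identityˡ : ∀ P → ⟨ 0 , 0 ⟩ ⊛ P ≋ P
    ⊛-identityˡ P .at ι g = ev-convolve _⊹_ _ ⟨ 0 , 0 ⟩ P

    ⊛-distribʳ : ∀ P Q S → (Q ⊕ S) ⊛ P ≋ (Q ⊛ P) ⊕ (S ⊛ P)
    ⊛-distribʳ P Q S .at ι g = trans (ev-convolve _⊹_ _ (Q ⊕ S) P)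
      (sym (+-cong (ev-convolve _⊹_ _ Q P) (ev-convolve _⊹_ _ S P)))

    ⊛-distribˡ : ∀ P Q S → P ⊛ (Q ⊕ S) ≋ (P ⊛ Q) ⊕ (P ⊛ S)
    ⊛-distribˡ P Q S = ≋-trans (⊛-comm P (Q ⊕ S)) (≋-trans (⊛-distribʳ P Q S)
      (mk≋ (λ ι g → +-cong (⊛-comm Q P .at ι g) (⊛-comm S P .at ι g))))

    mono-⊛ : ∀ g g′ → ⟨ g ⟩ ⊛ ⟨ g′ ⟩ ≋ ⟨ g ⊹ g′ ⟩
    mono-⊛ g g′ .at ι g₀ = ev-convolve _⊹_ _ ⟨ g ⟩ ⟨ g′ ⟩

    monoidRing : CommutativeRing 0ℓ ℓ
    monoidRing = record
      { Carrier = FormalSum (ℕ × ℕ)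
      ; _≈_ = _≋_
      ; _+_ = _⊕_
      ; _*_ = _⊛_
      ; -_ = ⊖_
      ; 0# = 𝟘
      ; 1# = ⟨ 0 , 0 ⟩
      ; isCommutativeRing = record
        { isRing = record
          { +-isAbelianGroup = record
            { isGroup = record
              { isMonoid = record
                { isSemigroup = record
                  { isMagma = record
                    { isEquivalence = record
                      { refl = mk≋ λ _ _ → refl
                      ; sym = λ e → mk≋ λ ι g → sym (e .at ι g)
                      ; trans = ≋-trans
                      }
                    ; ∙-cong = λ e e′ → mk≋ λ ι g → +-cong (e .at ι g) (e′ .at ι g)
                    }
                  ; assoc = λ P Q S → mk≋ λ ι g → +-assoc _ _ _
                  }
                ; identity = (λ P → mk≋ λ ι g → +-identityˡ _) , (λ P → mk≋ λ ι g → +-identityʳ _)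
                }
              ; inverse = (λ P → mk≋ λ ι g → -‿inverseˡ _) , (λ P → mk≋ λ ι g → -‿inverseʳ _)
              ; ⁻¹-cong = λ e → mk≋ λ ι g → -‿cong (e .at ι g)
              }
            ; comm = λ P Q → mk≋ λ ι g → +-comm _ _
            }
          ; *-cong = ⊛-cong
          ; *-assoc = ⊛-assoc
          ; *-identity = ⊛-identityˡ , (λ P → ≋-trans (⊛-comm P ⟨ 0 , 0 ⟩) (⊛-identityˡ P))
          ; distrib = ⊛-distribˡ , ⊛-distribʳ
          }
        ; *-comm = ⊛-comm
        }
      }

-- Ring identities with integer coefficients

module IntegerCoefficients {c ℓ : Level} (R : CommutativeRing c ℓ) where
  open CommutativeRing R
  open Algebra.Properties.Ring ring
  open Algebra.Properties.Semiring.Mult semiring renaming (_×_ to _·_)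
  open Relation.Binary.Reasoning.Setoid setoid

  ⟦_⟧ : ℤ → Carrier
  ⟦ ℤ.+ n ⟧      = n · 1#
  ⟦ -[1+ n ] ⟧ = - (suc n · 1#)

  ⟦⟧-⊖ : ∀ m n → ⟦ m ℤ.⊖ n ⟧ ≈ m · 1# - n · 1#
  ⟦⟧-⊖ m       zero    = trans (sym (+-identityʳ _)) (+-congˡ (sym -0#≈0#))
  ⟦⟧-⊖ zero    (suc n) = sym (+-identityˡ _)
  ⟦⟧-⊖ (suc m) (suc n) = begin
    ⟦ suc m ℤ.⊖ suc n ⟧                    ≡⟨ ≡.cong ⟦_⟧ (ℤ.[1+m]⊖[1+n]≡m⊖n m n) ⟩
    ⟦ m ℤ.⊖ n ⟧                            ≈⟨ ⟦⟧-⊖ m n ⟩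
    m · 1# - n · 1#                        ≈⟨ +-congʳ (+-identityʳ _) ⟨
    m · 1# + 0# - n · 1#                   ≈⟨ +-congʳ (+-congˡ (-‿inverseʳ 1#)) ⟨
    m · 1# + (1# - 1#) - n · 1#            ≈⟨ +-congʳ (+-assoc _ _ _) ⟨
    m · 1# + 1# - 1# - n · 1#              ≈⟨ +-assoc _ _ _ ⟩
    m · 1# + 1# + (- 1# - n · 1#)          ≈⟨ +-cong (+-comm _ _) (-‿+-comm _ _) ⟩
    suc m · 1# - suc n · 1#                ∎

  ⟦⟧-+ : ∀ i j → ⟦ i ℤ.+ j ⟧ ≈ ⟦ i ⟧ + ⟦ j ⟧
  ⟦⟧-+ (ℤ.+ m)    (ℤ.+ n)    = ×-homo-+ 1# m n
  ⟦⟧-+ (ℤ.+ m)    -[1+ n ] = ⟦⟧-⊖ m (suc n)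
  ⟦⟧-+ -[1+ m ] (ℤ.+ n)    = trans (⟦⟧-⊖ n (suc m)) (+-comm _ _)
  ⟦⟧-+ -[1+ m ] -[1+ n ] = begin
    - (suc (suc (m ℕ.+ n)) · 1#)    ≡⟨ ≡.cong (λ x → - (suc x · 1#)) (≡.sym (ℕ.+-suc m n)) ⟩
    - ((suc m ℕ.+ suc n) · 1#)      ≈⟨ -‿cong (×-homo-+ 1# (suc m) (suc n)) ⟩
    - (suc m · 1# + suc n · 1#)     ≈⟨ -‿+-comm _ _ ⟨
    - (suc m · 1#) - (suc n · 1#)   ∎

  ⟦⟧-neg : ∀ i → ⟦ ℤ.- i ⟧ ≈ - ⟦ i ⟧
  ⟦⟧-neg (ℤ.+ zero)  = sym -0#≈0#
  ⟦⟧-neg (ℤ.+ suc n) = refl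
  ⟦⟧-neg -[1+ n ]  = sym (-‿involutive _)

  ⟦⟧-*⁺ : ∀ m j → ⟦ ℤ.+ m ℤ.* j ⟧ ≈ (m · 1#) * ⟦ j ⟧
  ⟦⟧-*⁺ zero    j = trans (reflexive (≡.cong ⟦_⟧ (ℤ.*-zeroˡ j))) (sym (zeroˡ _))
  ⟦⟧-*⁺ (suc m) j = begin
    ⟦ ℤ.+ suc m ℤ.* j ⟧               ≡⟨ ≡.cong ⟦_⟧ (ℤ.suc-* (ℤ.+ m) j) ⟩
    ⟦ j ℤ.+ ℤ.+ m ℤ.* j ⟧             ≈⟨ ⟦⟧-+ j (ℤ.+ m ℤ.* j) ⟩
    ⟦ j ⟧ + ⟦ ℤ.+ m ℤ.* j ⟧           ≈⟨ +-cong (sym (*-identityˡ _)) (⟦⟧-*⁺ m j) ⟩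
    1# * ⟦ j ⟧ + (m · 1#) * ⟦ j ⟧   ≈⟨ distribʳ _ _ _ ⟨
    (suc m · 1#) * ⟦ j ⟧            ∎

  ⟦⟧-* : ∀ i j → ⟦ i ℤ.* j ⟧ ≈ ⟦ i ⟧ * ⟦ j ⟧
  ⟦⟧-* (ℤ.+ m)    j = ⟦⟧-*⁺ m j
  ⟦⟧-* -[1+ m ] j = begin
    ⟦ -[1+ m ] ℤ.* j ⟧          ≡⟨ ≡.cong ⟦_⟧ (≡.sym (ℤ.neg-distribˡ-* (ℤ.+ suc m) j)) ⟩
    ⟦ ℤ.- (ℤ.+ suc m ℤ.* j) ⟧     ≈⟨ ⟦⟧-neg (ℤ.+ suc m ℤ.* j) ⟩
    - ⟦ ℤ.+ suc m ℤ.* j ⟧         ≈⟨ -‿cong (⟦⟧-*⁺ (suc m) j) ⟩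
    - ((suc m · 1#) * ⟦ j ⟧)    ≈⟨ -‿distribˡ-* _ _ ⟩
    - (suc m · 1#) * ⟦ j ⟧      ∎

  private
    -- Sends 1 to 1# rather than to 1# + 0#, so that con (ℤ.+ 1) may be used for 1#.
    ⟦_⟧′ : ℤ → Carrier
    ⟦ ℤ.+ 1 ⟧′ = 1#
    ⟦ i ⟧′   = ⟦ i ⟧

    ⟦⟧′≈ : ∀ i → ⟦ i ⟧′ ≈ ⟦ i ⟧
    ⟦⟧′≈ (ℤ.+ 0)           = refl
    ⟦⟧′≈ (ℤ.+ 1)           = sym (+-identityʳ 1#)
    ⟦⟧′≈ (ℤ.+ suc (suc n)) = refl
    ⟦⟧′≈ -[1+ n ]        = refl

    homomorphism : CommutativeRing.rawRing ℤ.+-*-commutativeRing -Raw-AlmostCommutative⟶ fromCommutativeRing R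
    homomorphism = record
      { ⟦_⟧ = ⟦_⟧′
      ; +-homo = λ i j → trans (⟦⟧′≈ (i ℤ.+ j)) (trans (⟦⟧-+ i j) (sym (+-cong (⟦⟧′≈ i) (⟦⟧′≈ j))))
      ; *-homo = λ i j → trans (⟦⟧′≈ (i ℤ.* j)) (trans (⟦⟧-* i j) (sym (*-cong (⟦⟧′≈ i) (⟦⟧′≈ j))))
      ; -‿homo = λ i → trans (⟦⟧′≈ (ℤ.- i)) (trans (⟦⟧-neg i) (sym (-‿cong (⟦⟧′≈ i))))
      ; 0-homo = refl
      ; 1-homo = refl }

    _≟⟦⟧_ : ∀ i j → Maybe (⟦ i ⟧′ ≈ ⟦ j ⟧′)
    i ≟⟦⟧ j = Maybe.map (λ { ≡.refl → refl }) (dec⇒weaklyDec ℤ._≟_ i j)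

  open Algebra.Solver.Ring _ (fromCommutativeRing R) homomorphism _≟⟦⟧_ public
    using (solve; _:=_; _:+_; _:*_; _:-_; :-_; con; Polynomial)

  :0 :1 : ∀ {n} → Polynomial n
  :0 = con (ℤ.+ 0)
  :1 = con (ℤ.+ 1)

-- Commutative rings

C-absorption : ∀ n k → suc k ℕ.* (suc n C suc k) ≡ suc n ℕ.* (n C k)
C-absorption zero    zero    = ≡.refl
C-absorption zero    (suc k) = begin
  suc (suc k) ℕ.* (1 C suc (suc k))   ≡⟨ ≡.cong (suc (suc k) ℕ.*_) (k>n⇒nCk≡0 {1} {suc (suc k)} (ℕ.s≤s (ℕ.s≤s ℕ.z≤n))) ⟩
  suc (suc k) ℕ.* 0                   ≡⟨ ℕ.*-zeroʳ (suc (suc k)) ⟩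
  0                                   ≡⟨ k>n⇒nCk≡0 {0} {suc k} (ℕ.s≤s ℕ.z≤n) ⟨
  0 C suc k                           ≡⟨ ℕ.*-identityˡ _ ⟨
  1 ℕ.* (0 C suc k)                   ∎
  where open ≡.≡-Reasoning
C-absorption (suc n) zero    = begin
  1 ℕ.* (suc (suc n) C 1)     ≡⟨ ℕ.*-identityˡ _ ⟩
  suc (suc n) C 1             ≡⟨ nC1≡n (suc (suc n)) ⟩
  suc (suc n)                 ≡⟨ ℕ.*-identityʳ _ ⟨
  suc (suc n) ℕ.* 1           ≡⟨ ≡.cong (suc (suc n) ℕ.*_) (≡.sym (≡.trans (nCk≡nC[n∸k] {0} {suc n} ℕ.z≤n) (nCn≡1 (suc n)))) ⟩
  suc (suc n) ℕ.* (suc n C 0) ∎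
  where open ≡.≡-Reasoning
C-absorption (suc n) (suc k) = begin
  suc (suc k) ℕ.* (suc (suc n) C suc (suc k))
    ≡⟨ ≡.cong (suc (suc k) ℕ.*_) (nCk+nC[k+1]≡[n+1]C[k+1] (suc n) (suc k)) ⟨
  suc (suc k) ℕ.* (a ℕ.+ b)
    ≡⟨ expand (suc k) a b ⟩
  a ℕ.+ (suc k ℕ.* a ℕ.+ suc (suc k) ℕ.* b)
    ≡⟨ ≡.cong (a ℕ.+_) (≡.cong₂ ℕ._+_ (C-absorption n k) (C-absorption n (suc k))) ⟩
  a ℕ.+ (suc n ℕ.* (n C k) ℕ.+ suc n ℕ.* (n C suc k))
    ≡⟨ ≡.cong (a ℕ.+_) (ℕ.*-distribˡ-+ (suc n) (n C k) (n C suc k)) ⟨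
  a ℕ.+ suc n ℕ.* (n C k ℕ.+ n C suc k)
    ≡⟨ ≡.cong (λ x → a ℕ.+ suc n ℕ.* x) (nCk+nC[k+1]≡[n+1]C[k+1] n k) ⟩
  suc (suc n) ℕ.* (suc n C suc k) ∎
  where
  open ≡.≡-Reasoning
  a = suc n C suc k
  b = suc n C suc (suc k)
  expand : ∀ k a b → suc k ℕ.* (a ℕ.+ b) ≡ a ℕ.+ (k ℕ.* a ℕ.+ suc k ℕ.* b)
  expand = solve-∀

-- By `C-absorption`, p divides k * (p C k), and it cannot divide k itself.
prime∣C : ∀ {p k} → Prime p → 0 ℕ.< k → k ℕ.< p → p ℕ.∣ p C k
prime∣C {suc n} {suc k} pr _ k<p
  with euclidsLemma (suc k) (suc n C suc k) pr
         (ℕ.divides (n C k) (≡.trans (C-absorption n k) (ℕ.*-comm (suc n) (n C k))))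
... | inj₁ p∣k = ⊥-elim (ℕ.<⇒≱ k<p (ℕ.∣⇒≤ p∣k))
... | inj₂ p∣C = p∣C

module RingProperties {c ℓ : Level} (R : CommutativeRing c ℓ) where
  open CommutativeRing R hiding (zero)
  open Algebra.Properties.Ring ring
  open Algebra.Properties.Semiring.Mult semiring public renaming (_×_ to _·_)
  open Algebra.Properties.Semiring.Exp semiring public
  open Algebra.Properties.CommutativeSemiring.Exp commutativeSemiring public using (^-distrib-*)
  open Algebra.Properties.Semiring.Sum semiring using (sum; sum-cong-≋; sum-init-last)
  open IntegerCoefficients R public
  open Relation.Binary.Reasoning.Setoid setoid

  infix 4 _∣_
  _∣_ : Carrier → Carrier → Set (c ⊔ ℓ)
  x ∣ y = ∃[ z ] y ≈ x * z

  fromℕ# : ℕ → Carrier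
  fromℕ# n = n · 1#

  ∣-respʳ : ∀ {x y y′} → y ≈ y′ → x ∣ y → x ∣ y′
  ∣-respʳ e (z , e′) = z , trans (sym e) e′

  ∣-+ : ∀ {x y y′} → x ∣ y → x ∣ y′ → x ∣ y + y′
  ∣-+ {x} (z , e) (z′ , e′) = z + z′ , trans (+-cong e e′) (sym (distribˡ x z z′))

  ∣-* : ∀ {x y} w → x ∣ y → x ∣ y * w
  ∣-* {x} w (z , e) = z * w , trans (*-congʳ e) (*-assoc x z w)

  ∣-trans : ∀ {x y z} → x ∣ y → y ∣ z → x ∣ z
  ∣-trans {x} (a , e) (b , e′) = a * b , trans e′ (trans (*-congʳ e) (*-assoc x a b))

  ∣-sum : ∀ {x n} (f : Fin n → Carrier) → (∀ i → x ∣ f i) → x ∣ sum f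
  ∣-sum {x} {zero}  f d = 0# , sym (zeroʳ x)
  ∣-sum {x} {suc n} f d = ∣-+ (d zero) (∣-sum (λ i → f (suc i)) (λ i → d (suc i)))

  ·≈fromℕ#* : ∀ n x → n · x ≈ fromℕ# n * x
  ·≈fromℕ#* n x = sym (trans (×-assoc-* n 1# x) (×-congʳ n (*-identityˡ x)))

  fromℕ#-* : ∀ m n → fromℕ# (m ℕ.* n) ≈ fromℕ# m * fromℕ# n
  fromℕ#-* = ×1-homo-*

  fromℕ#-^ : ∀ m n → fromℕ# (m ℕ.^ n) ≈ fromℕ# m ^ n
  fromℕ#-^ m zero    = +-identityʳ 1#
  fromℕ#-^ m (suc n) = trans (fromℕ#-* m (m ℕ.^ n)) (*-congˡ (fromℕ#-^ m n))

  1^ : ∀ n → 1# ^ n ≈ 1#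
  1^ zero    = refl
  1^ (suc n) = trans (*-identityˡ _) (1^ n)

  +-^ : ∀ n a b → ∃[ s ] (a + b) ^ n ≈ a ^ n + b * s
  +-^ zero    a b = 0# , sym (trans (+-congˡ (zeroʳ b)) (+-identityʳ 1#))
  +-^ (suc n) a b with s , e ← +-^ n a b = a ^ n + (a + b) * s , (begin
    (a + b) * (a + b) ^ n               ≈⟨ *-congˡ e ⟩
    (a + b) * (a ^ n + b * s)           ≈⟨ solve 4 (λ a b c s → (a :+ b) :* (c :+ b :* s) := a :* c :+ b :* (c :+ (a :+ b) :* s)) refl a b (a ^ n) s ⟩
    a * a ^ n + b * (a ^ n + (a + b) * s)  ∎)

  -- All inner binomial coefficients carry p. The term linear in y is split off because, after
  -- division by y at x = 1, it supplies the 1 in the factor 1 + y * t of the Eisenstein relation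
  -- below.
  binomial-prime : ∀ {p} → Prime p → ∀ x y →
    ∃[ t ] (x + y) ^ p ≈ x ^ p + (y ^ p + fromℕ# p * (x * y * (x ^ (p ℕ.∸ 2) + y * t)))
  binomial-prime {zero}         pr x y with () ← prime⇒nonTrivial pr
  binomial-prime {suc zero}     pr x y with () ← prime⇒nonTrivial pr
  binomial-prime {suc (suc m)}  pr x y = proj₁ mid , (begin
    (x + y) ^ p
      ≈⟨ ^-congˡ p (+-comm x y) ⟩
    (y + x) ^ p
      ≈⟨ Binomial.theorem p y x ⟩
    term zero + (term (suc zero) + sum (λ (i : Fin (suc m)) → term (suc (suc i))))
      ≈⟨ +-cong term₀ (+-cong term₁ (trans (sum-init-last {m} (λ i → term (suc (suc i)))) (+-cong (proj₂ mid) termₚ))) ⟩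
    x ^ p + (P * (x * y * x ^ m) + (P * (x * y * y) * proj₁ mid + y ^ p))
      ≈⟨ solve 7 (λ a b P x y c t → a :+ (P :* (x :* y :* c) :+ (P :* (x :* y :* y) :* t :+ b)) :=
                                    a :+ (b :+ P :* (x :* y :* (c :+ y :* t)))) refl
                 (x ^ p) (y ^ p) P x y (x ^ m) (proj₁ mid) ⟩
    x ^ p + (y ^ p + P * (x * y * (x ^ m + y * proj₁ mid))) ∎)
    where
    p = suc (suc m)
    P = fromℕ# p
    module Binomial = Algebra.Properties.CommutativeSemiring.Binomial commutativeSemiring
    term : Fin (suc p) → Carrier
    term = Binomial.binomialTerm y x p
    term₀ : term zero ≈ x ^ p
    term₀ = trans (×-cong (≡.trans (nCk≡nC[n∸k] {0} {p} ℕ.z≤n) (nCn≡1 p)) (*-identityˡ _)) (×-homo-1 _)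
    term₁ : term (suc zero) ≈ P * (x * y * x ^ m)
    term₁ = trans (×-congˡ (nC1≡n p)) (trans (·≈fromℕ#* p _)
      (*-congˡ (trans (*-cong (*-identityʳ y) refl)
        (trans (sym (*-assoc y x _)) (*-congʳ (*-comm y x))))))
    termₚ : term (suc (suc (fromℕ m))) ≈ y ^ p
    termₚ = begin
      (p C (2 ℕ.+ toℕ (fromℕ m))) · (y ^ (2 ℕ.+ toℕ (fromℕ m)) * x ^ (p ℕ.∸ (2 ℕ.+ toℕ (fromℕ m))))
        ≡⟨ ≡.cong (λ k → (p C (2 ℕ.+ k)) · (y ^ (2 ℕ.+ k) * x ^ (m ℕ.∸ k))) (toℕ-fromℕ m) ⟩
      (p C p) · (y ^ p * x ^ (m ℕ.∸ m))
        ≈⟨ ×-cong (nCn≡1 p) (*-congˡ (^-congʳ x (ℕ.n∸n≡0 m))) ⟩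
      1 · (y ^ p * 1#)
        ≈⟨ trans (×-homo-1 _) (*-identityʳ _) ⟩
      y ^ p ∎
    term-mid : ∀ i → P * (x * y * y) ∣ term (suc (suc (inject₁ i)))
    term-mid i = fromℕ# e * (y ^ k * x ^ (m ℕ.∸ suc k)) , (begin
      (p C (2 ℕ.+ toℕ (inject₁ i))) · (y ^ (2 ℕ.+ toℕ (inject₁ i)) * x ^ (m ℕ.∸ toℕ (inject₁ i)))
        ≡⟨ ≡.cong (λ k → (p C (2 ℕ.+ k)) · (y ^ (2 ℕ.+ k) * x ^ (m ℕ.∸ k))) (toℕ-inject₁ i) ⟩
      (p C (2 ℕ.+ k)) · (y ^ (2 ℕ.+ k) * x ^ (m ℕ.∸ k))
        ≈⟨ ×-cong (ℕ._∣_.equality p∣C) (*-congˡ (^-congʳ x (ℕ.+-∸-assoc 1 k<m))) ⟩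
      (e ℕ.* p) · (y ^ (2 ℕ.+ k) * x ^ suc (m ℕ.∸ suc k))
        ≈⟨ trans (·≈fromℕ#* (e ℕ.* p) _) (*-congʳ (fromℕ#-* e p)) ⟩
      fromℕ# e * P * (y ^ (2 ℕ.+ k) * x ^ suc (m ℕ.∸ suc k))
        ≈⟨ solve 6 (λ e P x y b a → e :* P :* ((y :* (y :* b)) :* (x :* a)) :=
                                    P :* (x :* y :* y) :* (e :* (b :* a))) refl
                   (fromℕ# e) P x y (y ^ k) (x ^ (m ℕ.∸ suc k)) ⟩
      P * (x * y * y) * (fromℕ# e * (y ^ k * x ^ (m ℕ.∸ suc k))) ∎)
      where
      k = toℕ i
      k<m : k ℕ.< m
      k<m = toℕ<n i
      p∣C : p ℕ.∣ p C (2 ℕ.+ k)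
      p∣C = prime∣C pr (ℕ.s≤s ℕ.z≤n) (ℕ.s≤s (ℕ.s≤s k<m))
      e = ℕ.quotient p∣C
    mid : P * (x * y * y) ∣ sum (λ (i : Fin m) → term (suc (suc (inject₁ i))))
    mid = ∣-sum {n = m} _ term-mid

-- Quotients, Frobenius and the radical property

module Quotient {c ℓ : Level} (R : CommutativeRing c ℓ) (π : CommutativeRing.Carrier R) where
  open CommutativeRing R hiding (zero)
  open Algebra.Properties.Ring ring using (-0#≈0#)
  open RingProperties R
  open Relation.Binary.Reasoning.Setoid setoid

  infix 4 _∼_
  record _∼_ (x y : Carrier) : Set (c ⊔ ℓ) where
    constructor mk∼
    field difference : π ∣ x - y
  open _∼_ public

  ≈⇒∼ : ∀ {x y} → x ≈ y → x ∼ y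
  ≈⇒∼ {x} {y} e = mk∼ (0# , trans (+-congʳ e) (trans (-‿inverseʳ y) (sym (zeroʳ π))))

  ∣⇒∼0 : ∀ {x} → π ∣ x → x ∼ 0#
  ∣⇒∼0 {x} d = mk∼ (∣-respʳ (trans (sym (+-identityʳ x)) (+-congˡ (sym -0#≈0#))) d)

  ∼0⇒∣ : ∀ {x} → x ∼ 0# → π ∣ x
  ∼0⇒∣ {x} (mk∼ d) = ∣-respʳ (trans (+-congˡ -0#≈0#) (+-identityʳ x)) d

  ∼-sym : ∀ {x y} → x ∼ y → y ∼ x
  ∼-sym {x} {y} (mk∼ (z , e)) = mk∼ (- z , (begin
    y - x         ≈⟨ solve 2 (λ x y → y :- x := :- (x :- y)) refl x y ⟩
    - (x - y)     ≈⟨ -‿cong e ⟩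
    - (π * z)     ≈⟨ solve 2 (λ a b → :- (a :* b) := a :* (:- b)) refl π z ⟩
    π * - z       ∎))

  ∼-trans : ∀ {x y z} → x ∼ y → y ∼ z → x ∼ z
  ∼-trans {x} {y} {z} (mk∼ d) (mk∼ d′) =
    mk∼ (∣-respʳ (solve 3 (λ x y z → (x :- y) :+ (y :- z) := x :- z) refl x y z) (∣-+ d d′))

  ∼-+ : ∀ {x x′ y y′} → x ∼ x′ → y ∼ y′ → x + y ∼ x′ + y′
  ∼-+ {x} {x′} {y} {y′} (mk∼ d) (mk∼ d′) =
    mk∼ (∣-respʳ (solve 4 (λ x x′ y y′ → (x :- x′) :+ (y :- y′) := (x :+ y) :- (x′ :+ y′)) refl x x′ y y′)
                 (∣-+ d d′))

  ∼-* : ∀ {x x′ y y′} → x ∼ x′ → y ∼ y′ → x * y ∼ x′ * y′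
  ∼-* {x} {x′} {y} {y′} (mk∼ d) (mk∼ d′) =
    mk∼ (∣-respʳ (solve 4 (λ x x′ y y′ → (x :- x′) :* y :+ (y :- y′) :* x′ := x :* y :- x′ :* y′)
                          refl x x′ y y′)
                 (∣-+ (∣-* y d) (∣-* x′ d′)))

  ∼-neg : ∀ {x y} → x ∼ y → - x ∼ - y
  ∼-neg {x} {y} x∼y = mk∼ (∣-respʳ (solve 2 (λ x y → y :- x := (:- x) :- (:- y)) refl x y)
                                  (difference (∼-sym x∼y)))

  quotientRing : CommutativeRing c (c ⊔ ℓ)
  quotientRing = record
    { Carrier = Carrier ; _≈_ = _∼_ ; _+_ = _+_ ; _*_ = _*_ ; -_ = -_ ; 0# = 0# ; 1# = 1#
    ; isCommutativeRing = record
      { isRing = record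
        { +-isAbelianGroup = record
          { isGroup = record
            { isMonoid = record
              { isSemigroup = record
                { isMagma = record
                  { isEquivalence = record { refl = ≈⇒∼ refl ; sym = ∼-sym ; trans = ∼-trans }
                  ; ∙-cong = ∼-+
                  }
                ; assoc = λ x y z → ≈⇒∼ (+-assoc x y z)
                }
              ; identity = (λ x → ≈⇒∼ (+-identityˡ x)) , (λ x → ≈⇒∼ (+-identityʳ x))
              }
            ; inverse = (λ x → ≈⇒∼ (-‿inverseˡ x)) , (λ x → ≈⇒∼ (-‿inverseʳ x))
            ; ⁻¹-cong = ∼-neg
            }
          ; comm = λ x y → ≈⇒∼ (+-comm x y)
          }
        ; *-cong = ∼-*
        ; *-assoc = λ x y z → ≈⇒∼ (*-assoc x y z)
        ; *-identity = (λ x → ≈⇒∼ (*-identityˡ x)) , (λ x → ≈⇒∼ (*-identityʳ x))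
        ; distrib = (λ x y z → ≈⇒∼ (distribˡ x y z)) , (λ x y z → ≈⇒∼ (distribʳ x y z))
        }
      ; *-comm = λ x y → ≈⇒∼ (*-comm x y)
      }
    }

module Frobenius {c ℓ : Level} (R : CommutativeRing c ℓ) {p : ℕ} (pr : Prime p) where
  open CommutativeRing R hiding (zero)
  open Algebra.Properties.Ring ring using (x+x≈x⇒x≈0; +-inverseʳ-unique)
  open RingProperties R
  open Evaluation R using (ev)
  open Relation.Binary.Reasoning.Setoid setoid

  module _ (p≈0 : fromℕ# p ≈ 0#) where
    frobenius₁ : ∀ x y → (x + y) ^ p ≈ x ^ p + y ^ p
    frobenius₁ x y = begin
      (x + y) ^ p                        ≈⟨ proj₂ (binomial-prime pr x y) ⟩
      x ^ p + (y ^ p + fromℕ# p * _)     ≈⟨ +-congˡ (+-congˡ (trans (*-congʳ p≈0) (zeroˡ _))) ⟩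
      x ^ p + (y ^ p + 0#)               ≈⟨ +-congˡ (+-identityʳ _) ⟩
      x ^ p + y ^ p                      ∎

    frobenius : ∀ J x y → (x + y) ^ (p ℕ.^ J) ≈ x ^ (p ℕ.^ J) + y ^ (p ℕ.^ J)
    frobenius zero    x y = distribʳ 1# x y
    frobenius (suc J) x y = begin
      (x + y) ^ (p ℕ.* q)               ≈⟨ ^-assocʳ (x + y) p q ⟨
      ((x + y) ^ p) ^ q                 ≈⟨ ^-congˡ q (frobenius₁ x y) ⟩
      (x ^ p + y ^ p) ^ q               ≈⟨ frobenius J (x ^ p) (y ^ p) ⟩
      (x ^ p) ^ q + (y ^ p) ^ q         ≈⟨ +-cong (^-assocʳ x p q) (^-assocʳ y p q) ⟩
      x ^ (p ℕ.* q) + y ^ (p ℕ.* q)     ∎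
      where q = p ℕ.^ J

    frobenius-0 : ∀ J → 0# ^ (p ℕ.^ J) ≈ 0#
    frobenius-0 J = x+x≈x⇒x≈0 _ (trans (sym (frobenius J 0# 0#)) (^-congˡ (p ℕ.^ J) (+-identityˡ 0#)))

    ev-frobenius : ∀ J {G : Set} (f : G → Carrier) P → ev f P ^ (p ℕ.^ J) ≈ ev (λ g → f g ^ (p ℕ.^ J)) P
    ev-frobenius J f 𝟘       = frobenius-0 J
    ev-frobenius J f ⟨ g ⟩   = refl
    ev-frobenius J f (P ⊕ Q) = trans (frobenius J _ _) (+-cong (ev-frobenius J f P) (ev-frobenius J f Q))
    -- The sign comes out of additivity, so p = 2 is no exception.
    ev-frobenius J f (⊖ P)   = begin
      (- X) ^ q     ≈⟨ +-inverseʳ-unique (X ^ q) ((- X) ^ q)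
                         (trans (sym (frobenius J X (- X))) (trans (^-congˡ q (-‿inverseʳ X)) (frobenius-0 J))) ⟩
      - (X ^ q)     ≈⟨ -‿cong (ev-frobenius J f P) ⟩
      - ev _ P      ∎
      where
      X = ev f P
      q = p ℕ.^ J

  -- One p-th power already gains a factor p: the cross terms of the binomial carry p * Q, and (Q *
  -- z)^p contains Q², of which p * Q is a divisor. The remaining powers preserve the congruence by
  -- `+-^`.
  power-lift : ∀ k y z J → 1 ℕ.≤ J → ∃[ w ]
    (y + fromℕ# (p ℕ.^ suc k) * z) ^ (p ℕ.^ J) ≈ y ^ (p ℕ.^ J) + fromℕ# (p ℕ.^ suc (suc k)) * w
  power-lift k y z (suc J) _ = v * proj₁ outer′ , (begin
    (y + Q * z) ^ (p ℕ.* q)                  ≈⟨ ^-assocʳ _ p q ⟨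
    ((y + Q * z) ^ p) ^ q                    ≈⟨ ^-congˡ q inner ⟩
    (y ^ p + Q′ * v) ^ q                     ≈⟨ proj₂ outer′ ⟩
    (y ^ p) ^ q + Q′ * v * proj₁ outer′      ≈⟨ +-cong (^-assocʳ y p q) (*-assoc Q′ v _) ⟩
    y ^ (p ℕ.* q) + Q′ * (v * proj₁ outer′)  ∎)
    where
    q = p ℕ.^ J
    m = p ℕ.∸ 2
    Q = fromℕ# (p ℕ.^ suc k)
    Q₀ = fromℕ# (p ℕ.^ k)
    Q′ = fromℕ# (p ℕ.^ suc (suc k))
    binomial = binomial-prime pr y (Q * z)
    v = Q₀ * z * (z * (Q * z) ^ m) + y * z * (y ^ m + Q * z * proj₁ binomial)
    outer′ = +-^ q (y ^ p) (Q′ * v)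
    inner : (y + Q * z) ^ p ≈ y ^ p + Q′ * v
    inner = begin
      (y + Q * z) ^ p
        ≈⟨ proj₂ binomial ⟩
      y ^ p + ((Q * z) ^ p + fromℕ# p * (y * (Q * z) * (y ^ m + Q * z * proj₁ binomial)))
        ≈⟨ +-congˡ (+-congʳ (trans (^-congʳ (Q * z) (≡.sym (ℕ.m+[n∸m]≡n (ℕ.nonTrivial⇒n>1 p {{prime⇒nonTrivial pr}}))))
             (*-cong (*-congʳ (fromℕ#-* p (p ℕ.^ k))) refl))) ⟩
      y ^ p + (fromℕ# p * Q₀ * z * (Q * z * (Q * z) ^ m) + fromℕ# p * (y * (Q * z) * (y ^ m + Q * z * proj₁ binomial)))
        ≈⟨ solve 8 (λ a P Q₀ z Q b y d → a :+ (P :* Q₀ :* z :* (Q :* z :* b) :+ P :* (y :* (Q :* z) :* d)) :=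
                     a :+ P :* Q :* (Q₀ :* z :* (z :* b) :+ y :* z :* d)) refl
                   (y ^ p) (fromℕ# p) Q₀ z Q ((Q * z) ^ m) y (y ^ m + Q * z * proj₁ binomial) ⟩
      y ^ p + fromℕ# p * Q * v
        ≈⟨ +-congˡ (*-congʳ (fromℕ#-* p (p ℕ.^ suc k))) ⟨
      y ^ p + Q′ * v ∎

module Radical {c ℓ : Level} (R : CommutativeRing c ℓ) {p : ℕ} (pr : Prime p)
               (π : CommutativeRing.Carrier R) where
  open CommutativeRing R hiding (zero)
  open RingProperties R
  open Evaluation R using (ev)
  open Quotient R π
  private
    module Q = CommutativeRing quotientRing
    module QP = RingProperties quotientRing
    module QE = Evaluation quotientRing
  open Relation.Binary.Reasoning.Setoid Q.setoid

  private
    ev≡ : {G : Set} (f : G → Carrier) → ∀ P → ev f P ≡ QE.ev f P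
    ev≡ f 𝟘       = ≡.refl
    ev≡ f ⟨ g ⟩   = ≡.refl
    ev≡ f (P ⊕ Q) = ≡.cong₂ _+_ (ev≡ f P) (ev≡ f Q)
    ev≡ f (⊖ P)   = ≡.cong -_ (ev≡ f P)

    ^≡ : ∀ x n → x QP.^ n ≡ x ^ n
    ^≡ x zero    = ≡.refl
    ^≡ x (suc n) = ≡.cong (x *_) (^≡ x n)

    ·≡ : ∀ n x → n QP.· x ≡ n · x
    ·≡ zero    x = ≡.refl
    ·≡ (suc n) x = ≡.cong (x +_) (·≡ n x)

  -- Modulo π the q-th power map is additive, where q = p^J, so it exchanges X and X̄. From X X̄ ≡ 0
  -- follow in turn X² ≡ X X̄^q ≡ 0, then X̄ ≡ X^q ≡ 0 because q ≥ 2, and finally X ≡ X̄^q ≡ 0.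
  radical : ∀ J → 1 ℕ.≤ J → π ∣ fromℕ# p → {G : Set} (f f̄ : G → Carrier) →
            (∀ g → f g ^ (p ℕ.^ J) ∼ f̄ g) → (∀ g → f̄ g ^ (p ℕ.^ J) ∼ f g) →
            ∀ P → π ∣ ev f P * ev f̄ P → π ∣ ev f P
  radical (suc J) _ π∣p f f̄ e ē P π∣XX̄ = ∼0⇒∣ (begin
    X                          ≈⟨ conjugate f̄ f ē ⟨
    X̄ QP.^ q                   ≡⟨ ≡.cong (X̄ QP.^_) q≡ ⟩
    X̄ * X̄ QP.^ suc q′          ≈⟨ Q.*-congʳ X̄∼0 ⟩
    0# * X̄ QP.^ suc q′         ≈⟨ Q.zeroˡ _ ⟩
    0#                         ∎)
    where
    q = p ℕ.^ suc J
    X = ev f P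
    X̄ = ev f̄ P
    XX̄∼0 : X * X̄ ∼ 0#
    XX̄∼0 = ∣⇒∼0 π∣XX̄
    p∼0 : QP.fromℕ# p ∼ 0#
    p∼0 = Q.trans (Q.reflexive (·≡ p 1#)) (∣⇒∼0 π∣p)
    1<q : 1 ℕ.< q
    1<q = ℕ.≤-trans (ℕ.nonTrivial⇒n>1 p {{prime⇒nonTrivial pr}})
            (ℕ.m≤m*n p (p ℕ.^ J) {{ℕ.m^n≢0 p J {{prime⇒nonZero pr}}}})
    q′ = q ℕ.∸ 2
    q≡ : q ≡ suc (suc q′)
    q≡ = ≡.sym (ℕ.m+[n∸m]≡n 1<q)
    conjugate : ∀ f f̄ → (∀ g → f g ^ q ∼ f̄ g) → ev f P QP.^ q ∼ ev f̄ P
    conjugate f f̄ e = begin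
      ev f P QP.^ q                     ≡⟨ ≡.cong (QP._^ q) (ev≡ f P) ⟩
      QE.ev f P QP.^ q                  ≈⟨ Frobenius.ev-frobenius quotientRing pr p∼0 (suc J) f P ⟩
      QE.ev (λ g → f g QP.^ q) P        ≈⟨ QE.ev-cong (λ g → Q.trans (Q.reflexive (^≡ (f g) q)) (e g)) P ⟩
      QE.ev f̄ P                         ≡⟨ ev≡ f̄ P ⟨
      ev f̄ P                            ∎
    X²∼0 : X * X ∼ 0#
    X²∼0 = begin
      X * X                             ≈⟨ Q.*-congˡ {X} (conjugate f̄ f ē) ⟨
      X * X̄ QP.^ q                      ≡⟨ ≡.cong (λ n → X * X̄ QP.^ n) q≡ ⟩
      X * (X̄ * X̄ QP.^ suc q′)           ≈⟨ Q.*-assoc X X̄ _ ⟨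
      X * X̄ * X̄ QP.^ suc q′             ≈⟨ Q.*-congʳ XX̄∼0 ⟩
      0# * X̄ QP.^ suc q′                ≈⟨ Q.zeroˡ _ ⟩
      0#                                ∎
    X̄∼0 : X̄ ∼ 0#
    X̄∼0 = begin
      X̄                                 ≈⟨ conjugate f f̄ e ⟨
      X QP.^ q                          ≡⟨ ≡.cong (X QP.^_) q≡ ⟩
      X * (X * X QP.^ q′)               ≈⟨ Q.*-assoc X X _ ⟨
      X * X * X QP.^ q′                 ≈⟨ Q.*-congʳ X²∼0 ⟩
      0# * X QP.^ q′                    ≈⟨ Q.zeroˡ _ ⟩
      0#                                ∎

-- Geometric sums and total ramification

module Geometric {c ℓ : Level} (R : CommutativeRing c ℓ) where
  open CommutativeRing R hiding (zero)
  open RingProperties R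
  open Relation.Binary.Reasoning.Setoid setoid

  geometric : ℕ → Carrier → Carrier
  geometric zero    x = 0#
  geometric (suc n) x = 1# + x * geometric n x

  geometric-cong : ∀ n {x y} → x ≈ y → geometric n x ≈ geometric n y
  geometric-cong zero    e = refl
  geometric-cong (suc n) e = +-congˡ (*-cong e (geometric-cong n e))

  geometric-telescope : ∀ n x → x ^ n ≈ 1# + (x - 1#) * geometric n x
  geometric-telescope zero    x = sym (trans (+-congˡ (zeroʳ _)) (+-identityʳ 1#))
  geometric-telescope (suc n) x = begin
    x * x ^ n                                   ≈⟨ *-congˡ (geometric-telescope n x) ⟩
    x * (1# + (x - 1#) * geometric n x)
      ≈⟨ solve 2 (λ x g → x :* (:1 :+ (x :- :1) :* g) :=
                          :1 :+ (x :- :1) :* (:1 :+ x :* g)) refl x (geometric n x) ⟩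
    1# + (x - 1#) * (1# + x * geometric n x)    ∎

  geometric-last : ∀ n x → geometric (suc n) x ≈ geometric n x + x ^ n
  geometric-last zero    x = trans (+-congˡ (zeroʳ x)) (+-comm 1# 0#)
  geometric-last (suc n) x = begin
    1# + x * geometric (suc n) x              ≈⟨ +-congˡ (*-congˡ (geometric-last n x)) ⟩
    1# + x * (geometric n x + x ^ n)          ≈⟨ +-congˡ (distribˡ x _ _) ⟩
    1# + (x * geometric n x + x * x ^ n)      ≈⟨ +-assoc 1# _ _ ⟨
    geometric (suc n) x + x ^ suc n           ∎

  geometric-inverse : ∀ n {x x⁻¹} → x * x⁻¹ ≈ 1# → x ^ n * geometric (suc n) x⁻¹ ≈ geometric (suc n) x
  geometric-inverse zero    {x} {y} e = trans (*-identityˡ _) (+-congˡ (trans (zeroʳ y) (sym (zeroʳ x))))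
  geometric-inverse (suc n) {x} {y} e = begin
    x * x ^ n * (1# + y * geometric (suc n) y)
      ≈⟨ solve 4 (λ x y a g → x :* a :* (:1 :+ y :* g) := x :* y :* (a :* g) :+ x :* a) refl
                 x y (x ^ n) (geometric (suc n) y) ⟩
    x * y * (x ^ n * geometric (suc n) y) + x ^ suc n
      ≈⟨ +-congʳ (trans (*-congʳ e) (*-identityˡ _)) ⟩
    x ^ n * geometric (suc n) y + x ^ suc n
      ≈⟨ +-congʳ (geometric-inverse n e) ⟩
    geometric (suc n) x + x ^ suc n
      ≈⟨ geometric-last (suc n) x ⟨
    geometric (suc (suc n)) x ∎

  x-1∣x^n-1 : ∀ n x → x - 1# ∣ x ^ n - 1#
  x-1∣x^n-1 n x = geometric n x , (begin
    x ^ n - 1#                                 ≈⟨ +-congʳ (geometric-telescope n x) ⟩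
    1# + (x - 1#) * geometric n x - 1#         ≈⟨ solve 1 (λ a → :1 :+ a :- :1 := a) refl _ ⟩
    (x - 1#) * geometric n x                   ∎)

  x-1∣geometric-n : ∀ n x → x - 1# ∣ geometric n x - fromℕ# n
  x-1∣geometric-n zero    x = 0# , trans (-‿inverseʳ 0#) (sym (zeroʳ _))
  x-1∣geometric-n (suc n) x with z , e ← x-1∣geometric-n n x = geometric n x + z , (begin
    1# + x * g - (1# + fromℕ# n)
      ≈⟨ solve 3 (λ x g n → :1 :+ x :* g :- (:1 :+ n) := (x :- :1) :* g :+ (g :- n)) refl x g (fromℕ# n) ⟩
    (x - 1#) * g + (g - fromℕ# n)       ≈⟨ +-congˡ e ⟩
    (x - 1#) * g + (x - 1#) * z         ≈⟨ distribˡ _ g z ⟨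
    (x - 1#) * (g + z)                  ∎)
    where g = geometric n x

-- For θ = η ^ p^A a root of 1 + X + … + X^(p-1), the prime p is totally ramified: it is
-- associate to a power of η - 1.
module Ramification {c ℓ : Level} (R : CommutativeRing c ℓ) {p : ℕ} (pr : Prime p)
  (torsionFree : ∀ x → CommutativeRing._≈_ R (CommutativeRing._*_ R (RingProperties.fromℕ# R p) x) (CommutativeRing.0# R) →
                 CommutativeRing._≈_ R x (CommutativeRing.0# R))
  (η : CommutativeRing.Carrier R) (A : ℕ)
  (sum≈0 : CommutativeRing._≈_ R (Geometric.geometric R p (RingProperties._^_ R η (p ℕ.^ A))) (CommutativeRing.0# R)) where
  open CommutativeRing R hiding (zero)
  open Algebra.Properties.Ring ring using (-0#≈0#)
  open RingProperties R
  open Geometric R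
  open Relation.Binary.Reasoning.Setoid setoid

  private
    P y θ Y : Carrier
    P = fromℕ# p
    y = η - 1#
    θ = η ^ (p ℕ.^ A)
    Y = θ - 1#

    p′ = p ℕ.∸ 1
    p≡1+p′ : p ≡ suc p′
    p≡1+p′ = ≡.sym (ℕ.m+[n∸m]≡n (ℕ.>-nonZero⁻¹ p {{prime⇒nonZero pr}}))

    q≡ : ∀ B → p ℕ.^ B ≡ suc (p ℕ.^ B ℕ.∸ 1)
    q≡ B = ≡.sym (ℕ.m+[n∸m]≡n (ℕ.m^n>0 p {{prime⇒nonZero pr}} B))

    -- Modulo Y every power of θ becomes 1, so the vanishing sum of p powers becomes p.
    Y∣P : Y ∣ P
    Y∣P with z , e ← x-1∣geometric-n p θ = - z , (begin
      P                        ≈⟨ solve 2 (λ a b → a := b :- (b :- a)) refl P (geometric p θ) ⟩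
      geometric p θ - (geometric p θ - P) ≈⟨ +-cong sum≈0 (-‿cong e) ⟩
      0# - Y * z               ≈⟨ solve 2 (λ a b → :0 :- a :* b := a :* (:- b)) refl Y z ⟩
      Y * - z                  ∎)

    Y-cancel : ∀ x → Y * x ≈ 0# → x ≈ 0#
    Y-cancel x e with z , e′ ← Y∣P = torsionFree x (begin
      P * x        ≈⟨ *-congʳ e′ ⟩
      Y * z * x    ≈⟨ solve 3 (λ a b c → a :* b :* c := b :* (a :* c)) refl Y z x ⟩
      z * (Y * x)  ≈⟨ *-congˡ e ⟩
      z * 0#       ≈⟨ zeroʳ z ⟩
      0#           ∎)

    1+Y : 1# + Y ≈ θ
    1+Y = solve 1 (λ a → :1 :+ (a :- :1) := a) refl θ

    -- Expand θ^p = 1 around θ = 1 + Y and cancel one factor Y, which is a non-zero-divisor because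
    -- it divides p.
    eisenstein-θ : ∃[ t ] Y ^ p′ + P * (1# + Y * t) ≈ 0#
    eisenstein-θ with t , e ← binomial-prime pr 1# Y = t , Y-cancel _ (begin
      Y * (Y ^ p′ + P * (1# + Y * t))
        ≈⟨ solve 4 (λ Y a P t → Y :* (a :+ P :* (:1 :+ Y :* t)) :=
                     :1 :+ (Y :* a :+ P :* (:1 :* Y :* (:1 :+ Y :* t))) :- :1) refl Y (Y ^ p′) P t ⟩
      1# + (Y ^ suc p′ + P * (1# * Y * (1# + Y * t))) - 1#
        ≈⟨ +-congʳ (+-cong (1^ p) (+-cong (^-congʳ Y p≡1+p′) (*-congˡ (*-congˡ (+-congʳ (1^ (p ℕ.∸ 2))))))) ⟨
      1# ^ p + (Y ^ p + P * (1# * Y * (1# ^ (p ℕ.∸ 2) + Y * t))) - 1#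
        ≈⟨ +-congʳ e ⟨
      (1# + Y) ^ p - 1#
        ≈⟨ +-congʳ (^-congˡ p 1+Y) ⟩
      θ ^ p - 1#
        ≈⟨ +-congʳ (geometric-telescope p θ) ⟩
      1# + (θ - 1#) * geometric p θ - 1#
        ≈⟨ +-congʳ (+-congˡ (trans (*-congˡ sum≈0) (zeroʳ _))) ⟩
      1# + 0# - 1#
        ≈⟨ trans (+-congʳ (+-identityʳ 1#)) (-‿inverseʳ 1#) ⟩
      0# ∎)

  -- Frobenius modulo p, with the error divisible by p * y and not merely by p. The extra y keeps
  -- the cofactor of p in `Eisenstein` of the form 1 + y * z after substitution.
  1+y^q : ∀ B → ∃[ z ] (1# + y) ^ (p ℕ.^ B) ≈ 1# + (y ^ (p ℕ.^ B) + P * (y * z))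
  1+y^q zero    = 0# , solve 2 (λ y P → (:1 :+ y) :* :1 := :1 :+ (y :* :1 :+ P :* (y :* :0))) refl y P
  1+y^q (suc B) with z , e ← 1+y^q B = z * s + (y ^ q′ + P * z) * (1# + W * t) , (begin
    (1# + y) ^ (p ℕ.* q)
      ≈⟨ trans (^-congʳ (1# + y) (ℕ.*-comm p q)) (sym (^-assocʳ (1# + y) q p)) ⟩
    ((1# + y) ^ q) ^ p
      ≈⟨ ^-congˡ p e ⟩
    (1# + W) ^ p
      ≈⟨ proj₂ (binomial-prime pr 1# W) ⟩
    1# ^ p + (W ^ p + P * (1# * W * (1# ^ (p ℕ.∸ 2) + W * t)))
      ≈⟨ +-cong (1^ p) (+-cong (proj₂ W^p) (*-congˡ (*-congˡ (+-congʳ (1^ (p ℕ.∸ 2)))))) ⟩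
    1# + ((y ^ q) ^ p + P * (y * z) * s + P * (1# * W * (1# + W * t)))
      ≈⟨ +-congˡ (+-cong (+-congʳ (trans (^-assocʳ y q p) (^-congʳ y (ℕ.*-comm q p)))) (*-congˡ (*-congʳ (*-congˡ W≈)))) ⟩
    1# + (y ^ (p ℕ.* q) + P * (y * z) * s + P * (1# * (y * (y ^ q′ + P * z)) * (1# + W * t)))
      ≈⟨ solve 7 (λ a P y z s b d → :1 :+ (a :+ P :* (y :* z) :* s :+ P :* (:1 :* (y :* b) :* d)) :=
                                     :1 :+ (a :+ P :* (y :* (z :* s :+ b :* d)))) refl
                 (y ^ (p ℕ.* q)) P y z s (y ^ q′ + P * z) (1# + W * t) ⟩
    1# + (y ^ (p ℕ.* q) + P * (y * (z * s + (y ^ q′ + P * z) * (1# + W * t)))) ∎)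
    where
    q = p ℕ.^ B
    q′ = q ℕ.∸ 1
    W = y ^ q + P * (y * z)
    t = proj₁ (binomial-prime pr 1# W)
    W^p = +-^ p (y ^ q) (P * (y * z))
    s = proj₁ W^p
    W≈ : W ≈ y * (y ^ q′ + P * z)
    W≈ = trans (+-congʳ (^-congʳ y (q≡ B)))
      (solve 4 (λ y a P z → y :* a :+ P :* (y :* z) := y :* (a :+ P :* z)) refl y (y ^ q′) P z)

  -- This is φ(p^(A+1)), the ramification index of p in the field of p^(A+1)-th roots of unity.
  exponent : ℕ
  exponent = p ℕ.^ A ℕ.* p′

  exponent>0 : 0 ℕ.< exponent
  exponent>0 = ℕ.*-mono-≤ (ℕ.m^n>0 p {{prime⇒nonZero pr}} A) (ℕ.∸-monoˡ-≤ 1 (ℕ.nonTrivial⇒n>1 p {{prime⇒nonTrivial pr}}))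

  Eisenstein : Set (c ⊔ ℓ)
  Eisenstein = ∃[ z ] y ^ exponent + P * (1# + y * z) ≈ 0#

  -- Substitute Y = y^q + p y z with q = p^A: the leading term becomes y^(q(p-1)), and both
  -- corrections are absorbed into p * y.
  eisenstein-lift : ∃[ t ] Y ^ p′ + P * (1# + Y * t) ≈ 0# →
                    ∃[ z ] (1# + y) ^ (p ℕ.^ A) ≈ 1# + (y ^ (p ℕ.^ A) + P * (y * z)) → Eisenstein
  eisenstein-lift (t , e) (z , e′) = z * s + (y ^ q′ + P * z) * t , (begin
    y ^ exponent + P * (1# + y * (z * s + (y ^ q′ + P * z) * t))
      ≈⟨ +-congʳ (sym (^-assocʳ y q p′)) ⟩
    (y ^ q) ^ p′ + P * (1# + y * (z * s + (y ^ q′ + P * z) * t))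
      ≈⟨ solve 7 (λ a P y z s b t → a :+ P :* (:1 :+ y :* (z :* s :+ b :* t)) :=
                                     (a :+ P :* (y :* z) :* s) :+ P :* (:1 :+ (y :* b) :* t)) refl
                 ((y ^ q) ^ p′) P y z s (y ^ q′ + P * z) t ⟩
    ((y ^ q) ^ p′ + P * (y * z) * s) + P * (1# + y * (y ^ q′ + P * z) * t)
      ≈⟨ +-cong (sym (proj₂ W^p′)) (*-congˡ (+-congˡ (*-congʳ (sym W≈)))) ⟩
    W ^ p′ + P * (1# + W * t)
      ≈⟨ +-cong (^-congˡ p′ Y≈W) (*-congˡ (+-congˡ (*-congʳ Y≈W))) ⟨
    Y ^ p′ + P * (1# + Y * t)
      ≈⟨ e ⟩
    0# ∎)
    where
    q = p ℕ.^ A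
    q′ = q ℕ.∸ 1
    W = y ^ q + P * (y * z)
    W^p′ = +-^ p′ (y ^ q) (P * (y * z))
    s = proj₁ W^p′
    Y≈W : Y ≈ W
    Y≈W = begin
      η ^ q - 1#          ≈⟨ +-congʳ (^-congˡ q (solve 1 (λ a → a := :1 :+ (a :- :1)) refl η)) ⟩
      (1# + y) ^ q - 1#   ≈⟨ +-congʳ e′ ⟩
      1# + W - 1#         ≈⟨ solve 1 (λ a → :1 :+ a :- :1 := a) refl W ⟩
      W                   ∎
    W≈ : W ≈ y * (y ^ q′ + P * z)
    W≈ = trans (+-congʳ (^-congʳ y (q≡ A)))
      (solve 4 (λ y a P z → y :* a :+ P :* (y :* z) := y :* (a :+ P :* z)) refl y (y ^ q′) P z)

  eisenstein : Eisenstein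
  eisenstein = eisenstein-lift eisenstein-θ (1+y^q A)

  eisenstein⇒p∣π^e : Eisenstein → P ∣ y ^ exponent
  eisenstein⇒p∣π^e (z , e) = - (1# + y * z) , (begin
    y ^ exponent
      ≈⟨ solve 2 (λ a b → a := (a :+ b) :- b) refl (y ^ exponent) (P * (1# + y * z)) ⟩
    (y ^ exponent + P * (1# + y * z)) - P * (1# + y * z)
      ≈⟨ +-congʳ e ⟩
    0# - P * (1# + y * z)
      ≈⟨ solve 2 (λ a b → :0 :- a :* b := a :* (:- b)) refl P (1# + y * z) ⟩
    P * - (1# + y * z) ∎)

  -- p = - π^e - p π z, so a factor π^i of p on the right gives a factor π^(i+1) on the left.
  eisenstein⇒π^e∣p : Eisenstein → y ^ exponent ∣ P
  eisenstein⇒π^e∣p (z , e) = go exponent ℕ.≤-refl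
    where
    raise : ∀ {i} → i ℕ.< exponent → y ^ i ∣ P → y ^ suc i ∣ P
    raise {i} i<e (d , e′) = - (y ^ (exponent ℕ.∸ suc i) + d * z) , (begin
      P
        ≈⟨ solve 4 (λ P a y z → P := (a :+ P :* (:1 :+ y :* z)) :- (a :+ P :* (y :* z))) refl P (y ^ exponent) y z ⟩
      (y ^ exponent + P * (1# + y * z)) - (y ^ exponent + P * (y * z))
        ≈⟨ +-cong e (-‿cong (+-cong (trans (^-congʳ y (≡.sym (ℕ.m+[n∸m]≡n i<e))) (^-homo-* y (suc i) _)) (*-congʳ e′))) ⟩
      0# - (y ^ suc i * y ^ (exponent ℕ.∸ suc i) + y ^ i * d * (y * z))
        ≈⟨ solve 5 (λ y a b c z → :0 :- ((y :* a) :* b :+ a :* c :* (y :* z)) := (y :* a) :* (:- (b :+ c :* z))) refl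
                   y (y ^ i) (y ^ (exponent ℕ.∸ suc i)) d z ⟩
      y ^ suc i * - (y ^ (exponent ℕ.∸ suc i) + d * z) ∎)
    go : ∀ i → i ℕ.≤ exponent → y ^ i ∣ P
    go zero    _   = P , sym (*-identityˡ P)
    go (suc i) i<e = raise i<e (go i (ℕ.<⇒≤ i<e))

  p∣π^e : P ∣ y ^ exponent
  p∣π^e = eisenstein⇒p∣π^e eisenstein

  π^e∣p : y ^ exponent ∣ P
  π^e∣p = eisenstein⇒π^e∣p eisenstein

-- Descent from X X̄ to X

record Conjugation {c ℓ : Level} (R : CommutativeRing c ℓ) : Set (c ⊔ ℓ) where
  open CommutativeRing R
  field
    conj      : Carrier → Carrier
    conj-cong : ∀ {x y} → x ≈ y → conj x ≈ conj y
    conj-+    : ∀ x y → conj (x + y) ≈ conj x + conj y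
    conj-*    : ∀ x y → conj (x * y) ≈ conj x * conj y
    conj-0    : conj 0# ≈ 0#
    conj-1    : conj 1# ≈ 1#

module Descent {c ℓ : Level} (R : CommutativeRing c ℓ) (conjugation : Conjugation R) where
  open CommutativeRing R hiding (zero)
  open Conjugation conjugation
  open RingProperties R
  open Relation.Binary.Reasoning.Setoid setoid

  Descends : ℕ → Set (c ⊔ ℓ)
  Descends p = ∀ X → fromℕ# p * fromℕ# p ∣ X * conj X → fromℕ# p ∣ X

  NonZeroDivisor : Carrier → Set (c ⊔ ℓ)
  NonZeroDivisor a = ∀ x → a * x ≈ 0# → x ≈ 0#

  nonZeroDivisor-∣ : ∀ {a b} → a ∣ b → NonZeroDivisor b → NonZeroDivisor a
  nonZeroDivisor-∣ {a} {b} (z , e) nz x ax≈0 = nz x (begin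
    b * x        ≈⟨ *-congʳ e ⟩
    a * z * x    ≈⟨ solve 3 (λ a z x → a :* z :* x := z :* (a :* x)) refl a z x ⟩
    z * (a * x)  ≈⟨ *-congˡ ax≈0 ⟩
    z * 0#       ≈⟨ zeroʳ z ⟩
    0#           ∎)

  cancelˡ : ∀ {a} → NonZeroDivisor a → ∀ {x y} → a * x ≈ a * y → x ≈ y
  cancelˡ {a} na {x} {y} e = begin
    x              ≈⟨ solve 2 (λ x y → x := (x :- y) :+ y) refl x y ⟩
    (x - y) + y    ≈⟨ +-congʳ (na (x - y) (begin
      a * (x - y)      ≈⟨ solve 3 (λ a x y → a :* (x :- y) := a :* x :- a :* y) refl a x y ⟩
      a * x - a * y    ≈⟨ +-congʳ e ⟩
      a * y - a * y    ≈⟨ -‿inverseʳ _ ⟩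
      0#               ∎)) ⟩
    0# + y         ≈⟨ +-identityˡ y ⟩
    y              ∎

  conj-^ : ∀ x n → conj (x ^ n) ≈ conj x ^ n
  conj-^ x zero    = conj-1
  conj-^ x (suc n) = trans (conj-* x (x ^ n)) (*-congˡ (conj-^ x n))

  conj-fromℕ# : ∀ n → conj (fromℕ# n) ≈ fromℕ# n
  conj-fromℕ# zero    = conj-0
  conj-fromℕ# (suc n) = trans (conj-+ 1# (fromℕ# n)) (+-cong conj-1 (conj-fromℕ# n))

  module _ {p : ℕ} (torsionFree : NonZeroDivisor (fromℕ# p)) {π v v⁻¹ : Carrier} {f : ℕ}
           (π^f∣p : π ^ f ∣ fromℕ# p) (p∣π^f : fromℕ# p ∣ π ^ f)
           (conj-π : conj π ≈ v * π) (v-unit : v⁻¹ * v ≈ 1#)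
           (radical : ∀ Y → π ∣ Y * conj Y → π ∣ Y) where

    private
      P = fromℕ# p

      π^i-nonZeroDivisor : ∀ i → i ℕ.≤ f → NonZeroDivisor (π ^ i)
      π^i-nonZeroDivisor i i≤f = nonZeroDivisor-∣ {b = P}
        (∣-trans (π ^ (f ℕ.∸ i) , trans (^-congʳ π (≡.sym (ℕ.m+[n∸m]≡n i≤f))) (^-homo-* π i _)) π^f∣p)
        torsionFree

      unit^ : ∀ i → v⁻¹ ^ i * v ^ i ≈ 1#
      unit^ i = trans (sym (^-distrib-* v⁻¹ v i)) (trans (^-congˡ i v-unit) (1^ i))

      -- With X = π^i Y one has X X̄ = v^i π^(2i) Y Ȳ. Since i < f, the factor p² contains π^(2i+2);
      -- cancelling π^(2i) leaves π ∣ Y Ȳ, and `radical` yields another π in Y.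
      step : ∀ X → P * P ∣ X * conj X → ∀ i → i ℕ.< f → π ^ i ∣ X → π ^ suc i ∣ X
      step X (z , e) i i<f (Y , X≈) = raise (radical Y (ρ * (π * ρ) * z * v⁻¹ ^ i , cancelˡ nz (cancelˡ nz (begin
        π ^ i * (π ^ i * (Y * conj Y))
          ≈⟨ *-congˡ (*-congˡ (trans (sym (*-identityˡ _)) (*-congʳ (sym (unit^ i))))) ⟩
        π ^ i * (π ^ i * (v⁻¹ ^ i * v ^ i * (Y * conj Y)))
          ≈⟨ solve 5 (λ a w v y y′ → a :* (a :* (w :* v :* (y :* y′))) := w :* ((a :* y) :* ((v :* a) :* y′))) refl
                     (π ^ i) (v⁻¹ ^ i) (v ^ i) Y (conj Y) ⟩
        v⁻¹ ^ i * ((π ^ i * Y) * ((v ^ i * π ^ i) * conj Y))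
          ≈⟨ *-congˡ (trans (*-cong (sym X≈) conjX) e) ⟩
        v⁻¹ ^ i * (P * P * z)
          ≈⟨ *-congˡ (*-congʳ (*-cong P≈ P≈)) ⟩
        v⁻¹ ^ i * ((π ^ i * (π * ρ)) * (π ^ i * (π * ρ)) * z)
          ≈⟨ solve 5 (λ w a π ρ z → w :* ((a :* (π :* ρ)) :* (a :* (π :* ρ)) :* z) :=
                                     a :* (a :* (π :* (ρ :* (π :* ρ) :* z :* w)))) refl
                     (v⁻¹ ^ i) (π ^ i) π ρ z ⟩
        π ^ i * (π ^ i * (π * (ρ * (π * ρ) * z * v⁻¹ ^ i))) ∎))))
        where
        nz = π^i-nonZeroDivisor i (ℕ.<⇒≤ i<f)
        ρ = π ^ (f ℕ.∸ suc i) * proj₁ π^f∣p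
        P≈ : P ≈ π ^ i * (π * ρ)
        P≈ = begin
          P                                                  ≈⟨ proj₂ π^f∣p ⟩
          π ^ f * proj₁ π^f∣p                                ≈⟨ *-congʳ (trans (^-congʳ π (≡.sym (ℕ.m+[n∸m]≡n i<f))) (^-homo-* π (suc i) _)) ⟩
          π * π ^ i * π ^ (f ℕ.∸ suc i) * proj₁ π^f∣p
            ≈⟨ solve 4 (λ π a b c → π :* a :* b :* c := a :* (π :* (b :* c))) refl π (π ^ i) (π ^ (f ℕ.∸ suc i)) (proj₁ π^f∣p) ⟩
          π ^ i * (π * ρ)                                    ∎
        conjX : (v ^ i * π ^ i) * conj Y ≈ conj X
        conjX = begin
          v ^ i * π ^ i * conj Y        ≈⟨ *-congʳ (^-distrib-* v π i) ⟨
          (v * π) ^ i * conj Y          ≈⟨ *-congʳ (^-congˡ i conj-π) ⟨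
          conj π ^ i * conj Y           ≈⟨ *-congʳ (conj-^ π i) ⟨
          conj (π ^ i) * conj Y         ≈⟨ conj-* (π ^ i) Y ⟨
          conj (π ^ i * Y)              ≈⟨ conj-cong X≈ ⟨
          conj X                        ∎
        raise : π ∣ Y → π ^ suc i ∣ X
        raise (Z , Y≈) = Z , trans X≈ (trans (*-congˡ Y≈)
          (solve 3 (λ a π Z → a :* (π :* Z) := (π :* a) :* Z) refl (π ^ i) π Z))

    descends : Descends p
    descends X d = ∣-trans p∣π^f (go f ℕ.≤-refl)
      where
      go : ∀ i → i ℕ.≤ f → π ^ i ∣ X
      go zero    _   = X , sym (*-identityˡ X)
      go (suc i) i<f = step X d i i<f (go i (ℕ.<⇒≤ i<f))

  module _ (torsionFree : ∀ n → .{{NonZero n}} → NonZeroDivisor (fromℕ# n)) where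

    -- Primes may repeat, so they are removed one at a time. Once X = p Y, cancelling p² (p is fixed
    -- by conjugation) leaves Y Ȳ divisible by the square of the remaining product.
    descends-product : ∀ ps → All (λ p → NonZero p × Descends p) ps → ∀ X Z →
                       X * conj X ≈ fromℕ# (product ps) * fromℕ# (product ps) * Z → fromℕ# (product ps) ∣ X
    descends-product []       _                X Z e = X , sym (trans (*-congʳ (+-identityʳ 1#)) (*-identityˡ X))
    descends-product (p ∷ ps) ((nz , d) ∷ ds) X Z e =
      Y′ , trans X≈ (trans (*-congˡ Y≈) (trans (sym (*-assoc P w Y′)) (*-congʳ (sym (fromℕ#-* p (product ps))))))
      where
      P = fromℕ# p
      w = fromℕ# (product ps)
      nzP = torsionFree p {{nz}}
      P∣X : P ∣ X
      P∣X = d X (w * w * Z , trans e (trans (*-congʳ (*-cong (fromℕ#-* p (product ps)) (fromℕ#-* p (product ps))))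
              (solve 3 (λ P w Z → P :* w :* (P :* w) :* Z := P :* P :* (w :* w :* Z)) refl P w Z)))
      Y = proj₁ P∣X
      X≈ = proj₂ P∣X
      YȲ : Y * conj Y ≈ w * w * Z
      YȲ = cancelˡ nzP (cancelˡ nzP (begin
        P * (P * (Y * conj Y))       ≈⟨ solve 3 (λ P Y Y′ → P :* (P :* (Y :* Y′)) := P :* Y :* (P :* Y′)) refl P Y (conj Y) ⟩
        P * Y * (P * conj Y)         ≈⟨ *-congˡ (trans (*-congʳ (sym (conj-fromℕ# p))) (sym (conj-* P Y))) ⟩
        P * Y * conj (P * Y)         ≈⟨ *-cong (sym X≈) (conj-cong (sym X≈)) ⟩
        X * conj X                   ≈⟨ e ⟩
        fromℕ# (p ℕ.* product ps) * fromℕ# (p ℕ.* product ps) * Z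
          ≈⟨ *-congʳ (*-cong (fromℕ#-* p (product ps)) (fromℕ#-* p (product ps))) ⟩
        P * w * (P * w) * Z          ≈⟨ solve 3 (λ P w Z → P :* w :* (P :* w) :* Z := P :* (P :* (w :* w :* Z))) refl P w Z ⟩
        P * (P * (w * w * Z))        ∎))
      ih = descends-product ps ds Y Z YȲ
      Y′ = proj₁ ih
      Y≈ = proj₂ ih

-- Discreteness of ℤ[ζ]

module Discreteness {c ℓ : Level} (R : CommutativeRing c ℓ) where
  open CommutativeRing R hiding (zero)
  open Algebra.Properties.Ring ring using (-0#≈0#; +-inverseˡ-unique; +-inverseʳ-unique)
  open RingProperties R
  open Evaluation R
  open Evaluation ℤ.+-*-commutativeRing using () renaming (ev to evℤ; ev-bind to evℤ-bind; ev-cong to evℤ-cong)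
  open Relation.Binary.Reasoning.Setoid setoid

  copies : {G : Set} → ℕ → FormalSum G → FormalSum G
  copies zero    P = 𝟘
  copies (suc n) P = P ⊕ copies n P

  ev-copies : {G : Set} (f : G → Carrier) → ∀ n P → ev f (copies n P) ≈ n · ev f P
  ev-copies f zero    P = refl
  ev-copies f (suc n) P = +-congˡ (ev-copies f n P)

  evℤ-copies : {G : Set} (f : G → ℤ) → ∀ n P → evℤ f (copies n P) ≡ ℤ.+ n ℤ.* evℤ f P
  evℤ-copies f zero    P = ≡.sym (ℤ.*-zeroˡ (evℤ f P))
  evℤ-copies f (suc n) P = ≡.trans (≡.cong (λ z → evℤ f P ℤ.+ z) (evℤ-copies f n P)) (≡.sym (ℤ.suc-* (ℤ.+ n) (evℤ f P)))

  -- The functionals in F act as coordinates on the additive group generated by the values of `a`: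
  -- they detect zero by finitely many integers.
  KernelOf : ∀ {k} → (Fin k → Carrier) → List (Fin k → ℤ) → Set ℓ
  KernelOf {k} a F = (P : FormalSum (Fin k)) →
    (ev a P ≈ 0# → All (λ f → evℤ f P ≡ 0ℤ) F) × (All (λ f → evℤ f P ≡ 0ℤ) F → ev a P ≈ 0#)

  head-coefficient : ∀ {k} → Fin (suc k) → ℤ
  head-coefficient zero    = 1ℤ
  head-coefficient (suc _) = 0ℤ

  tail-part : ∀ {k} → Fin (suc k) → FormalSum (Fin k)
  tail-part zero    = 𝟘
  tail-part (suc i) = ⟨ i ⟩

  ev-split : ∀ {k} (a : Fin (suc k) → Carrier) P →
             ev a P ≈ ⟦ evℤ head-coefficient P ⟧ * a zero + ev (λ i → a (suc i)) (bind P tail-part)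
  ev-split a 𝟘           = sym (trans (+-identityʳ _) (zeroˡ _))
  ev-split a ⟨ zero ⟩    = sym (trans (+-identityʳ _) (trans (*-congʳ (+-identityʳ 1#)) (*-identityˡ _)))
  ev-split a ⟨ suc i ⟩   = sym (trans (+-congʳ (zeroˡ _)) (+-identityˡ _))
  ev-split a (P ⊕ Q)     = begin
    ev a P + ev a Q
      ≈⟨ +-cong (ev-split a P) (ev-split a Q) ⟩
    (⟦ m ⟧ * a zero + x) + (⟦ n ⟧ * a zero + y)
      ≈⟨ solve 5 (λ m n a x y → (m :* a :+ x) :+ (n :* a :+ y) := (m :+ n) :* a :+ (x :+ y)) refl ⟦ m ⟧ ⟦ n ⟧ (a zero) x y ⟩
    (⟦ m ⟧ + ⟦ n ⟧) * a zero + (x + y)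
      ≈⟨ +-congʳ (*-congʳ (⟦⟧-+ m n)) ⟨
    ⟦ m ℤ.+ n ⟧ * a zero + (x + y) ∎
    where
    m = evℤ head-coefficient P
    n = evℤ head-coefficient Q
    x = ev (λ i → a (suc i)) (bind P tail-part)
    y = ev (λ i → a (suc i)) (bind Q tail-part)
  ev-split a (⊖ P)       = begin
    - ev a P                          ≈⟨ -‿cong (ev-split a P) ⟩
    - (⟦ m ⟧ * a zero + x)            ≈⟨ solve 3 (λ m a x → :- (m :* a :+ x) := (:- m) :* a :+ (:- x)) refl ⟦ m ⟧ (a zero) x ⟩
    (- ⟦ m ⟧) * a zero + (- x)        ≈⟨ +-congʳ (*-congʳ (⟦⟧-neg m)) ⟨
    ⟦ ℤ.- m ⟧ * a zero + (- x)        ∎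
    where
    m = evℤ head-coefficient P
    x = ev (λ i → a (suc i)) (bind P tail-part)

  module _ (torsionFree : ∀ n x → suc n · x ≈ 0# → x ≈ 0#) where

    -- The relations among finitely many elements are cut out by finitely many integer functionals:
    -- a new element either has a multiple in the span of the previous ones, and is eliminated, or
    -- is independent of them.
    kernel-functionals : ∀ k (a : Fin k → Carrier) → ¬ ¬ (Σ[ F ∈ List (Fin k → ℤ) ] KernelOf a F)
    kernel-functionals zero    a κ = κ ([] , λ P → (λ _ → []) , (λ _ → empty P))
      where
      empty : ∀ P → ev a P ≈ 0#
      empty P = trans (ev-cong (λ ()) P) (ev-0 P)
    kernel-functionals (suc k) a κ = kernel-functionals k a′ λ (F , ker) →
      ¬¬-excluded-middle {A = Dependent} λ where
        (yes (g , v , e)) → κ (dependent F ker g v e)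
        (no independent)  → κ (independence F ker independent)
      where
      a′ : Fin k → Carrier
      a′ i = a (suc i)
      Dependent : Set ℓ
      Dependent = ∃[ g ] ∃[ v ] suc g · a zero ≈ ev a′ v

      module _ (F : List (Fin k → ℤ)) (ker : KernelOf a′ F) where
        dependent : ∀ g v → suc g · a zero ≈ ev a′ v → Σ[ F ∈ List (Fin (suc k) → ℤ) ] KernelOf a F
        dependent g v e = map (λ f i → evℤ f (σ i)) F , λ P →
          (λ z → All.map⁺ (All.map (λ {f} z′ → ≡.trans (≡.sym (evℤ-bind f σ P)) z′)
                   (proj₁ (ker (bind P σ)) (trans (scaled P) (trans (×-congʳ (suc g) z) (·-0 (suc g))))))) ,
          (λ z → torsionFree g _ (trans (sym (scaled P)) (proj₂ (ker (bind P σ))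
                   (All.map (λ {f} z′ → ≡.trans (evℤ-bind f σ P) z′) (All.map⁻ z)))))
          where
          -- The multiple of the new element is replaced by v and every other generator is taken suc
          -- g times. All values are thereby multiplied by suc g, which torsion-freeness undoes.
          σ : Fin (suc k) → FormalSum (Fin k)
          σ zero    = v
          σ (suc i) = copies (suc g) ⟨ i ⟩
          ev-σ : ∀ i → ev a′ (σ i) ≈ suc g · a i
          ev-σ zero    = sym e
          ev-σ (suc i) = ev-copies a′ (suc g) ⟨ i ⟩
          scaled : ∀ P → ev a′ (bind P σ) ≈ suc g · ev a P
          scaled P = trans (ev-bind a′ σ P) (trans (ev-cong ev-σ P) (ev-· (suc g) a P))
          ·-0 : ∀ n → n · 0# ≈ 0#
          ·-0 n = trans (·≈fromℕ#* n 0#) (zeroʳ _)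

        independence : ¬ Dependent → Σ[ F ∈ List (Fin (suc k) → ℤ) ] KernelOf a F
        independence ind = head-coefficient ∷ map extend F , λ P →
          (λ z → head≡0 P z ∷ All.map⁺ (All.map (λ {f} z′ → ≡.trans (ev-extend f P) z′)
                   (proj₁ (ker (bind P tail-part)) (tail≈0 P (head≡0 P z) z)))) ,
          (λ { (h ∷ t) → trans (ev-split a P) (trans (+-cong (trans (*-congʳ (reflexive (≡.cong ⟦_⟧ h))) (zeroˡ _))
                   (proj₂ (ker (bind P tail-part)) (All.map (λ {f} z′ → ≡.trans (≡.sym (ev-extend f P)) z′) (All.map⁻ t))))
                   (+-identityˡ 0#)) })
          where
          extend : (Fin k → ℤ) → Fin (suc k) → ℤ
          extend f i = evℤ f (tail-part i)
          ev-extend : ∀ f P → evℤ (extend f) P ≡ evℤ f (bind P tail-part)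
          ev-extend f P = ≡.sym (evℤ-bind f tail-part P)
          head≡0 : ∀ P → ev a P ≈ 0# → evℤ head-coefficient P ≡ 0ℤ
          head≡0 P z with evℤ head-coefficient P | ev-split a P
          ... | ℤ.+ zero  | e = ≡.refl
          ... | ℤ.+ suc g | e = ⊥-elim (ind (g , ⊖ bind P tail-part ,
                  trans (·≈fromℕ#* (suc g) (a zero)) (+-inverseˡ-unique _ _ (trans (sym e) z))))
          ... | -[1+ g ]  | e = ⊥-elim (ind (g , bind P tail-part , (begin
                  suc g · a zero                ≈⟨ ·≈fromℕ#* (suc g) (a zero) ⟩
                  x * a zero                    ≈⟨ solve 3 (λ x a t → x :* a := t :- ((:- x) :* a :+ t)) refl x (a zero) t ⟩
                  t - ((- x) * a zero + t)      ≈⟨ +-congˡ (-‿cong (trans (sym e) z)) ⟩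
                  t - 0#                        ≈⟨ trans (+-congˡ -0#≈0#) (+-identityʳ t) ⟩
                  t                             ∎)))
            where
            x = fromℕ# (suc g)
            t = ev a′ (bind P tail-part)
          tail≈0 : ∀ P → evℤ head-coefficient P ≡ 0ℤ → ev a P ≈ 0# → ev a′ (bind P tail-part) ≈ 0#
          tail≈0 P h z = begin
            t                                               ≈⟨ +-identityˡ t ⟨
            0# + t                                          ≈⟨ +-congʳ (zeroˡ (a zero)) ⟨
            ⟦ 0ℤ ⟧ * a zero + t                             ≡⟨ ≡.cong (λ n → ⟦ n ⟧ * a zero + t) h ⟨
            ⟦ evℤ head-coefficient P ⟧ * a zero + t         ≈⟨ ev-split a P ⟨
            ev a P                                          ≈⟨ z ⟩
            0#                                              ∎
            where t = ev a′ (bind P tail-part)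

  bounded : ∀ k (f : Fin k → ℤ) → ∃[ K ] (∀ i → ℤ.∣ f i ∣ ℕ.≤ K)
  bounded zero    f = 0 , λ ()
  bounded (suc k) f = ℤ.∣ f zero ∣ ℕ.+ proj₁ rest , λ where
      zero    → ℕ.m≤m+n _ _
      (suc i) → ℕ.≤-trans (proj₂ rest i) (ℕ.m≤n+m _ _)
    where rest = bounded k (λ i → f (suc i))

  bounded-list : ∀ {k} (F : List (Fin k → ℤ)) → ∃[ K ] All (λ f → ∀ i → ℤ.∣ f i ∣ ℕ.≤ K) F
  bounded-list []      = 0 , []
  bounded-list (f ∷ F) = proj₁ b ℕ.+ proj₁ rest ,
      (λ i → ℕ.≤-trans (proj₂ b i) (ℕ.m≤m+n _ _)) ∷
      All.map (λ b′ i → ℕ.≤-trans (b′ i) (ℕ.m≤n+m _ _)) (proj₂ rest)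
    where
    b = bounded _ f
    rest = bounded-list F

  ∣evℤ∣≤ : ∀ {G : Set} {K} {f : G → ℤ} → (∀ g → ℤ.∣ f g ∣ ℕ.≤ K) → ∀ P → ℤ.∣ evℤ f P ∣ ℕ.≤ K ℕ.* size P
  ∣evℤ∣≤ {K = K} b 𝟘       = ℕ.z≤n
  ∣evℤ∣≤ {K = K} b ⟨ g ⟩   = ℕ.≤-trans (b g) (ℕ.≤-reflexive (≡.sym (ℕ.*-identityʳ K)))
  ∣evℤ∣≤ {K = K} {f} b (P ⊕ Q) = ℕ.≤-trans (ℤ.∣i+j∣≤∣i∣+∣j∣ (evℤ f P) (evℤ f Q))
    (ℕ.≤-trans (ℕ.+-mono-≤ (∣evℤ∣≤ b P) (∣evℤ∣≤ b Q)) (ℕ.≤-reflexive (≡.sym (ℕ.*-distribˡ-+ K (size P) (size Q)))))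
  ∣evℤ∣≤ {K = K} {f} b (⊖ P)   = ℕ.≤-trans (ℕ.≤-reflexive (ℤ.∣-i∣≡∣i∣ (evℤ f P))) (∣evℤ∣≤ b P)

  -- This replaces an archimedean estimate: if K bounds the functionals on the generators, K * size
  -- P bounds the coordinates of P, and an integer multiple of M of absolute value below M is zero.
  Discrete : {G : Set} → (G → Carrier) → ℕ → Set ℓ
  Discrete a K = ∀ P Q M → ev a P ≈ M · ev a Q → K ℕ.* size P ℕ.< M → ev a P ≈ 0#

  discrete : (∀ n x → suc n · x ≈ 0# → x ≈ 0#) → ∀ {k} (a : Fin k → Carrier) → ¬ ¬ (∃[ K ] Discrete a K)
  discrete torsionFree a κ = kernel-functionals torsionFree _ a λ (F , ker) → κ (proj₁ (bounded-list F) , λ P Q M e K<M →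
    proj₂ (ker P) (vanish F P Q M K<M (proj₂ (bounded-list F))
      (proj₁ (ker (P ⊕ ⊖ copies M Q)) (trans (+-cong e (-‿cong (ev-copies a M Q))) (-‿inverseʳ _)))))
    where
    vanish : ∀ {k K} (F : List (Fin k → ℤ)) P Q M → K ℕ.* size P ℕ.< M → All (λ f → ∀ i → ℤ.∣ f i ∣ ℕ.≤ K) F →
             All (λ f → evℤ f (P ⊕ ⊖ copies M Q) ≡ 0ℤ) F → All (λ f → evℤ f P ≡ 0ℤ) F
    vanish []      P Q M K<M []       []       = []
    vanish (f ∷ F) P Q M K<M (b ∷ bs) (z ∷ zs) = multiple _ ≡.refl ∷ vanish F P Q M K<M bs zs
      where
      evP≡ : evℤ f P ≡ ℤ.+ M ℤ.* evℤ f Q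
      evP≡ = ≡.trans (ℤ.i-j≡0⇒i≡j (evℤ f P) _ z) (evℤ-copies f M Q)
      q = evℤ f Q
      multiple : ∀ r → ℤ.∣ q ∣ ≡ r → evℤ f P ≡ 0ℤ
      multiple zero    eq = ≡.trans evP≡ (≡.trans (≡.cong (ℤ.+ M ℤ.*_) (ℤ.∣i∣≡0⇒i≡0 {q} eq)) (ℤ.*-zeroʳ (ℤ.+ M)))
      multiple (suc r) eq = ⊥-elim (ℕ.<⇒≱ K<M (ℕ.≤-trans (ℕ.m≤m*n M (suc r)) (ℕ.≤-trans (ℕ.≤-reflexive
              (≡.trans (≡.cong (M ℕ.*_) (≡.sym eq)) (≡.trans (≡.sym (ℤ.abs-* (ℤ.+ M) q)) (≡.cong ℤ.∣_∣ (≡.sym evP≡)))))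
              (∣evℤ∣≤ b P))))

-- Twisted group rings

-- Indices range over ℕ so that periodic functions can be shifted. The monoid is left general
-- because both ring elements and numbers of terms are summed.
module RangeSum {c ℓ : Level} (M : CommutativeMonoid c ℓ) where
  open CommutativeMonoid M renaming (_∙_ to _+_; ε to 0#; ∙-cong to +-cong; ∙-congˡ to +-congˡ; ∙-congʳ to +-congʳ; comm to +-comm)
  open Algebra.Properties.CommutativeMonoid.Sum M using (sum; sum-cong-≋; sum-init-last; sum-replicate-zero)
  open Relation.Binary.Reasoning.Setoid setoid

  Σ< : ℕ → (ℕ → Carrier) → Carrier
  Σ< n f = sum (λ (i : Fin n) → f (toℕ i))

  Σ<-cong : ∀ n {f g : ℕ → Carrier} → (∀ i → f i ≈ g i) → Σ< n f ≈ Σ< n g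
  Σ<-cong n e = sum-cong-≋ {n} (λ i → e (toℕ i))

  Σ<-last : ∀ n f → Σ< (suc n) f ≈ Σ< n f + f n
  Σ<-last n f = trans (sum-init-last {n} (λ i → f (toℕ i)))
    (+-cong (sum-cong-≋ {n} (λ i → reflexive (≡.cong f (toℕ-inject₁ i)))) (reflexive (≡.cong f (toℕ-fromℕ n))))

  Σ<-shift₁ : ∀ n f → f n ≈ f 0 → Σ< n (λ i → f (suc i)) ≈ Σ< n f
  Σ<-shift₁ zero    f e = refl
  Σ<-shift₁ (suc n) f e = begin
    Σ< (suc n) (λ i → f (suc i))           ≈⟨ Σ<-last n (λ i → f (suc i)) ⟩
    Σ< n (λ i → f (suc i)) + f (suc n)     ≈⟨ +-comm _ _ ⟩
    f (suc n) + Σ< n (λ i → f (suc i))     ≈⟨ +-congʳ e ⟩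
    Σ< (suc n) f                           ∎

  Σ<-shift : ∀ n f → (∀ i → f (i ℕ.+ n) ≈ f i) → ∀ k → Σ< n (λ i → f (i ℕ.+ k)) ≈ Σ< n f
  Σ<-shift n f periodic zero    = Σ<-cong n (λ i → reflexive (≡.cong f (ℕ.+-identityʳ i)))
  Σ<-shift n f periodic (suc k) = begin
    Σ< n (λ i → f (i ℕ.+ suc k))     ≈⟨ Σ<-cong n (λ i → reflexive (≡.cong f (ℕ.+-suc i k))) ⟩
    Σ< n (λ i → f (suc i ℕ.+ k))     ≈⟨ Σ<-shift₁ n (λ i → f (i ℕ.+ k))
                                          (trans (reflexive (≡.cong f (ℕ.+-comm n k))) (periodic k)) ⟩
    Σ< n (λ i → f (i ℕ.+ k))         ≈⟨ Σ<-shift n f periodic k ⟩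
    Σ< n f                           ∎

  Σ<-+ : ∀ m n f → Σ< (m ℕ.+ n) f ≈ Σ< m f + Σ< n (λ i → f (m ℕ.+ i))
  Σ<-+ zero    n f = sym (identityˡ _)
  Σ<-+ (suc m) n f = trans (+-congˡ (Σ<-+ m n (λ i → f (suc i)))) (sym (assoc _ _ _))

  Σ<-first : ∀ n .{{_ : NonZero n}} f → (∀ i → 0 ℕ.< i → i ℕ.< n → f i ≈ 0#) → Σ< n f ≈ f 0
  Σ<-first (suc n) f z = trans (+-congˡ (trans
    (sum-cong-≋ {n} (λ i → z (suc (toℕ i)) (ℕ.s≤s ℕ.z≤n) (ℕ.s≤s (toℕ<n i)))) (sum-replicate-zero n))) (identityʳ (f 0))

infixr 7 _⋆_
_⋆_ : ℕ → ℕ × ℕ → ℕ × ℕ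
k ⋆ (i , l) = k ℕ.* i , k ℕ.* l

⋆-⊹ : ∀ k g g′ → k ⋆ (g ⊹ g′) ≡ k ⋆ g ⊹ k ⋆ g′
⋆-⊹ k (i , l) (i′ , l′) = ≡.cong₂ _,_ (ℕ.*-distribˡ-+ k i i′) (ℕ.*-distribˡ-+ k l l′)

scale : ℕ → FormalSum (ℕ × ℕ) → FormalSum (ℕ × ℕ)
scale k P = bind P (λ g → ⟨ k ⋆ g ⟩)

module _ {c ℓ : Level} (R : CommutativeRing c ℓ) where
  open CommutativeRing R hiding (zero)
  open Evaluation R

  module ScaledMonoidRing {I : Set} (s : I → ℕ × ℕ → Carrier) where
    open MonoidRing s public
    private
      module B = CommutativeRing monoidRing
    open RingProperties monoidRing public using (_^_)
    open RingProperties R using () renaming (_·_ to _·ᴿ_)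
    open RingProperties monoidRing public using (fromℕ#; ·≈fromℕ#*) renaming (_·_ to _·ᴮ_)

    mono-^ : ∀ g k → ⟨ g ⟩ ^ k ≋ ⟨ k ⋆ g ⟩
    mono-^ g zero    = B.refl
    mono-^ g (suc k) = B.trans (B.*-congˡ {⟨ g ⟩} (mono-^ g k)) (mono-⊛ g (k ⋆ g))

    ev-scale : ∀ k (f : ℕ × ℕ → Carrier) P → ev f (scale k P) ≈ ev (λ g → f (k ⋆ g)) P
    ev-scale k f P = ev-bind f _ P

    scale-⊛ : ∀ k P Q → scale k (P ⊛ Q) ≋ scale k P ⊛ scale k Q
    scale-⊛ k P Q .at ι g₀ =
      trans (ev-scale k f (P ⊛ Q)) (trans (ev-convolve _⊹_ _ P Q)
        (trans (ev-cong (λ g → trans (ev-cong (λ g′ → reflexive (≡.cong f (⋆-⊹ k g g′))) Q)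
                                     (sym (ev-scale k _ Q))) P)
          (trans (sym (ev-scale k _ P)) (sym (ev-convolve _⊹_ f (scale k P) (scale k Q))))))
      where
      f : ℕ × ℕ → Carrier
      f g = s ι (g₀ ⊹ g)

    ev-·ᴮ : ∀ (f : ℕ × ℕ → Carrier) n P → ev f (n ·ᴮ P) ≈ n ·ᴿ ev f P
    ev-·ᴮ f zero    P = refl
    ev-·ᴮ f (suc n) P = +-congˡ (ev-·ᴮ f n P)

-- The number 2hn - 1 is -1 modulo both h and n, so this power inverts ζ and x at once: it is
-- complex conjugation on monomials.
inverseExponent : (n h : ℕ) → ℕ
inverseExponent n h = ℕ.pred (2 ℕ.* (h ℕ.* n))

suc-inverseExponent : ∀ n h .{{_ : NonZero n}} .{{_ : NonZero h}} → suc (inverseExponent n h) ≡ 2 ℕ.* (h ℕ.* n)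
suc-inverseExponent n h = ℕ.suc-pred (2 ℕ.* (h ℕ.* n)) {{ℕ.m*n≢0 2 (h ℕ.* n) {{_}} {{ℕ.m*n≢0 h n}}}}

module RootOfUnity {c ℓ : Level} (R : CommutativeRing c ℓ) (h : ℕ) (ζ : CommutativeRing.Carrier R)
  (ζ^h≈1 : CommutativeRing._≈_ R (RingProperties._^_ R ζ h) (CommutativeRing.1# R)) where
  open CommutativeRing R
  open RingProperties R
  open Relation.Binary.Reasoning.Setoid setoid

  ζ^-periodic : ∀ i k → ζ ^ (i ℕ.+ k ℕ.* h) ≈ ζ ^ i
  ζ^-periodic i k = begin
    ζ ^ (i ℕ.+ k ℕ.* h)      ≈⟨ ^-homo-* ζ i (k ℕ.* h) ⟩
    ζ ^ i * ζ ^ (k ℕ.* h)    ≈⟨ *-congˡ (trans (^-congʳ ζ (ℕ.*-comm k h)) (sym (^-assocʳ ζ h k))) ⟩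
    ζ ^ i * (ζ ^ h) ^ k      ≈⟨ *-congˡ (trans (^-congˡ k ζ^h≈1) (1^ k)) ⟩
    ζ ^ i * 1#               ≈⟨ *-identityʳ _ ⟩
    ζ ^ i                    ∎

-- ℤ[ζ][x] modulo the polynomials annihilated by all translates of the functional
-- ζ^i x^l ↦ ζ^i t(l), where t(l) is the value of the formal sum T l.  The functional is used
-- together with its conjugate, so that ζ ↦ ζ⁻¹, x ↦ x⁻¹ is well defined on the quotient.
module TwistedRing {c ℓ : Level} (R : CommutativeRing c ℓ)
  (torsionFree : ∀ n x → CommutativeRing._≈_ R (RingProperties._·_ R (suc n) x) (CommutativeRing.0# R) →
                 CommutativeRing._≈_ R x (CommutativeRing.0# R))
  (n h : ℕ) {{_ : NonZero n}} {{_ : NonZero h}} (ζ : CommutativeRing.Carrier R)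
  (ζ^h≈1 : CommutativeRing._≈_ R (RingProperties._^_ R ζ h) (CommutativeRing.1# R))
  (T : ℕ → FormalSum ℕ)
  (T-periodic : ∀ l → CommutativeRing._≈_ R (Evaluation.ev R (RingProperties._^_ R ζ) (T (l ℕ.+ n)))
                                            (Evaluation.ev R (RingProperties._^_ R ζ) (T l)))
  where
  open CommutativeRing R hiding (zero)
  open RingProperties R
  open Evaluation R
  open RootOfUnity R h ζ ζ^h≈1 using (ζ^-periodic)
  open Relation.Binary.Reasoning.Setoid setoid

  κ : ℕ
  κ = inverseExponent n h

  t : ℕ → Carrier
  t l = ev (ζ ^_) (T l)

  s : ℕ × ℕ → Carrier
  s (i , l) = ζ ^ i * t l

  t-periodic : ∀ l k → t (l ℕ.+ k ℕ.* n) ≈ t l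
  t-periodic l zero    = reflexive (≡.cong t (ℕ.+-identityʳ l))
  t-periodic l (suc k) = trans (reflexive (≡.cong t (shuffle l n (k ℕ.* n))))
                           (trans (T-periodic (l ℕ.+ k ℕ.* n)) (t-periodic l k))
    where
    shuffle : ∀ l n m → l ℕ.+ (n ℕ.+ m) ≡ l ℕ.+ m ℕ.+ n
    shuffle = solve-∀

  private
    s± : Bool → ℕ × ℕ → Carrier
    s± true  g = s g
    s± false g = s (κ ⋆ g)

    module Conj = ScaledMonoidRing R s±
    module Half = ScaledMonoidRing R {⊤} (λ _ → s)

  twistedRing : CommutativeRing 0ℓ ℓ
  twistedRing = Conj.monoidRing

  -- Only the functional itself is imposed here, not its conjugate. Relations are verified in this
  -- ring and transferred to `twistedRing` by `both` when their conjugates hold as well.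
  halfRing : CommutativeRing 0ℓ ℓ
  halfRing = Half.monoidRing

  open Conj public using (_⊛_; mono-⊛; mono-^)
  open Conj using (ev-scale)
  private
    module B = CommutativeRing twistedRing
    module BP = RingProperties twistedRing
    module H = CommutativeRing halfRing
    module HP = RingProperties halfRing

  s-periodic : ∀ g g′ → s (g ⊹ suc κ ⋆ g′) ≈ s g
  s-periodic (i , l) (i′ , l′) = *-cong
    (trans (^-congʳ ζ (≡.cong (i ℕ.+_) (≡.trans (≡.cong (ℕ._* i′) (suc-inverseExponent n h)) (left h n i′))))
           (ζ^-periodic i (2 ℕ.* n ℕ.* i′)))
    (trans (reflexive (≡.cong (λ m → t (l ℕ.+ m)) (≡.trans (≡.cong (ℕ._* l′) (suc-inverseExponent n h)) (right h n l′))))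
           (t-periodic l (2 ℕ.* h ℕ.* l′)))
    where
    left : ∀ h n i → 2 ℕ.* (h ℕ.* n) ℕ.* i ≡ 2 ℕ.* n ℕ.* i ℕ.* h
    left = solve-∀
    right : ∀ h n l → 2 ℕ.* (h ℕ.* n) ℕ.* l ≡ 2 ℕ.* h ℕ.* l ℕ.* n
    right = solve-∀

  s-involutive : ∀ g g′ → s (g ⊹ κ ⋆ κ ⋆ g′) ≈ s (g ⊹ g′)
  s-involutive g@(i , l) g′@(i′ , l′) = begin
    s (g ⊹ κ ⋆ κ ⋆ g′)                              ≈⟨ s-periodic (g ⊹ κ ⋆ κ ⋆ g′) g′ ⟨
    s (g ⊹ κ ⋆ κ ⋆ g′ ⊹ suc κ ⋆ g′)                 ≡⟨ ≡.cong s (≡.cong₂ _,_ (shuffle i κ i′) (shuffle l κ l′)) ⟩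
    s (g ⊹ g′ ⊹ suc κ ⋆ κ ⋆ g′)                     ≈⟨ s-periodic (g ⊹ g′) (κ ⋆ g′) ⟩
    s (g ⊹ g′)                                      ∎
    where
    shuffle : ∀ i k j → i ℕ.+ k ℕ.* (k ℕ.* j) ℕ.+ suc k ℕ.* j ≡ i ℕ.+ j ℕ.+ suc k ℕ.* (k ℕ.* j)
    shuffle = solve-∀

  half : ∀ {P Q} → P B.≈ Q → P H.≈ Q
  half e .Half.at tt g = e .Conj.at true g

  half-fromℕ# : ∀ m → BP.fromℕ# m ≡ HP.fromℕ# m
  half-fromℕ# zero    = ≡.refl
  half-fromℕ# (suc m) = ≡.cong (H.1# ⊕_) (half-fromℕ# m)

  half-mono-^ : ∀ g k → ⟨ g ⟩ HP.^ k H.≈ ⟨ k ⋆ g ⟩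
  half-mono-^ = Half.mono-^

  half-intro : ∀ {P Q} → (∀ i l → ev (λ g → s ((i , l) ⊹ g)) P ≈ ev (λ g → s ((i , l) ⊹ g)) Q) → P H.≈ Q
  half-intro e .Half.at tt (i , l) = e i l

  value-half : ∀ {P Q} → P H.≈ Q → ∀ g → ev (λ g′ → s (g ⊹ g′)) P ≈ ev (λ g′ → s (g ⊹ g′)) Q
  value-half e = e .Half.at tt

  both : ∀ {P Q} → P H.≈ Q → scale κ P H.≈ scale κ Q → P B.≈ Q
  both e ē .Conj.at true  g = e .Half.at tt g
  both {P} {Q} e ē .Conj.at false g = begin
    ev (λ g′ → s (κ ⋆ (g ⊹ g′))) P              ≈⟨ ev-cong (λ g′ → reflexive (≡.cong s (⋆-⊹ κ g g′))) P ⟩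
    ev (λ g′ → s (κ ⋆ g ⊹ κ ⋆ g′)) P            ≈⟨ ev-scale κ _ P ⟨
    ev (λ g′ → s (κ ⋆ g ⊹ g′)) (scale κ P)      ≈⟨ ē .Half.at tt (κ ⋆ g) ⟩
    ev (λ g′ → s (κ ⋆ g ⊹ g′)) (scale κ Q)      ≈⟨ ev-scale κ _ Q ⟩
    ev (λ g′ → s (κ ⋆ g ⊹ κ ⋆ g′)) Q            ≈⟨ ev-cong (λ g′ → reflexive (≡.cong s (⋆-⊹ κ g g′))) Q ⟨
    ev (λ g′ → s (κ ⋆ (g ⊹ g′))) Q              ∎

  scale-involutive : ∀ P → scale κ (scale κ P) H.≈ P
  scale-involutive P .Half.at tt g =
    trans (ev-scale κ _ (scale κ P)) (trans (ev-scale κ _ P) (ev-cong (λ g′ → s-involutive g g′) P))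

  scale-half : ∀ {P Q} → P B.≈ Q → scale κ P H.≈ scale κ Q
  scale-half {P} {Q} e .Half.at tt g = begin
    ev (λ g′ → s (g ⊹ g′)) (scale κ P)          ≈⟨ untwist P ⟨
    ev (λ g′ → s (κ ⋆ (κ ⋆ g ⊹ g′))) P          ≈⟨ e .Conj.at false (κ ⋆ g) ⟩
    ev (λ g′ → s (κ ⋆ (κ ⋆ g ⊹ g′))) Q          ≈⟨ untwist Q ⟩
    ev (λ g′ → s (g ⊹ g′)) (scale κ Q)          ∎
    where
    untwist : ∀ P → ev (λ g′ → s (κ ⋆ (κ ⋆ g ⊹ g′))) P ≈ ev (λ g′ → s (g ⊹ g′)) (scale κ P)
    untwist P = trans (ev-cong (λ g′ → begin
      s (κ ⋆ (κ ⋆ g ⊹ g′))           ≡⟨ ≡.cong s (⋆-⊹ κ (κ ⋆ g) g′) ⟩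
      s (κ ⋆ κ ⋆ g ⊹ κ ⋆ g′)         ≡⟨ ≡.cong s (⊹-comm (κ ⋆ κ ⋆ g) (κ ⋆ g′)) ⟩
      s (κ ⋆ g′ ⊹ κ ⋆ κ ⋆ g)         ≈⟨ s-involutive (κ ⋆ g′) g ⟩
      s (κ ⋆ g′ ⊹ g)                 ≡⟨ ≡.cong s (⊹-comm (κ ⋆ g′) g) ⟩
      s (g ⊹ κ ⋆ g′)                 ∎) P) (sym (ev-scale κ _ P))

  scale-cong : ∀ {P Q} → P B.≈ Q → scale κ P B.≈ scale κ Q
  scale-cong {P} {Q} e = both (scale-half e)
    (H.trans (scale-involutive P) (H.trans (half e) (H.sym (scale-involutive Q))))

  private
    scale-one : scale κ H.1# ≡ H.1#
    scale-one = ≡.cong₂ (λ i l → ⟨ i , l ⟩) (ℕ.*-zeroʳ κ) (ℕ.*-zeroʳ κ)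

  conjugation : Conjugation twistedRing
  conjugation = record
    { conj      = scale κ
    ; conj-cong = scale-cong
    ; conj-+    = λ P Q → B.refl
    ; conj-*    = Conj.scale-⊛ κ
    ; conj-0    = B.refl
    ; conj-1    = B.reflexive scale-one
    }

  torsionFreeRing : ∀ m .{{_ : NonZero m}} P → BP.fromℕ# m ⊛ P B.≈ 𝟘 → P B.≈ 𝟘
  torsionFreeRing (suc m) P e .Conj.at ι g = torsionFree m _ (trans (sym (Conj.ev-·ᴮ _ (suc m) P))
    (B.trans (BP.·≈fromℕ#* (suc m) P) e .Conj.at ι g))

  -- On monomials conjugation is the κ-th power map.
  half-mono : ∀ {g g′} → ⟨ g ⟩ H.≈ ⟨ g′ ⟩ → ⟨ g ⟩ B.≈ ⟨ g′ ⟩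
  half-mono {g} {g′} e = both e (H.trans (H.sym (Half.mono-^ g κ)) (H.trans (HP.^-congˡ κ e) (Half.mono-^ g′ κ)))

  mono-period : ∀ g → ⟨ suc κ ⋆ g ⟩ B.≈ B.1#
  mono-period g = half-mono {suc κ ⋆ g} {0 , 0} e
    where
    e : ⟨ suc κ ⋆ g ⟩ H.≈ H.1#
    e .Half.at tt (i , l) = trans (s-periodic (i , l) g) (reflexive (≡.cong s (≡.sym (≡.cong₂ _,_ (ℕ.+-identityʳ i) (ℕ.+-identityʳ l)))))

  mono-inverse : ∀ g → ⟨ g ⟩ ⊛ ⟨ κ ⋆ g ⟩ B.≈ B.1#
  mono-inverse g = B.trans (mono-⊛ g (κ ⋆ g)) (mono-period g)

  ζ-mono-period : ⟨ h , 0 ⟩ B.≈ B.1#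
  ζ-mono-period = half-mono {h , 0} {0 , 0} e
    where
    e : ⟨ h , 0 ⟩ H.≈ H.1#
    e .Half.at tt (i , l) = *-congʳ (trans (trans (^-congʳ ζ (≡.cong (i ℕ.+_) (≡.sym (ℕ.*-identityˡ h)))) (ζ^-periodic i 1))
                                           (^-congʳ ζ (≡.sym (ℕ.+-identityʳ i))))

  open RangeSum +-commutativeMonoid
  open Algebra.Properties.Semiring.Sum semiring using (sum; sum-cong-≋; ∑-comm; *-distribˡ-sum; *-distribʳ-sum)

  module _ (a : ℕ → ℕ) where
    D : FormalSum (ℕ × ℕ)
    D = ⨁ {n = n} (λ k → ⟨ a (toℕ k) , toℕ k ⟩)

    autocorrelation : ℕ → Carrier
    autocorrelation l = Σ< n (λ k → ζ ^ (a (k ℕ.+ l) ℕ.+ κ ℕ.* a k))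

    module _ (a-periodic : ∀ k → a (k ℕ.+ n) ≡ a k) (auto-0 : autocorrelation 0 ≈ n · 1#)
             (auto-l : ∀ l → 0 ℕ.< l → l ℕ.< n → autocorrelation l ≈ 0#) where

      -- Reindexing the double sum by k = m + k′, which periodicity in k allows, turns the product
      -- into the sum of autocorrelation m times x^m. Only m = 0 survives.
      ev-DD̄ : ∀ i l → ev (λ g → s ((i , l) ⊹ g)) (D ⊛ scale κ D) ≈ n · s (i , l)
      ev-DD̄ i l = begin
        ev (λ g → s ((i , l) ⊹ g)) (D ⊛ scale κ D)
          ≈⟨ ev-convolve _⊹_ _ D (scale κ D) ⟩
        ev (λ g → ev (λ g′ → s ((i , l) ⊹ (g ⊹ g′))) (scale κ D)) D
          ≈⟨ ev-⨁ _ {n} _ ⟩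
        Σ< n (λ k → ev (λ g′ → s ((i , l) ⊹ ((a k , k) ⊹ g′))) (scale κ D))
          ≈⟨ Σ<-cong n (λ k → trans (ev-scale κ (λ g′ → s ((i , l) ⊹ ((a k , k) ⊹ g′))) D) (ev-⨁ _ {n} _)) ⟩
        Σ< n (λ k → Σ< n (λ k′ → s ((i , l) ⊹ ((a k , k) ⊹ κ ⋆ (a k′ , k′)))))
          ≈⟨ ∑-comm {n} {n} (λ k k′ → F (toℕ k′) (toℕ k)) ⟩
        Σ< n (λ k′ → Σ< n (F k′))
          ≈⟨ Σ<-cong n (λ k′ → sym (Σ<-shift n (F k′) (F-periodic k′) k′)) ⟩
        Σ< n (λ k′ → Σ< n (λ m → F k′ (m ℕ.+ k′)))
          ≈⟨ ∑-comm {n} {n} (λ k′ m → F (toℕ k′) (toℕ m ℕ.+ toℕ k′)) ⟩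
        Σ< n (λ m → Σ< n (λ k′ → F k′ (m ℕ.+ k′)))
          ≈⟨ Σ<-cong n (λ m → Σ<-cong n (λ k′ → F-shifted m k′)) ⟩
        Σ< n (λ m → Σ< n (λ k′ → s (i , l ℕ.+ m) * ζ ^ (a (k′ ℕ.+ m) ℕ.+ κ ℕ.* a k′)))
          ≈⟨ Σ<-cong n (λ m → *-distribˡ-sum {n} (s (i , l ℕ.+ m)) (λ k′ → ζ ^ (a (toℕ k′ ℕ.+ m) ℕ.+ κ ℕ.* a (toℕ k′)))) ⟨
        Σ< n (λ m → s (i , l ℕ.+ m) * autocorrelation m)
          ≈⟨ Σ<-first n (λ m → s (i , l ℕ.+ m) * autocorrelation m) (λ m 0<m m<n → trans (*-congˡ (auto-l m 0<m m<n)) (zeroʳ _)) ⟩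
        s (i , l ℕ.+ 0) * autocorrelation 0
          ≈⟨ *-cong (reflexive (≡.cong (λ m → s (i , m)) (ℕ.+-identityʳ l))) auto-0 ⟩
        s (i , l) * (n · 1#)
          ≈⟨ trans (*-comm _ _) (sym (·≈fromℕ#* n _)) ⟩
        n · s (i , l) ∎
        where
        F : ℕ → ℕ → Carrier
        F k′ k = s ((i , l) ⊹ ((a k , k) ⊹ κ ⋆ (a k′ , k′)))
        F-periodic : ∀ k′ k → F k′ (k ℕ.+ n) ≈ F k′ k
        F-periodic k′ k = *-cong (^-congʳ ζ (≡.cong (λ x → i ℕ.+ (x ℕ.+ κ ℕ.* a k′)) (a-periodic k)))
          (trans (reflexive (≡.cong t (shuffle l k n (κ ℕ.* k′)))) (t-periodic (l ℕ.+ (k ℕ.+ κ ℕ.* k′)) 1))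
          where
          shuffle : ∀ l k n m → l ℕ.+ (k ℕ.+ n ℕ.+ m) ≡ l ℕ.+ (k ℕ.+ m) ℕ.+ 1 ℕ.* n
          shuffle = solve-∀
        F-shifted : ∀ m k′ → F k′ (m ℕ.+ k′) ≈ s (i , l ℕ.+ m) * ζ ^ (a (k′ ℕ.+ m) ℕ.+ κ ℕ.* a k′)
        F-shifted m k′ = begin
          ζ ^ (i ℕ.+ (a (m ℕ.+ k′) ℕ.+ κ ℕ.* a k′)) * t (l ℕ.+ (m ℕ.+ k′ ℕ.+ κ ℕ.* k′))
            ≈⟨ *-cong (trans (^-homo-* ζ i _) (*-congˡ (^-congʳ ζ (≡.cong (λ x → a x ℕ.+ κ ℕ.* a k′) (ℕ.+-comm m k′)))))
                 (trans (reflexive (≡.cong t (≡.trans (shuffle l m k′ κ)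
                    (≡.cong (l ℕ.+ m ℕ.+_) (≡.trans (≡.cong (ℕ._* k′) (suc-inverseExponent n h)) (right h n k′))))))
                    (t-periodic (l ℕ.+ m) (2 ℕ.* h ℕ.* k′))) ⟩
          ζ ^ i * ζ ^ (a (k′ ℕ.+ m) ℕ.+ κ ℕ.* a k′) * t (l ℕ.+ m)
            ≈⟨ solve 3 (λ x y z → x :* y :* z := x :* z :* y) refl (ζ ^ i) _ (t (l ℕ.+ m)) ⟩
          ζ ^ i * t (l ℕ.+ m) * ζ ^ (a (k′ ℕ.+ m) ℕ.+ κ ℕ.* a k′) ∎
          where
          shuffle : ∀ l m k κ → l ℕ.+ (m ℕ.+ k ℕ.+ κ ℕ.* k) ≡ l ℕ.+ m ℕ.+ suc κ ℕ.* k
          shuffle = solve-∀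
          right : ∀ h n l → 2 ℕ.* (h ℕ.* n) ℕ.* l ≡ 2 ℕ.* h ℕ.* l ℕ.* n
          right = solve-∀

      DD̄-half : D ⊛ scale κ D H.≈ HP.fromℕ# n
      DD̄-half .Half.at tt (i , l) = trans (ev-DD̄ i l) (sym (trans (Half.ev-·ᴮ _ n H.1#)
        (×-congʳ n (reflexive (≡.cong s (≡.cong₂ _,_ (ℕ.+-identityʳ i) (ℕ.+-identityʳ l)))))))

      DD̄ : D ⊛ scale κ D B.≈ BP.fromℕ# n
      DD̄ = both (H.trans DD̄-half (H.reflexive (≡.sym (half-fromℕ# n)))) (H.trans (Half.scale-⊛ κ D (scale κ D))
        (H.trans (H.*-congˡ {scale κ D} (scale-involutive D)) (H.trans (H.*-comm (scale κ D) D) (H.trans DD̄-half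
          (H.reflexive (≡.sym (scale-fromℕ n)))))))
        where
        scale-fromℕ : ∀ m → scale κ (BP.fromℕ# m) ≡ HP.fromℕ# m
        scale-fromℕ zero    = ≡.refl
        scale-fromℕ (suc m) = ≡.cong₂ _⊕_ scale-one (scale-fromℕ m)

module TwistedRingProperties {c ℓ : Level} (R : CommutativeRing c ℓ)
  (torsionFree : ∀ n x → CommutativeRing._≈_ R (RingProperties._·_ R (suc n) x) (CommutativeRing.0# R) →
                 CommutativeRing._≈_ R x (CommutativeRing.0# R))
  (n h : ℕ) {{_ : NonZero n}} {{_ : NonZero h}} (ζ : CommutativeRing.Carrier R)
  (ζ^h≈1 : CommutativeRing._≈_ R (RingProperties._^_ R ζ h) (CommutativeRing.1# R))
  (T : ℕ → FormalSum ℕ)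
  (T-periodic : ∀ l → CommutativeRing._≈_ R (Evaluation.ev R (RingProperties._^_ R ζ) (T (l ℕ.+ n)))
                                            (Evaluation.ev R (RingProperties._^_ R ζ) (T l)))
  where
  open TwistedRing R torsionFree n h ζ ζ^h≈1 T T-periodic public

  private
    module B where
      open CommutativeRing twistedRing public
      open RingProperties twistedRing public
    module H where
      open CommutativeRing halfRing public
      open RingProperties halfRing public
  open Conjugation conjugation using (conj)
  open Descent twistedRing conjugation using (Descends; descends)

  private
    ev-mono : ∀ P → Evaluation.ev twistedRing ⟨_⟩ P ≡ P
    ev-mono 𝟘       = ≡.refl
    ev-mono ⟨ g ⟩   = ≡.refl
    ev-mono (P ⊕ Q) = ≡.cong₂ _⊕_ (ev-mono P) (ev-mono Q)
    ev-mono (⊖ P)   = ≡.cong ⊖_ (ev-mono P)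

    ev-conj : ∀ P → Evaluation.ev twistedRing (λ g → ⟨ κ ⋆ g ⟩) P ≡ conj P
    ev-conj 𝟘       = ≡.refl
    ev-conj ⟨ g ⟩   = ≡.refl
    ev-conj (P ⊕ Q) = ≡.cong₂ _⊕_ (ev-conj P) (ev-conj Q)
    ev-conj (⊖ P)   = ≡.cong ⊖_ (ev-conj P)

  mono-involutive : ∀ g → ⟨ κ ⋆ κ ⋆ g ⟩ B.≈ ⟨ g ⟩
  mono-involutive g = half-mono {κ ⋆ κ ⋆ g} {g} (scale-involutive ⟨ g ⟩)

  module _ {p : ℕ} (pr : Prime p) (J : ℕ) (1≤J : 1 ℕ.≤ J) where

    -- Multiply g^(1+q) ≡ 1 by the inverse of g, which is its conjugate. In this form self-conjugacy
    -- says that conjugation is a power of Frobenius.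
    mono-frobenius : ∀ π → (∀ g → π B.∣ ⟨ suc (p ℕ.^ J) ⋆ g ⟩ B.- B.1#) →
                     ∀ g → Quotient._∼_ twistedRing π (⟨ g ⟩ B.^ (p ℕ.^ J)) ⟨ κ ⋆ g ⟩
    mono-frobenius π d g = Q.mk∼ (B.∣-respʳ e (B.∣-* ⟨ κ ⋆ g ⟩ (d g)))
      where
      module Q = Quotient twistedRing π
      open Relation.Binary.Reasoning.Setoid B.setoid
      q = p ℕ.^ J
      X Y Z : FormalSum (ℕ × ℕ)
      X = ⟨ g ⟩
      Y = ⟨ suc q ⋆ g ⟩
      Z = ⟨ κ ⋆ g ⟩
      e : (Y B.- B.1#) B.* Z B.≈ X B.^ q B.- Z
      e = begin
        (Y B.- B.1#) B.* Z
          ≈⟨ B.solve 2 (λ a z → (a B.:- B.:1) B.:* z B.:= a B.:* z B.:- z) B.refl Y Z ⟩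
        Y B.* Z B.- Z
          ≈⟨ B.+-congʳ (B.*-congʳ {Z} (mono-^ g (suc q))) ⟨
        X B.* X B.^ q B.* Z B.- Z
          ≈⟨ B.+-congʳ (B.solve 3 (λ a b z → a B.:* b B.:* z B.:= a B.:* z B.:* b) B.refl X (X B.^ q) Z) ⟩
        X B.* Z B.* X B.^ q B.- Z
          ≈⟨ B.+-congʳ (B.trans (B.*-congʳ {X B.^ q} (mono-inverse g)) (B.*-identityˡ (X B.^ q))) ⟩
        X B.^ q B.- Z ∎

    radicalRing : ∀ π → π B.∣ B.fromℕ# p → (∀ g → π B.∣ ⟨ suc (p ℕ.^ J) ⋆ g ⟩ B.- B.1#) →
                  ∀ X → π B.∣ X B.* conj X → π B.∣ X
    radicalRing π π∣p d X π∣XX̄ = ≡.subst (π B.∣_) (ev-mono X)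
      (Radical.radical twistedRing pr π J 1≤J π∣p ⟨_⟩ (λ g → ⟨ κ ⋆ g ⟩) (mono-frobenius π d)
        (λ g → Q.∼-trans (mono-frobenius π d (κ ⋆ g)) (Q.≈⇒∼ (mono-involutive g)))
        X (≡.subst₂ (λ a b → π B.∣ a B.* b) (≡.sym (ev-mono X)) (≡.sym (ev-conj X)) π∣XX̄))
      where module Q = Quotient twistedRing π

    module _ (e : ℕ × ℕ) (A : ℕ) (sum≈0 : Geometric.geometric twistedRing p (⟨ e ⟩ B.^ (p ℕ.^ A)) B.≈ B.0#)
             (powers : ∀ g → ∃[ k ] ⟨ suc (p ℕ.^ J) ⋆ g ⟩ B.≈ ⟨ e ⟩ B.^ k) where
      private
        η η̄ π : FormalSum (ℕ × ℕ)
        η = ⟨ e ⟩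
        η̄ = ⟨ κ ⋆ e ⟩
        π = η B.- B.1#
        tf = torsionFreeRing p {{prime⇒nonZero pr}}
        module Ram = Ramification twistedRing pr tf η A sum≈0

        power-cong : ∀ g → π B.∣ ⟨ suc (p ℕ.^ J) ⋆ g ⟩ B.- B.1#
        power-cong g = B.∣-respʳ (B.+-congʳ (B.sym (proj₂ (powers g)))) (Geometric.x-1∣x^n-1 twistedRing (proj₁ (powers g)) η)

        conj-π : conj π B.≈ (B.- η̄) B.* π
        conj-π = begin
          η̄ B.- conj B.1#          ≈⟨ B.+-congˡ (B.-‿cong (Conjugation.conj-1 conjugation)) ⟩
          η̄ B.- B.1#               ≈⟨ B.+-congˡ (B.-‿cong (mono-inverse e)) ⟨
          η̄ B.- η B.* η̄            ≈⟨ B.solve 2 (λ a x → a B.:- x B.:* a B.:= (B.:- a) B.:* (x B.:- B.:1)) B.refl η̄ η ⟩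
          (B.- η̄) B.* π            ∎
          where open Relation.Binary.Reasoning.Setoid B.setoid

        unit : (B.- η) B.* (B.- η̄) B.≈ B.1#
        unit = B.trans (B.solve 2 (λ a b → (B.:- a) B.:* (B.:- b) B.:= a B.:* b) B.refl η η̄) (mono-inverse e)

      -- In the applications 1 + p^J is a multiple of the prime-to-p part of the order of every
      -- monomial, so the power in `powers` lies in the p-part, which η generates. As η ≡ 1 modulo
      -- π, these powers become 1, and `radicalRing` applies.
      descendsRing : Descends p
      descendsRing = descends {p} tf {f = Ram.exponent} Ram.π^e∣p Ram.p∣π^e conj-π unit
        (radicalRing π (B.∣-trans π∣π^e Ram.π^e∣p) power-cong)
        where
        π∣π^e : π B.∣ π B.^ Ram.exponent
        π∣π^e = π B.^ (Ram.exponent ℕ.∸ 1) , B.^-congʳ π (≡.sym (ℕ.m+[n∸m]≡n Ram.exponent>0))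

  module _ where
    private
      module BG = Geometric twistedRing
      module HG = Geometric halfRing

      geometric≡ : ∀ m x → BG.geometric m x ≡ HG.geometric m x
      geometric≡ zero    x = ≡.refl
      geometric≡ (suc m) x = ≡.cong (λ y → ⟨ 0 , 0 ⟩ ⊕ (x ⊛ y)) (geometric≡ m x)

      scale-geometric : ∀ m g → scale κ (BG.geometric m ⟨ g ⟩) B.≈ BG.geometric m ⟨ κ ⋆ g ⟩
      scale-geometric zero    g = B.refl
      scale-geometric (suc m) g = B.+-cong {scale κ B.1#} (Conjugation.conj-1 conjugation)
        (B.trans (Conjugation.conj-* conjugation ⟨ g ⟩ (BG.geometric m ⟨ g ⟩)) (B.*-congˡ {⟨ κ ⋆ g ⟩} (scale-geometric m g)))

    -- The conjugate of the sum is the same sum at the inverse of g. By `geometric-inverse` this is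
    -- the original sum read backwards, up to a unit, so it vanishes too.
    geometric-both : ∀ m g → HG.geometric (suc m) ⟨ g ⟩ H.≈ H.0# → BG.geometric (suc m) ⟨ g ⟩ B.≈ B.0#
    geometric-both m g e = both (H.trans (H.reflexive (geometric≡ (suc m) ⟨ g ⟩)) e)
      (H.trans (half (scale-geometric (suc m) g)) (H.trans (H.reflexive (geometric≡ (suc m) ⟨ κ ⋆ g ⟩)) (begin
        G′                                    ≈⟨ H.*-identityˡ G′ ⟨
        H.1# H.* G′                           ≈⟨ H.*-congʳ {G′} (H.1^ m) ⟨
        H.1# H.^ m H.* G′                     ≈⟨ H.*-congʳ {G′} (H.^-congˡ m (H.trans (H.*-comm y x) xy≈1)) ⟨
        (y H.* x) H.^ m H.* G′                ≈⟨ H.*-congʳ {G′} (H.^-distrib-* y x m) ⟩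
        y H.^ m H.* x H.^ m H.* G′            ≈⟨ H.*-assoc (y H.^ m) (x H.^ m) G′ ⟩
        y H.^ m H.* (x H.^ m H.* G′)          ≈⟨ H.*-congˡ {y H.^ m} (H.trans (HG.geometric-inverse m xy≈1) e) ⟩
        y H.^ m H.* H.0#                      ≈⟨ H.zeroʳ (y H.^ m) ⟩
        H.0#                                  ∎)))
      where
      open Relation.Binary.Reasoning.Setoid H.setoid
      x = ⟨ g ⟩
      y = ⟨ κ ⋆ g ⟩
      G′ = HG.geometric (suc m) y
      xy≈1 : x H.* y H.≈ H.1#
      xy≈1 = half (mono-inverse g)

  open CommutativeRing R hiding (zero)
  open Evaluation R
  open RingProperties R

  -- The functional applied to x^l₀ P, kept as a formal sum of powers of ζ so that its terms can be
  -- counted.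
  coefficient : ℕ → FormalSum (ℕ × ℕ) → FormalSum ℕ
  coefficient l₀ P = bind P (λ { (i , l) → bind (T (l₀ ℕ.+ l)) (λ e → ⟨ i ℕ.+ e ⟩) })

  ev-coefficient : ∀ l₀ P → ev (ζ ^_) (coefficient l₀ P) ≈ ev (λ g → s ((0 , l₀) ⊹ g)) P
  ev-coefficient l₀ P = trans (ev-bind (ζ ^_) _ P) (ev-cong (λ { (i , l) →
    trans (ev-bind (ζ ^_) _ (T (l₀ ℕ.+ l)))
      (trans (ev-cong (λ e → ^-homo-* ζ i e) (T (l₀ ℕ.+ l))) (ev-*ˡ (ζ ^ i) (ζ ^_) (T (l₀ ℕ.+ l)))) }) P)

  ev-multiple : ∀ (f : ℕ × ℕ → Carrier) m P → ev f (m H.· P) ≈ m · ev f P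
  ev-multiple f zero    P = refl
  ev-multiple f (suc m) P = +-congˡ (ev-multiple f m P)

  half-coefficient-divisible : ∀ m {P Q} → P H.≈ H.fromℕ# m H.* Q → ∀ l₀ →
                               ev (ζ ^_) (coefficient l₀ P) ≈ m · ev (ζ ^_) (coefficient l₀ Q)
  half-coefficient-divisible m {P} {Q} e l₀ = begin
    ev (ζ ^_) (coefficient l₀ P)           ≈⟨ ev-coefficient l₀ P ⟩
    ev (λ g → s ((0 , l₀) ⊹ g)) P          ≈⟨ value-half (H.trans e (H.sym (H.·≈fromℕ#* m Q))) (0 , l₀) ⟩
    ev (λ g → s ((0 , l₀) ⊹ g)) (m H.· Q)  ≈⟨ ev-multiple _ m Q ⟩
    m · ev (λ g → s ((0 , l₀) ⊹ g)) Q      ≈⟨ ×-congʳ m (ev-coefficient l₀ Q) ⟨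
    m · ev (ζ ^_) (coefficient l₀ Q)       ∎
    where open Relation.Binary.Reasoning.Setoid setoid

  coefficient-divisible : ∀ m {P Q} → P B.≈ B.fromℕ# m B.* Q → ∀ l₀ →
                          ev (ζ ^_) (coefficient l₀ P) ≈ m · ev (ζ ^_) (coefficient l₀ Q)
  coefficient-divisible m {P} {Q} e = half-coefficient-divisible m
    (H.trans (half e) (H.*-congʳ {Q} (H.reflexive (half-fromℕ# m))))

  module _ (a : ℕ → ℕ) (a-periodic : ∀ k → a (k ℕ.+ n) ≡ a k) (auto-0 : autocorrelation a 0 ≈ n · 1#)
           (auto-l : ∀ l → 0 ℕ.< l → l ℕ.< n → autocorrelation a l ≈ 0#) where

    -- If every translate of the functional vanished on D, then D and D D̄ = n would be zero in
    -- `halfRing`; evaluated at the monomial 1 this reads n · t 0 = 0.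
    D-nonzero : ¬ t 0 ≈ 0# → ¬ (∀ l₀ → ev (ζ ^_) (coefficient l₀ (D a)) ≈ 0#)
    D-nonzero t₀≉0 z = t₀≉0 (trans (sym (*-identityˡ _)) (torsionFree (ℕ.pred n) _
      (trans (×-congˡ (ℕ.suc-pred n)) (trans (sym (ev-DD̄ a a-periodic auto-0 auto-l 0 0)) (value-half DD̄≈0 (0 , 0))))))
      where
      D≈0 : D a H.≈ H.0#
      D≈0 = half-intro λ i l → trans (ev-cong (λ g → trans (*-congʳ (^-homo-* ζ i (proj₁ g))) (*-assoc _ _ _)) (D a))
        (trans (ev-*ˡ (ζ ^ i) _ (D a)) (trans (*-congˡ (trans (sym (ev-coefficient l (D a))) (z l))) (zeroʳ _)))
      DD̄≈0 : D a H.* scale κ (D a) H.≈ H.0#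
      DD̄≈0 = H.trans (H.*-congʳ {scale κ (D a)} D≈0) (H.zeroˡ (scale κ (D a)))

-- Growth of powers and residues modulo n

-- Bernoulli's inequality gives ((d+1)/d)^N ≥ 1 + N/d; the choice N = K * d makes the right side K +
-- 1.
exponential-growth : ∀ K d w → d ℕ.< w → ∃[ N ] K ℕ.* d ℕ.^ N ℕ.< w ℕ.^ N
exponential-growth K zero    w 0<w = 1 , ℕ.≤-trans (ℕ.≤-reflexive (≡.cong suc (ℕ.*-zeroʳ K))) (ℕ.≤-trans 0<w (ℕ.≤-reflexive (≡.sym (ℕ.*-identityʳ w))))
exponential-growth K d@(suc _) w d<w = N , ℕ.≤-trans (ℕ.*-cancelʳ-≤ _ _ d (begin
    suc (K ℕ.* d ℕ.^ N) ℕ.* d              ≤⟨ ℕ.*-monoˡ-≤ d (ℕ.+-monoˡ-≤ (K ℕ.* d ℕ.^ N) (ℕ.m^n>0 d N)) ⟩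
    (d ℕ.^ N ℕ.+ K ℕ.* d ℕ.^ N) ℕ.* d      ≡⟨ expand (d ℕ.^ N) K d ⟩
    d ℕ.^ N ℕ.* (d ℕ.+ N)                  ≤⟨ bernoulli N ⟩
    suc d ℕ.^ N ℕ.* d                      ∎)) (ℕ.^-monoˡ-≤ N d<w)
  where
  open ℕ.≤-Reasoning
  N = K ℕ.* d
  expand : ∀ x K d → (x ℕ.+ K ℕ.* x) ℕ.* d ≡ x ℕ.* (d ℕ.+ K ℕ.* d)
  expand = solve-∀
  bernoulli : ∀ N → d ℕ.^ N ℕ.* (d ℕ.+ N) ℕ.≤ suc d ℕ.^ N ℕ.* d
  bernoulli zero    = ℕ.≤-reflexive (≡.cong (ℕ._+ 0) (ℕ.+-identityʳ d))
  bernoulli (suc N) = begin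
    d ℕ.* d ℕ.^ N ℕ.* (d ℕ.+ suc N)             ≡⟨ lhs d (d ℕ.^ N) N ⟩
    d ℕ.^ N ℕ.* (d ℕ.* (d ℕ.+ N) ℕ.+ d)         ≤⟨ ℕ.*-monoʳ-≤ (d ℕ.^ N) (ℕ.+-monoʳ-≤ (d ℕ.* (d ℕ.+ N)) (ℕ.m≤m+n d N)) ⟩
    d ℕ.^ N ℕ.* (d ℕ.* (d ℕ.+ N) ℕ.+ (d ℕ.+ N)) ≡⟨ rhs d (d ℕ.^ N) (d ℕ.+ N) ⟩
    suc d ℕ.* (d ℕ.^ N ℕ.* (d ℕ.+ N))           ≤⟨ ℕ.*-monoʳ-≤ (suc d) (bernoulli N) ⟩
    suc d ℕ.* (suc d ℕ.^ N ℕ.* d)               ≡⟨ ℕ.*-assoc (suc d) (suc d ℕ.^ N) d ⟨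
    suc d ℕ.* suc d ℕ.^ N ℕ.* d                 ∎
    where
    lhs : ∀ d x N → d ℕ.* x ℕ.* (d ℕ.+ suc N) ≡ x ℕ.* (d ℕ.* (d ℕ.+ N) ℕ.+ d)
    lhs = solve-∀
    rhs : ∀ d x m → x ℕ.* (d ℕ.* m ℕ.+ m) ≡ suc d ℕ.* (x ℕ.* m)
    rhs = solve-∀

toℕ-mod : ∀ k n .{{_ : NonZero n}} → toℕ (k mod n) ≡ k ℕ.% n
toℕ-mod k n = toℕ-fromℕ< (ℕ.m%n<n k n)

mod-cong : ∀ {k k′} n .{{_ : NonZero n}} → k ℕ.% n ≡ k′ ℕ.% n → k mod n ≡ k′ mod n
mod-cong {k} {k′} n e = toℕ-injective (≡.trans (toℕ-mod k n) (≡.trans e (≡.sym (toℕ-mod k′ n))))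

toℕ-mod-inverse : ∀ {n} .{{_ : NonZero n}} (k : Fin n) → toℕ k mod n ≡ k
toℕ-mod-inverse {n} k = toℕ-injective (≡.trans (toℕ-mod (toℕ k) n) (ℕ.m<n⇒m%n≡m (toℕ<n k)))

addℤ-mod : ∀ n .{{_ : NonZero n}} g k → addℤ n (g mod n) (k mod n) ≡ (g ℕ.+ k) mod n
addℤ-mod n g k = mod-cong n (≡.trans (≡.cong₂ (λ x y → (x ℕ.+ y) ℕ.% n) (toℕ-mod g n) (toℕ-mod k n))
                                     (≡.sym (ℕ.%-distribˡ-+ g k n)))

-- Sums of roots of unity in an integral domain

module IntegralDomainProperties {c ℓ : Level} (R : CommutativeRing c ℓ) (domain : IntegralDomain R) (char0 : CharZero R) where
  open CommutativeRing R hiding (zero)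
  open RingProperties R
  open Evaluation R

  1≉0 : ¬ 1# ≈ 0#
  1≉0 e with () ← char0 1 (trans (+-identityʳ 1#) e)

  torsionFree : ∀ n x → suc n · x ≈ 0# → x ≈ 0#
  torsionFree n x e with domain (suc n · 1#) x (trans (sym (·≈fromℕ#* (suc n) x)) e)
  ... | inj₁ z with () ← char0 (suc n) z
  ... | inj₂ z = z

  ^≈0⇒≈0 : ∀ x N → x ^ N ≈ 0# → x ≈ 0#
  ^≈0⇒≈0 x zero    e = ⊥-elim (1≉0 e)
  ^≈0⇒≈0 x (suc N) e with domain x (x ^ N) e
  ... | inj₁ z = z
  ... | inj₂ z = ^≈0⇒≈0 x N z

  open Discreteness R using (Discrete; discrete)

  module _ (h : ℕ) {{_ : NonZero h}} (ζ : Carrier) (ζ^h≈1 : ζ ^ h ≈ 1#) where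
    open RootOfUnity R h ζ ζ^h≈1

    DiscreteRoots : ℕ → Set ℓ
    DiscreteRoots = Discrete {ℕ} (ζ ^_)

    -- Reducing exponents modulo h leaves finitely many generators and changes neither values nor
    -- sizes.
    discreteRoots : ¬ ¬ (∃[ K ] DiscreteRoots K)
    discreteRoots κ = discrete torsionFree {h} (λ i → ζ ^ toℕ i) λ (K , disc) → κ (K , λ P Q M e K<M →
      trans (reduce P) (disc (bind P σ) (bind Q σ) M
        (trans (sym (reduce P)) (trans e (×-congʳ M (reduce Q))))
        (≡.subst (λ x → K ℕ.* x ℕ.< M) (≡.sym (≡.trans (size-bind 1 (λ _ → ≡.refl) P) (ℕ.*-identityʳ _))) K<M)))
      where
      σ : ℕ → FormalSum (Fin h)
      σ e = ⟨ e mod h ⟩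
      reduce : ∀ P → ev (ζ ^_) P ≈ ev (λ i → ζ ^ toℕ i) (bind P σ)
      reduce P = trans (ev-cong (λ e → trans (^-congʳ ζ (ℕ.m≡m%n+[m/n]*n e h))
          (trans (ζ^-periodic (e ℕ.% h) (e ℕ./ h)) (^-congʳ ζ (≡.sym (toℕ-mod e h))))) P)
        (sym (ev-bind _ σ P))

    power : FormalSum ℕ → ℕ → FormalSum ℕ
    power P zero    = ⟨ 0 ⟩
    power P (suc N) = convolve ℕ._+_ P (power P N)

    ev-power : ∀ P N → ev (ζ ^_) (power P N) ≈ ev (ζ ^_) P ^ N
    ev-power P zero    = refl
    ev-power P (suc N) = trans (ev-convolve ℕ._+_ (ζ ^_) P (power P N))
      (trans (ev-cong (λ e → trans (ev-cong (λ e′ → ^-homo-* ζ e e′) (power P N))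
                                   (trans (ev-*ˡ (ζ ^ e) (ζ ^_) (power P N)) (*-comm _ _))) P)
        (trans (ev-*ˡ _ (ζ ^_) P) (trans (*-comm _ _) (*-congˡ (ev-power P N)))))

    size-power : ∀ P N → size (power P N) ≡ size P ℕ.^ N
    size-power P zero    = ≡.refl
    size-power P (suc N) = ≡.trans (size-convolve ℕ._+_ P (power P N)) (≡.cong (size P ℕ.*_) (size-power P N))

    -- A nonzero sum of fewer than w roots of unity is not divisible by w: otherwise its N-th power
    -- would be divisible by w ^ N, which outgrows its coordinates.
    indivisible : ∀ {K} → DiscreteRoots K → ∀ S Q w → size S ℕ.< w → ev (ζ ^_) S ≈ w · ev (ζ ^_) Q → ev (ζ ^_) S ≈ 0#
    indivisible {K} disc S Q w S<w e = ^≈0⇒≈0 _ N (trans (sym (ev-power S N)) (disc (power S N) (power Q N) (w ℕ.^ N) (begin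
      ev (ζ ^_) (power S N)                  ≈⟨ ev-power S N ⟩
      ev (ζ ^_) S ^ N                        ≈⟨ ^-congˡ N (trans e (·≈fromℕ#* w _)) ⟩
      (fromℕ# w * ev (ζ ^_) Q) ^ N           ≈⟨ ^-distrib-* _ _ N ⟩
      fromℕ# w ^ N * ev (ζ ^_) Q ^ N         ≈⟨ *-cong (sym (fromℕ#-^ w N)) (sym (ev-power Q N)) ⟩
      fromℕ# (w ℕ.^ N) * ev (ζ ^_) (power Q N) ≈⟨ ·≈fromℕ#* (w ℕ.^ N) _ ⟨
      (w ℕ.^ N) · ev (ζ ^_) (power Q N)      ∎)
      (≡.subst (λ x → K ℕ.* x ℕ.< w ℕ.^ N) (≡.sym (size-power S N)) (proj₂ growth))))
      where
      open Relation.Binary.Reasoning.Setoid setoid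
      growth = exponential-growth K (size S) w S<w
      N = proj₁ growth

  geometric-root : ∀ p θ → θ ^ p ≈ 1# → ¬ θ ≈ 1# → Geometric.geometric R p θ ≈ 0#
  geometric-root p θ θ^p≈1 θ≉1 with domain (θ - 1#) (Geometric.geometric R p θ) (begin
      (θ - 1#) * G               ≈⟨ solve 1 (λ a → a := :1 :+ a :- :1) refl _ ⟩
      1# + (θ - 1#) * G - 1#     ≈⟨ +-congʳ (Geometric.geometric-telescope R p θ) ⟨
      θ ^ p - 1#                 ≈⟨ +-congʳ θ^p≈1 ⟩
      1# - 1#                    ≈⟨ -‿inverseʳ 1# ⟩
      0#                         ∎)
    where
    open Relation.Binary.Reasoning.Setoid setoid
    G = Geometric.geometric R p θ
  ... | inj₁ z = ⊥-elim (θ≉1 (trans (solve 1 (λ a → a := a :- :1 :+ :1) refl θ) (trans (+-congʳ z) (+-identityˡ 1#))))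
  ... | inj₂ z = z

-- The first row of a BH matrix

module FromBH {c ℓ : Level} (R : CommutativeRing c ℓ) (n h : ℕ) {{_ : NonZero n}} {{_ : NonZero h}}
  (ζ : CommutativeRing.Carrier R)
  (ζ^h≈1 : CommutativeRing._≈_ R (RingProperties._^_ R ζ h) (CommutativeRing.1# R))
  (H : Fin n → Fin n → Fin h) (bh : IsBH R n h ζ H) where
  open CommutativeRing R hiding (zero)
  open RingProperties R
  open RangeSum +-commutativeMonoid
  open RootOfUnity R h ζ ζ^h≈1
  open Algebra.Properties.Semiring.Sum semiring using (sum; sum-cong-≋)
  open Relation.Binary.Reasoning.Setoid setoid

  entry : ℕ → ℕ → ℕ
  entry g k = toℕ (H (g mod n) (k mod n))

  row : ℕ → ℕ
  row = entry 0

  entry-periodic : ∀ g k → entry g (k ℕ.+ n) ≡ entry g k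
  entry-periodic g k = ≡.cong (λ x → toℕ (H (g mod n) x)) (mod-cong n (ℕ.[m+n]%n≡m%n k n))

  entry-invariant : ∀ l k → entry l (k ℕ.+ l) ≡ row k
  entry-invariant l k = ≡.trans (≡.cong₂ (λ x y → toℕ (H x y)) (≡.sym (addℤ-mod n 0 l)) (≡.sym (addℤ-mod n k l)))
    (≡.cong toℕ (proj₁ bh (0 mod n) (k mod n) (l mod n)))

  private
    κ = inverseExponent n h

    -- This reconciles two encodings of the conjugate of ζ^b: the exponent h - b of `IsBH` and the
    -- exponent κ * b of the twisted rings.
    ζ^-inverse : ∀ b → b ℕ.≤ h → ζ ^ (κ ℕ.* b) ≈ ζ ^ (h ℕ.∸ b)
    ζ^-inverse b b≤h = begin
      ζ ^ (κ ℕ.* b)                              ≈⟨ ζ^-periodic (κ ℕ.* b) 1 ⟨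
      ζ ^ (κ ℕ.* b ℕ.+ 1 ℕ.* h)                  ≡⟨ ≡.cong (ζ ^_) (≡.trans (≡.cong (λ x → κ ℕ.* b ℕ.+ 1 ℕ.* x) (≡.sym (ℕ.m∸n+n≡m b≤h))) (shuffle κ b (h ℕ.∸ b))) ⟩
      ζ ^ (h ℕ.∸ b ℕ.+ suc κ ℕ.* b)              ≡⟨ ≡.cong (λ x → ζ ^ (h ℕ.∸ b ℕ.+ x)) (≡.trans (≡.cong (ℕ._* b) (suc-inverseExponent n h)) (left h n b)) ⟩
      ζ ^ (h ℕ.∸ b ℕ.+ 2 ℕ.* n ℕ.* b ℕ.* h)      ≈⟨ ζ^-periodic (h ℕ.∸ b) (2 ℕ.* n ℕ.* b) ⟩
      ζ ^ (h ℕ.∸ b)                              ∎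
      where
      shuffle : ∀ k b x → k ℕ.* b ℕ.+ 1 ℕ.* (x ℕ.+ b) ≡ x ℕ.+ suc k ℕ.* b
      shuffle = solve-∀
      left : ∀ h n i → 2 ℕ.* (h ℕ.* n) ℕ.* i ≡ 2 ℕ.* n ℕ.* i ℕ.* h
      left = solve-∀

  autocorrelation : ℕ → Carrier
  autocorrelation l = Σ< n (λ k → ζ ^ (row (k ℕ.+ l) ℕ.+ κ ℕ.* row k))

  -- By invariance, the entry at k of row 0 is the entry at k + l of row l. A cyclic shift of the
  -- summation index then gives the inner product of rows 0 and l.
  autocorrelation-rows : ∀ l → autocorrelation l ≈
    sum (λ (k : Fin n) → ζ ^ (toℕ (H (0 mod n) k) ℕ.+ (h ℕ.∸ toℕ (H (l mod n) k))))
  autocorrelation-rows l = begin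
    Σ< n (λ k → ζ ^ (row (k ℕ.+ l) ℕ.+ κ ℕ.* row k))
      ≈⟨ Σ<-cong n (λ k → ^-congʳ ζ (≡.cong (λ x → row (k ℕ.+ l) ℕ.+ κ ℕ.* x) (≡.sym (entry-invariant l k)))) ⟩
    Σ< n (λ k → f (k ℕ.+ l))
      ≈⟨ Σ<-shift n f (λ k → ^-congʳ ζ (≡.cong₂ (λ x y → x ℕ.+ κ ℕ.* y) (entry-periodic 0 k) (entry-periodic l k))) l ⟩
    Σ< n f
      ≈⟨ sum-cong-≋ {n} (λ k → trans (^-homo-* ζ (row (toℕ k)) (κ ℕ.* entry l (toℕ k)))
           (trans (*-congˡ (ζ^-inverse (entry l (toℕ k)) (ℕ.<⇒≤ (toℕ<n (H (l mod n) (toℕ k mod n))))))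
           (trans (sym (^-homo-* ζ (row (toℕ k)) (h ℕ.∸ entry l (toℕ k))))
             (^-congʳ ζ (≡.cong (λ x → toℕ (H (0 mod n) x) ℕ.+ (h ℕ.∸ toℕ (H (l mod n) x))) (toℕ-mod-inverse k)))))) ⟩
    sum (λ (k : Fin n) → ζ ^ (toℕ (H (0 mod n) k) ℕ.+ (h ℕ.∸ toℕ (H (l mod n) k)))) ∎
    where
    f : ℕ → Carrier
    f k = ζ ^ (row k ℕ.+ κ ℕ.* entry l k)

  autocorrelation-0 : autocorrelation 0 ≈ n · 1#
  autocorrelation-0 = trans (autocorrelation-rows 0) (proj₁ (proj₂ bh) _ _ ≡.refl)

  autocorrelation-l : ∀ l → 0 ℕ.< l → l ℕ.< n → autocorrelation l ≈ 0#
  autocorrelation-l l 0<l l<n = trans (autocorrelation-rows l) (proj₂ (proj₂ bh) _ _ λ e →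
    ℕ.<⇒≢ 0<l (≡.trans (≡.sym (ℕ.m<n⇒m%n≡m (ℕ.≤-trans 0<l (ℕ.<⇒≤ l<n))))
      (≡.trans (≡.sym (toℕ-mod 0 n)) (≡.trans (≡.cong toℕ e) (≡.trans (toℕ-mod l n) (ℕ.m<n⇒m%n≡m l<n))))))

-- Self-conjugate primes

∤⇒coprime : ∀ {p x} → Prime p → ¬ p ℕ.∣ x → Coprime x p
∤⇒coprime pr p∤x {d} (d∣x , d∣p) with prime⇒irreducible pr d∣p
... | inj₁ d≡1   = d≡1
... | inj₂ ≡.refl = ⊥-elim (p∤x d∣x)

coprime-^-divisor : ∀ {p x} → Coprime x p → ∀ a y → x ℕ.∣ p ℕ.^ a ℕ.* y → x ℕ.∣ y
coprime-^-divisor {p} {x} c zero    y d = ≡.subst (x ℕ.∣_) (ℕ.*-identityˡ y) d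
coprime-^-divisor {p} {x} c (suc a) y d = coprime-^-divisor c a y
  (coprime-divisor c (≡.subst (x ℕ.∣_) (ℕ.*-assoc p (p ℕ.^ a) y) d))

coprime-^ : ∀ {p x} → Coprime x p → ∀ a → Coprime x (p ℕ.^ a)
coprime-^ {p} c a {d} (d∣x , d∣p^a) = ℕ.∣1⇒≡1 (coprime-^-divisor (λ (e∣d , e∣p) → c (ℕ.∣-trans e∣d d∣x , e∣p)) a 1
  (≡.subst (d ℕ.∣_) (≡.sym (ℕ.*-identityʳ _)) d∣p^a))

extract-prime : ∀ {p} → Prime p → ∀ n → .{{NonZero n}} → ∃[ b ] ∃[ n′ ] (n ≡ p ℕ.^ b ℕ.* n′) × (¬ p ℕ.∣ n′)
extract-prime {p} pr n {{nz}} = <-rec (λ n → NonZero n → ∃[ b ] ∃[ n′ ] (n ≡ p ℕ.^ b ℕ.* n′) × (¬ p ℕ.∣ n′)) step n (ℕ.≢-nonZero (ℕ.≢-nonZero⁻¹ n))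
  where
  step : ∀ n → (∀ {m} → m ℕ.< n → NonZero m → ∃[ b ] ∃[ n′ ] (m ≡ p ℕ.^ b ℕ.* n′) × (¬ p ℕ.∣ n′)) →
         NonZero n → ∃[ b ] ∃[ n′ ] (n ≡ p ℕ.^ b ℕ.* n′) × (¬ p ℕ.∣ n′)
  step n rec nz with p ℕ.∣? n
  ... | no  p∤n = 0 , n , ≡.sym (ℕ.*-identityˡ n) , p∤n
  ... | yes (divides (suc m) n≡) with b , n′ , e , p∤n′ ← rec (≡.subst (suc m ℕ.<_) (≡.sym n≡) (ℕ.m<m*n (suc m) p (ℕ.nonTrivial⇒n>1 p {{prime⇒nonTrivial pr}}))) _ =
    suc b , n′ , ≡.trans n≡ (≡.trans (≡.cong (ℕ._* p) e) (shuffle (p ℕ.^ b) n′ p)) , p∤n′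
    where
    shuffle : ∀ x n p → x ℕ.* n ℕ.* p ≡ p ℕ.* x ℕ.* n
    shuffle = solve-∀
  ... | yes (divides zero n≡0) = ⊥-elim (ℕ.≢-nonZero⁻¹ n {{nz}} n≡0)

even⊎odd : ∀ p → 2 ℕ.∣ p ⊎ 2 ℕ.∣ suc p
even⊎odd zero    = inj₁ (2 ℕ.∣0)
even⊎odd (suc p) with even⊎odd p
... | inj₁ d = inj₂ (ℕ.∣m∣n⇒∣m+n ℕ.∣-refl d)
... | inj₂ d = inj₁ d

-- A divisor of m prime to p divides N′. A positive J is required because `radical` uses p^J ≥ 2. If
-- the given j is 0, then N′ divides 2, and N′ = 2 forces p to be odd, so J = 1 works.
selfConj-exponent : ∀ {p m} → Prime p → SelfConjPrime p m →
  ∃[ J ] (1 ℕ.≤ J) × (∀ x → x ℕ.∣ m → ¬ p ℕ.∣ x → x ℕ.∣ suc (p ℕ.^ J))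
selfConj-exponent {p} {m} pr (a , N′ , m≡ , p∤N′ , j , d) = proj₁ positive , proj₁ (proj₂ positive) , λ x x∣m p∤x →
    ℕ.∣-trans (coprime-^-divisor (∤⇒coprime pr p∤x) a N′ (≡.subst (x ℕ.∣_) m≡ x∣m)) (proj₂ (proj₂ positive))
  where
  ∣2⇒∣1+p : ∀ N → ¬ p ℕ.∣ N → N ℕ.∣ 2 → N ℕ.∣ suc p
  ∣2⇒∣1+p 0 p∤N N∣2 = ⊥-elim (p∤N (p ℕ.∣0))
  ∣2⇒∣1+p 1 p∤N N∣2 = ℕ.1∣ suc p
  ∣2⇒∣1+p 2 p∤N N∣2 with even⊎odd p
  ... | inj₂ odd = odd
  ... | inj₁ even with prime⇒irreducible pr even
  ...   | inj₂ ≡.refl = ⊥-elim (p∤N ℕ.∣-refl)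
  ∣2⇒∣1+p (suc (suc (suc N))) p∤N N∣2 with ℕ.s≤s (ℕ.s≤s ()) ← ℕ.∣⇒≤ N∣2
  makePositive : ∀ j → N′ ℕ.∣ p ℕ.^ j ℕ.+ 1 → ∃[ J ] (1 ℕ.≤ J) × (N′ ℕ.∣ suc (p ℕ.^ J))
  makePositive zero    d = 1 , ℕ.≤-refl , ≡.subst (λ x → N′ ℕ.∣ suc x) (≡.sym (ℕ.*-identityʳ p)) (∣2⇒∣1+p N′ p∤N′ d)
  makePositive (suc j) d = suc j , ℕ.s≤s ℕ.z≤n , ≡.subst (N′ ℕ.∣_) (ℕ.+-comm _ 1) d
  positive = makePositive j d

-- Primes dividing u must divide h

module Unramified {c ℓ : Level} (R : CommutativeRing c ℓ) (domain : IntegralDomain R) (char0 : CharZero R)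
  (n h : ℕ) {{_ : NonZero n}} {{_ : NonZero h}} (ζ : CommutativeRing.Carrier R)
  (ζ^h≈1 : CommutativeRing._≈_ R (RingProperties._^_ R ζ h) (CommutativeRing.1# R))
  (H : Fin n → Fin n → Fin h) (bh : IsBH R n h ζ H)
  (K : ℕ) (disc : IntegralDomainProperties.DiscreteRoots R domain char0 h ζ ζ^h≈1 K)
  {p : ℕ} (pr : Prime p) (J : ℕ) (1≤J : 1 ℕ.≤ J) (h∣ : h ℕ.∣ suc (p ℕ.^ J)) where
  open CommutativeRing R hiding (zero)
  open RingProperties R
  open Evaluation R
  open IntegralDomainProperties R domain char0
  open RootOfUnity R h ζ ζ^h≈1
  open FromBH R n h ζ ζ^h≈1 H bh hiding (autocorrelation)
  open Algebra.Properties.Semiring.Sum semiring using (∑-distrib-+; *-distribˡ-sum)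

  private
    -- The functional sending every x^l to 1 identifies x with 1, so D becomes the row sum.
    module Untwisted = TwistedRingProperties R torsionFree n h ζ ζ^h≈1 (λ _ → ⟨ 0 ⟩) (λ _ → refl)

  -- The case p² ∤ n: the row sum X satisfies X X̄ = n, and p ∣ n would force p ∣ X and p² ∣ n.
  module RowSum (n₁ : ℕ) (n≡ : n ≡ p ℕ.* n₁) (p∤n₁ : ¬ p ℕ.∣ n₁) where
    open Untwisted
    private
      module B where
        open CommutativeRing twistedRing public
        open RingProperties twistedRing public
    open Conjugation conjugation
    open Descent twistedRing conjugation using (cancelˡ; conj-fromℕ#)

    mono≈1 : ∀ g → ⟨ suc (p ℕ.^ J) ⋆ g ⟩ B.≈ B.1#
    mono≈1 (i , l) = half-mono {suc (p ℕ.^ J) ⋆ (i , l)} {0 , 0} (half-intro λ i₀ l₀ → *-congʳ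
      (trans (^-congʳ ζ (≡.cong (i₀ ℕ.+_) (≡.trans (≡.cong (ℕ._* i) (ℕ._∣_.equality h∣)) (shuffle (ℕ.quotient h∣) h i))))
        (trans (ζ^-periodic i₀ (ℕ.quotient h∣ ℕ.* i)) (^-congʳ ζ (≡.sym (ℕ.+-identityʳ i₀))))))
      where
      shuffle : ∀ q h i → q ℕ.* h ℕ.* i ≡ q ℕ.* i ℕ.* h
      shuffle = solve-∀

    private
      P X : FormalSum (ℕ × ℕ)
      P = B.fromℕ# p
      X = D row

      XX̄ : X B.* conj X B.≈ P B.* B.fromℕ# n₁
      XX̄ = B.trans (DD̄ row (entry-periodic 0) autocorrelation-0 autocorrelation-l)
             (B.trans (B.reflexive (≡.cong B.fromℕ# n≡)) (B.fromℕ#-* p n₁))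

      P∣X : P B.∣ X
      -- As p ∤ h, p is unramified and serves as its own π: every monomial already satisfies
      -- g^(1+p^J) = 1.
      P∣X = radicalRing pr J 1≤J P (B.1# , B.sym (B.*-identityʳ P))
        (λ g → B.0# , B.trans (B.+-congʳ (mono≈1 g)) (B.trans (B.-‿inverseʳ B.1#) (B.sym (B.zeroʳ P))))
        X (B.fromℕ# n₁ , XX̄)

      n₁≈ : ∀ {Y} → X B.≈ P B.* Y → B.fromℕ# n₁ B.≈ P B.* (Y B.* conj Y)
      n₁≈ {Y} e = cancelˡ {P} (torsionFreeRing p {{prime⇒nonZero pr}}) (begin
        P B.* B.fromℕ# n₁                ≈⟨ XX̄ ⟨
        X B.* conj X                     ≈⟨ B.*-cong e (B.trans (conj-cong e) (conj-* P Y)) ⟩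
        P B.* Y B.* (conj P B.* conj Y)  ≈⟨ B.*-congˡ {P B.* Y} (B.*-congʳ {conj Y} (conj-fromℕ# p)) ⟩
        P B.* Y B.* (P B.* conj Y)       ≈⟨ B.solve 3 (λ p y z → p B.:* y B.:* (p B.:* z) B.:= p B.:* (p B.:* (y B.:* z))) B.refl P Y (conj Y) ⟩
        P B.* (P B.* (Y B.* conj Y))     ∎)
        where open Relation.Binary.Reasoning.Setoid B.setoid

      1≈ : ∀ {Z} → B.fromℕ# n₁ B.≈ P B.* Z → Bézout.Identity 1 n₁ p → P B.∣ B.1#
      1≈ {Z} e (Bézout.+- x y eq) = B.fromℕ# x B.* Z B.- B.fromℕ# y , (begin
        B.1#                                                 ≈⟨ B.+-identityʳ B.1# ⟨
        B.fromℕ# 1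
          ≈⟨ B.solve 2 (λ a b → a B.:= a B.:+ b B.:- b) B.refl (B.fromℕ# 1) (B.fromℕ# (y ℕ.* p)) ⟩
        B.fromℕ# 1 B.+ B.fromℕ# (y ℕ.* p) B.- B.fromℕ# (y ℕ.* p)
          ≈⟨ B.+-congʳ (B.×-homo-+ B.1# 1 (y ℕ.* p)) ⟨
        B.fromℕ# (1 ℕ.+ y ℕ.* p) B.- B.fromℕ# (y ℕ.* p)
          ≈⟨ B.+-cong (B.trans (B.reflexive (≡.cong B.fromℕ# eq)) (B.fromℕ#-* x n₁)) (B.-‿cong (B.fromℕ#-* y p)) ⟩
        B.fromℕ# x B.* B.fromℕ# n₁ B.- B.fromℕ# y B.* P
          ≈⟨ B.+-congʳ (B.*-congˡ {B.fromℕ# x} e) ⟩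
        B.fromℕ# x B.* (P B.* Z) B.- B.fromℕ# y B.* P
          ≈⟨ B.solve 4 (λ x P Z y → x B.:* (P B.:* Z) B.:- y B.:* P B.:= P B.:* (x B.:* Z B.:- y)) B.refl (B.fromℕ# x) P Z (B.fromℕ# y) ⟩
        P B.* (B.fromℕ# x B.* Z B.- B.fromℕ# y) ∎)
        where open Relation.Binary.Reasoning.Setoid B.setoid
      1≈ {Z} e (Bézout.-+ x y eq) = B.fromℕ# y B.- B.fromℕ# x B.* Z , (begin
        B.1#                                                 ≈⟨ B.+-identityʳ B.1# ⟨
        B.fromℕ# 1
          ≈⟨ B.solve 2 (λ a b → a B.:= a B.:+ b B.:- b) B.refl (B.fromℕ# 1) (B.fromℕ# (x ℕ.* n₁)) ⟩
        B.fromℕ# 1 B.+ B.fromℕ# (x ℕ.* n₁) B.- B.fromℕ# (x ℕ.* n₁)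
          ≈⟨ B.+-congʳ (B.×-homo-+ B.1# 1 (x ℕ.* n₁)) ⟨
        B.fromℕ# (1 ℕ.+ x ℕ.* n₁) B.- B.fromℕ# (x ℕ.* n₁)
          ≈⟨ B.+-cong (B.trans (B.reflexive (≡.cong B.fromℕ# eq)) (B.fromℕ#-* y p)) (B.-‿cong (B.fromℕ#-* x n₁)) ⟩
        B.fromℕ# y B.* P B.- B.fromℕ# x B.* B.fromℕ# n₁
          ≈⟨ B.+-congˡ (B.-‿cong (B.*-congˡ {B.fromℕ# x} e)) ⟩
        B.fromℕ# y B.* P B.- B.fromℕ# x B.* (P B.* Z)
          ≈⟨ B.solve 4 (λ x P Z y → y B.:* P B.:- x B.:* (P B.:* Z) B.:= P B.:* (y B.:- x B.:* Z)) B.refl (B.fromℕ# x) P Z (B.fromℕ# y) ⟩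
        P B.* (B.fromℕ# y B.- B.fromℕ# x B.* Z) ∎)
        where open Relation.Binary.Reasoning.Setoid B.setoid

      -- The element 1 is a sum of one root of unity and 1 < p, so by `indivisible` divisibility by
      -- p would make it zero.
      P∤1 : ¬ P B.∣ B.1#
      P∤1 (Z , e) = 1≉0 (indivisible h ζ ζ^h≈1 {K} disc ⟨ 0 ⟩ (coefficient 0 Z) p (ℕ.nonTrivial⇒n>1 p {{prime⇒nonTrivial pr}})
        (coefficient-divisible p e 0))

    impossible : ⊥
    impossible = P∤1 (1≈ (n₁≈ (proj₂ P∣X)) (coprime-Bézout (∤⇒coprime pr p∤n₁)))

  -- If two powers of ζ are congruent modulo p ^ k, raising to the power p ^ 2J, which fixes them,
  -- shows that they are congruent modulo p ^ (k + 1).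
  module CongruentRoots where
    open Untwisted
    private
      module A where
        open CommutativeRing halfRing public
        open RingProperties halfRing public

    open Frobenius halfRing pr using (power-lift)

    private
      q = p ℕ.^ J

      X : ℕ → FormalSum (ℕ × ℕ)
      X i = ⟨ i , 0 ⟩

      X^q² : ∀ i → X i A.^ (p ℕ.^ (J ℕ.+ J)) A.≈ X i
      X^q² i = A.trans (half-mono-^ (i , 0) (p ℕ.^ (J ℕ.+ J)))
        (half-intro λ i₀ l₀ → *-congʳ (begin
          ζ ^ (i₀ ℕ.+ p ℕ.^ (J ℕ.+ J) ℕ.* i)
            ≈⟨ ^-congʳ ζ (≡.cong (λ x → i₀ ℕ.+ x ℕ.* i) (ℕ.^-distribˡ-+-* p J J)) ⟩
          ζ ^ (i₀ ℕ.+ q ℕ.* q ℕ.* i)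
            ≈⟨ period (i₀ ℕ.+ q ℕ.* q ℕ.* i) i ⟨
          ζ ^ (i₀ ℕ.+ q ℕ.* q ℕ.* i ℕ.+ suc q ℕ.* i)
            ≡⟨ ≡.cong (ζ ^_) (shuffle i₀ q i) ⟩
          ζ ^ (i₀ ℕ.+ i ℕ.+ suc q ℕ.* (q ℕ.* i))
            ≈⟨ period (i₀ ℕ.+ i) (q ℕ.* i) ⟩
          ζ ^ (i₀ ℕ.+ i) ∎))
        where
        open Relation.Binary.Reasoning.Setoid setoid
        period : ∀ i₀ i → ζ ^ (i₀ ℕ.+ suc q ℕ.* i) ≈ ζ ^ i₀
        period i₀ i = trans (^-congʳ ζ (≡.cong (i₀ ℕ.+_) (≡.trans (≡.cong (ℕ._* i) (ℕ._∣_.equality h∣)) (shuffle′ (ℕ.quotient h∣) h i))))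
          (ζ^-periodic i₀ (ℕ.quotient h∣ ℕ.* i))
          where
          shuffle′ : ∀ q h i → q ℕ.* h ℕ.* i ≡ q ℕ.* i ℕ.* h
          shuffle′ = solve-∀
        shuffle : ∀ i₀ q i → i₀ ℕ.+ q ℕ.* q ℕ.* i ℕ.+ suc q ℕ.* i ≡ i₀ ℕ.+ i ℕ.+ suc q ℕ.* (q ℕ.* i)
        shuffle = solve-∀

      raise : ∀ i j k → ∃[ Z ] X i A.≈ X j A.+ A.fromℕ# (p ℕ.^ suc k) A.* Z →
                        ∃[ Z ] X i A.≈ X j A.+ A.fromℕ# (p ℕ.^ suc (suc k)) A.* Z
      raise i j k (Z , e) = proj₁ lifted , A.trans (A.sym (X^q² i)) (A.trans (A.^-congˡ (p ℕ.^ (J ℕ.+ J)) e)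
          (A.trans (proj₂ lifted) (A.+-congʳ (X^q² j))))
        where lifted = power-lift k (X j) Z (J ℕ.+ J) (ℕ.≤-trans 1≤J (ℕ.m≤m+n J J))

      raises : ∀ i j → ∃[ Z ] X i A.≈ X j A.+ A.fromℕ# p A.* Z →
               ∀ k → ∃[ Z ] X i A.≈ X j A.+ A.fromℕ# (p ℕ.^ suc k) A.* Z
      raises i j (Z , e) zero    = Z , A.trans e (A.+-congˡ (A.*-congʳ {Z} (A.reflexive (≡.cong A.fromℕ# (≡.sym (ℕ.*-identityʳ p))))))
      raises i j Ze      (suc k) = raise i j k (raises i j Ze k)

    congruent-roots : ∀ i j Q → ζ ^ i - ζ ^ j ≈ p · ev (ζ ^_) Q → ζ ^ i - ζ ^ j ≈ 0#
    congruent-roots i j Q e = disc (⟨ i ⟩ ⊕ ⊖ ⟨ j ⟩) (coefficient 0 (proj₁ high)) (p ℕ.^ suc N) high-divisible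
        (ℕ.<-≤-trans (≡.subst (ℕ._< p ℕ.^ N) (≡.trans (≡.cong (K ℕ.* 2 ℕ.*_) (ℕ.^-zeroˡ N)) (ℕ.*-identityʳ _)) (proj₂ growth))
          (ℕ.m≤n*m (p ℕ.^ N) p {{prime⇒nonZero pr}}))
      where
      -- The difference of two roots of unity has size 2, so a modulus above K * 2 forces it to
      -- vanish.
      growth = exponential-growth (K ℕ.* 2) 1 p (ℕ.nonTrivial⇒n>1 p {{prime⇒nonTrivial pr}})
      N = proj₁ growth
      Z₀ : FormalSum (ℕ × ℕ)
      Z₀ = bind Q X
      pZ₀ : X i A.- X j A.≈ A.fromℕ# p A.* Z₀
      pZ₀ = A.trans (half-intro λ i₀ l₀ → (begin
          ζ ^ (i₀ ℕ.+ i) * 1# - ζ ^ (i₀ ℕ.+ j) * 1#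
            ≈⟨ +-cong (trans (*-identityʳ _) (^-homo-* ζ i₀ i)) (-‿cong (trans (*-identityʳ _) (^-homo-* ζ i₀ j))) ⟩
          ζ ^ i₀ * ζ ^ i - ζ ^ i₀ * ζ ^ j
            ≈⟨ solve 3 (λ a x y → a :* x :- a :* y := a :* (x :- y)) refl (ζ ^ i₀) (ζ ^ i) (ζ ^ j) ⟩
          ζ ^ i₀ * (ζ ^ i - ζ ^ j)
            ≈⟨ trans (*-congˡ e) (×-comm-* p _ _) ⟩
          p · (ζ ^ i₀ * ev (ζ ^_) Q)
            ≈⟨ ×-congʳ p (trans (ev-bind _ X Q) (trans (ev-cong (λ i → trans (*-identityʳ _) (^-homo-* ζ i₀ i)) Q) (ev-*ˡ (ζ ^ i₀) (ζ ^_) Q))) ⟨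
          p · ev (λ g → s ((i₀ , l₀) ⊹ g)) Z₀
            ≈⟨ ev-multiple _ p Z₀ ⟨
          ev (λ g → s ((i₀ , l₀) ⊹ g)) (p A.· Z₀) ∎)) (A.·≈fromℕ#* p Z₀)
        where open Relation.Binary.Reasoning.Setoid setoid
      start : X i A.≈ X j A.+ A.fromℕ# p A.* Z₀
      start = A.trans (A.solve 2 (λ a b → a A.:= b A.:+ (a A.:- b)) A.refl (X i) (X j)) (A.+-congˡ {X j} pZ₀)
      high = raises i j (Z₀ , start) N
      high-divisible : ζ ^ i - ζ ^ j ≈ (p ℕ.^ suc N) · ev (ζ ^_) (coefficient 0 (proj₁ high))
      high-divisible = trans (+-cong (^-congʳ ζ (≡.sym (ℕ.+-identityʳ i))) (-‿cong (^-congʳ ζ (≡.sym (ℕ.+-identityʳ j)))))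
        (half-coefficient-divisible (p ℕ.^ suc N) {X i A.- X j} (A.trans (A.+-congʳ (proj₂ high))
          (A.solve 2 (λ a b → b A.:+ a A.:- b A.:= a) A.refl (A.fromℕ# (p ℕ.^ suc N) A.* proj₁ high) (X j))) 0)

  -- The case p² ∣ n.  Modulo 1 + x^(n/p) + … + x^((p-1)n/p) one finds p ∣ D, so entries of the
  -- first row at distance n/p are congruent modulo p, hence equal.
  module Cosets (A n′ n₁ n₂ : ℕ) (n≡ : n ≡ p ℕ.* n₁) (n₁≡p*n₂ : n₁ ≡ p ℕ.* n₂) (n₁≡ : n₁ ≡ p ℕ.^ A ℕ.* n′)
                (n′∣ : n′ ℕ.∣ suc (p ℕ.^ J)) where
    indicator : ∀ {l} → Dec (n ℕ.∣ l) → FormalSum ℕ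
    indicator (yes _) = ⟨ 0 ⟩
    indicator (no _)  = 𝟘

    ind : ℕ → FormalSum ℕ
    ind l = indicator (n ℕ.∣? l)

    ι : ℕ → Carrier
    ι l = ev (ζ ^_) (ind l)

    ι-yes : ∀ {l} → n ℕ.∣ l → ι l ≈ 1#
    ι-yes {l} d with n ℕ.∣? l
    ... | yes _  = refl
    ... | no ¬d  = ⊥-elim (¬d d)

    ι-no : ∀ {l} → ¬ n ℕ.∣ l → ι l ≈ 0#
    ι-no {l} ¬d with n ℕ.∣? l
    ... | yes d  = ⊥-elim (¬d d)
    ... | no _   = refl

    ι-cong : ∀ {l l′} → (n ℕ.∣ l → n ℕ.∣ l′) → (n ℕ.∣ l′ → n ℕ.∣ l) → ι l ≈ ι l′
    ι-cong {l} {l′} to from with n ℕ.∣? l′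
    ... | yes d  = ι-yes (from d)
    ... | no ¬d  = ι-no (λ d → ¬d (to d))

    ι-periodic : ∀ l → ι (l ℕ.+ n) ≈ ι l
    ι-periodic l = ι-cong (λ d → ℕ.∣m+n∣m⇒∣n (≡.subst (n ℕ.∣_) (ℕ.+-comm l n) d) ℕ.∣-refl)
                          (λ d → ℕ.∣m∣n⇒∣m+n d ℕ.∣-refl)

    -- On multiples of 1 + x^n₁ + ... + x^((p-1)n₁) this difference telescopes to ι l - ι (l + n) =
    -- 0, so that polynomial vanishes in the quotient. On translates of D it yields the difference
    -- of two row entries at distance n₁ = n/p.
    T : ℕ → FormalSum ℕ
    T l = ind l ⊕ ⊖ ind (l ℕ.+ n₁)

    T-periodic : ∀ l → ev (ζ ^_) (T (l ℕ.+ n)) ≈ ev (ζ ^_) (T l)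
    T-periodic l = +-cong (ι-periodic l) (-‿cong (trans (reflexive (≡.cong ι (shuffle l n n₁))) (ι-periodic (l ℕ.+ n₁))))
      where
      shuffle : ∀ l n m → l ℕ.+ n ℕ.+ m ≡ l ℕ.+ m ℕ.+ n
      shuffle = solve-∀

    open TwistedRingProperties R torsionFree n h ζ ζ^h≈1 T T-periodic
    private
      module B where
        open CommutativeRing twistedRing public
        open RingProperties twistedRing public
      module H = CommutativeRing halfRing
    open Conjugation conjugation
    open Descent twistedRing conjugation using (Descends)
    open Geometric

    private
      instance
        p≢0 : NonZero p
        p≢0 = prime⇒nonZero pr

      n₁≢0 : ¬ n₁ ≡ 0
      n₁≢0 e = ℕ.≢-nonZero⁻¹ n (≡.trans n≡ (≡.trans (≡.cong (p ℕ.*_) e) (ℕ.*-zeroʳ p)))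

      n∤n₁ : ¬ n ℕ.∣ n₁
      n∤n₁ d = ℕ.<⇒≱ (≡.subst (n₁ ℕ.<_) (≡.sym (≡.trans n≡ (ℕ.*-comm p n₁))) (ℕ.m<m*n n₁ p {{ℕ.≢-nonZero n₁≢0}} (ℕ.nonTrivial⇒n>1 p {{prime⇒nonTrivial pr}})))
                     (ℕ.∣⇒≤ {{ℕ.≢-nonZero n₁≢0}} d)

      t₀≉0 : ¬ t 0 ≈ 0#
      t₀≉0 z = 1≉0 (begin
        1#             ≈⟨ +-identityʳ 1# ⟨
        1# + 0#        ≈⟨ solve 1 (λ a → a := a :- :0) refl (1# + 0#) ⟩
        1# + 0# - 0#   ≈⟨ +-cong (trans (+-identityʳ 1#) (sym (ι-yes (n ℕ.∣0)))) (-‿cong (sym (ι-no n∤n₁))) ⟩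
        ι 0 - ι n₁     ≈⟨ z ⟩
        0#             ∎)
        where open Relation.Binary.Reasoning.Setoid setoid

      telescope : ∀ m i l → ev (λ g → s ((i , l) ⊹ g)) (geometric halfRing m ⟨ 0 , n₁ ⟩) ≈
                            ζ ^ i * (ι l - ι (l ℕ.+ m ℕ.* n₁))
      telescope zero    i l = sym (trans (*-congˡ (trans (+-congˡ (-‿cong (reflexive (≡.cong ι (ℕ.+-identityʳ l))))) (-‿inverseʳ _))) (zeroʳ _))
      telescope (suc m) i l = begin
        s ((i , l) ⊹ (0 , 0)) + ev (λ g → s ((i , l) ⊹ g)) (⟨ 0 , n₁ ⟩ ⊛ G)
          ≈⟨ +-cong (reflexive (≡.cong s (≡.cong₂ _,_ (ℕ.+-identityʳ i) (ℕ.+-identityʳ l))))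
               (trans (ev-convolve _⊹_ _ ⟨ 0 , n₁ ⟩ G) (ev-cong (λ g → reflexive (≡.cong s (≡.sym (⊹-assoc (i , l) (0 , n₁) g)))) G)) ⟩
        s (i , l) + ev (λ g → s ((i ℕ.+ 0 , l ℕ.+ n₁) ⊹ g)) G
          ≈⟨ +-congˡ (telescope m (i ℕ.+ 0) (l ℕ.+ n₁)) ⟩
        ζ ^ i * (ι l - ι (l ℕ.+ n₁)) + ζ ^ (i ℕ.+ 0) * (ι (l ℕ.+ n₁) - ι (l ℕ.+ n₁ ℕ.+ m ℕ.* n₁))
          ≈⟨ +-congˡ (*-cong (^-congʳ ζ (ℕ.+-identityʳ i)) (+-congˡ (-‿cong (reflexive (≡.cong ι (ℕ.+-assoc l n₁ (m ℕ.* n₁))))))) ⟩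
        ζ ^ i * (ι l - ι (l ℕ.+ n₁)) + ζ ^ i * (ι (l ℕ.+ n₁) - ι (l ℕ.+ suc m ℕ.* n₁))
          ≈⟨ solve 4 (λ z a b c → z :* (a :- b) :+ z :* (b :- c) := z :* (a :- c)) refl (ζ ^ i) (ι l) (ι (l ℕ.+ n₁)) (ι (l ℕ.+ suc m ℕ.* n₁)) ⟩
        ζ ^ i * (ι l - ι (l ℕ.+ suc m ℕ.* n₁)) ∎
        where
        open Relation.Binary.Reasoning.Setoid setoid
        G = geometric halfRing m ⟨ 0 , n₁ ⟩

      sum-half : geometric halfRing p ⟨ 0 , n₁ ⟩ H.≈ H.0#
      sum-half = half-intro λ i l → trans (telescope p i l) (trans (*-congˡ (trans
        (+-congˡ (-‿cong (trans (reflexive (≡.cong (λ x → ι (l ℕ.+ x)) (≡.sym n≡))) (ι-periodic l)))) (-‿inverseʳ _))) (zeroʳ _))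

      sum≈0 : geometric twistedRing p (⟨ 0 , n′ ⟩ B.^ (p ℕ.^ A)) B.≈ B.0#
      sum≈0 = B.trans (geometric-cong twistedRing p (B.trans (mono-^ (0 , n′) (p ℕ.^ A))
          (B.reflexive (≡.cong₂ (λ x y → ⟨ x , y ⟩) (ℕ.*-zeroʳ (p ℕ.^ A)) (≡.sym n₁≡)))))
        (≡.subst (λ m → geometric halfRing m ⟨ 0 , n₁ ⟩ H.≈ H.0# → geometric twistedRing m ⟨ 0 , n₁ ⟩ B.≈ B.0#) (ℕ.suc-pred p)
          (geometric-both (ℕ.pred p) (0 , n₁)) sum-half)

      powers : ∀ g → ∃[ k ] ⟨ suc (p ℕ.^ J) ⋆ g ⟩ B.≈ ⟨ 0 , n′ ⟩ B.^ k
      powers (i , l) = k , B.trans (half-mono {suc (p ℕ.^ J) ⋆ (i , l)} {k ⋆ (0 , n′)} (half-intro λ i₀ l₀ → *-cong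
          (trans (^-congʳ ζ (≡.cong (i₀ ℕ.+_) (≡.trans (≡.cong (ℕ._* i) (ℕ._∣_.equality h∣)) (swap (ℕ.quotient h∣) h i))))
            (trans (ζ^-periodic i₀ (ℕ.quotient h∣ ℕ.* i)) (^-congʳ ζ (≡.sym (≡.trans (≡.cong (i₀ ℕ.+_) (ℕ.*-zeroʳ k)) (ℕ.+-identityʳ i₀))))))
          (reflexive (≡.cong (λ x → t (l₀ ℕ.+ x)) (≡.trans (≡.cong (ℕ._* l) (ℕ._∣_.equality n′∣)) (swap (ℕ.quotient n′∣) n′ l))))))
        (B.sym (mono-^ (0 , n′) k))
        where
        k = ℕ.quotient n′∣ ℕ.* l
        swap : ∀ q h i → q ℕ.* h ℕ.* i ≡ q ℕ.* i ℕ.* h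
        swap = solve-∀

      DD̄-divisible : B.fromℕ# p B.* B.fromℕ# p B.∣ D row B.* conj (D row)
      DD̄-divisible = B.fromℕ# n₂ , B.trans (DD̄ row (entry-periodic 0) autocorrelation-0 autocorrelation-l)
        (B.trans (B.reflexive (≡.cong B.fromℕ# (≡.trans n≡ (≡.trans (≡.cong (p ℕ.*_) n₁≡p*n₂) (≡.sym (ℕ.*-assoc p p n₂))))))
          (B.trans (B.fromℕ#-* (p ℕ.* p) n₂) (B.*-congʳ {B.fromℕ# n₂} (B.fromℕ#-* p p))))

      p∣D : B.fromℕ# p B.∣ D row
      p∣D = descendsRing pr J 1≤J (0 , n′) A sum≈0 powers (D row) DD̄-divisible

      open RangeSum +-commutativeMonoid

      -- Only the index k ≡ -m modulo n contributes, and κ * m is a natural number in that class.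
      pick : ∀ m → Σ< n (λ k → ζ ^ row k * ι (m ℕ.+ k)) ≈ ζ ^ row (κ ℕ.* m)
      pick m = begin
        Σ< n f                          ≈⟨ Σ<-shift n f f-periodic (κ ℕ.* m) ⟨
        Σ< n (λ k → f (k ℕ.+ κ ℕ.* m))  ≈⟨ Σ<-first n (λ k → f (k ℕ.+ κ ℕ.* m)) (λ k 0<k k<n →
                                             trans (*-congˡ (ι-no (λ d → ℕ.<⇒≱ k<n (ℕ.∣⇒≤ {{ℕ.>-nonZero 0<k}} (offset k d))))) (zeroʳ _)) ⟩
        f (κ ℕ.* m)                     ≈⟨ trans (*-congˡ (ι-yes n∣m+κm)) (*-identityʳ _) ⟩
        ζ ^ row (κ ℕ.* m)               ∎
        where
        open Relation.Binary.Reasoning.Setoid setoid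
        f : ℕ → Carrier
        f k = ζ ^ row k * ι (m ℕ.+ k)
        f-periodic : ∀ k → f (k ℕ.+ n) ≈ f k
        f-periodic k = *-cong (^-congʳ ζ (entry-periodic 0 k)) (trans (reflexive (≡.cong ι (≡.sym (ℕ.+-assoc m k n)))) (ι-periodic (m ℕ.+ k)))
        n∣m+κm : n ℕ.∣ m ℕ.+ κ ℕ.* m
        n∣m+κm = divides (2 ℕ.* h ℕ.* m) (≡.trans (≡.cong (ℕ._* m) (suc-inverseExponent n h)) (right h n m))
          where
          right : ∀ h n l → 2 ℕ.* (h ℕ.* n) ℕ.* l ≡ 2 ℕ.* h ℕ.* l ℕ.* n
          right = solve-∀
        offset : ∀ k → n ℕ.∣ m ℕ.+ (k ℕ.+ κ ℕ.* m) → n ℕ.∣ k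
        offset k d = ℕ.∣m+n∣m⇒∣n (≡.subst (n ℕ.∣_) (shuffle m k (κ ℕ.* m)) d) n∣m+κm
          where
          shuffle : ∀ m k x → m ℕ.+ (k ℕ.+ x) ≡ m ℕ.+ x ℕ.+ k
          shuffle = solve-∀

      ev-D : ∀ l₀ → ev (ζ ^_) (coefficient l₀ (D row)) ≈ ζ ^ row (κ ℕ.* l₀) - ζ ^ row (κ ℕ.* (l₀ ℕ.+ n₁))
      ev-D l₀ = begin
        ev (ζ ^_) (coefficient l₀ (D row))
          ≈⟨ trans (ev-coefficient l₀ (D row)) (ev-⨁ _ {n} _) ⟩
        Σ< n (λ k → ζ ^ row k * (ι (l₀ ℕ.+ k) - ι (l₀ ℕ.+ k ℕ.+ n₁)))
          ≈⟨ Σ<-cong n (λ k → trans (*-congˡ {ζ ^ row k} (+-congˡ {ι (l₀ ℕ.+ k)} (-‿cong (reflexive (≡.cong ι (shuffle l₀ k n₁))))))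
               (solve 3 (λ a b c → a :* (b :- c) := a :* b :+ (:- :1) :* (a :* c)) refl (ζ ^ row k) (ι (l₀ ℕ.+ k)) (ι (l₀ ℕ.+ n₁ ℕ.+ k)))) ⟩
        Σ< n (λ k → ζ ^ row k * ι (l₀ ℕ.+ k) + (- 1#) * (ζ ^ row k * ι (l₀ ℕ.+ n₁ ℕ.+ k)))
          ≈⟨ ∑-distrib-+ {n} (λ k → f (toℕ k)) (λ k → (- 1#) * g (toℕ k)) ⟩
        Σ< n f + Σ< n (λ k → (- 1#) * g k)
          ≈⟨ +-cong (pick l₀) (trans (sym (*-distribˡ-sum {n} (- 1#) (λ k → g (toℕ k)))) (*-congˡ (pick (l₀ ℕ.+ n₁)))) ⟩
        ζ ^ row (κ ℕ.* l₀) + (- 1#) * ζ ^ row (κ ℕ.* (l₀ ℕ.+ n₁))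
          ≈⟨ +-congˡ (solve 1 (λ a → (:- :1) :* a := :- a) refl _) ⟩
        ζ ^ row (κ ℕ.* l₀) - ζ ^ row (κ ℕ.* (l₀ ℕ.+ n₁)) ∎
        where
        open Relation.Binary.Reasoning.Setoid setoid
        f g : ℕ → Carrier
        f k = ζ ^ row k * ι (l₀ ℕ.+ k)
        g k = ζ ^ row k * ι (l₀ ℕ.+ n₁ ℕ.+ k)
        shuffle : ∀ l k n → l ℕ.+ k ℕ.+ n ≡ l ℕ.+ n ℕ.+ k
        shuffle = solve-∀

    impossible : ⊥
    impossible = D-nonzero row (entry-periodic 0) autocorrelation-0 autocorrelation-l t₀≉0 λ l₀ →
      trans (ev-D l₀) (CongruentRoots.congruent-roots (row (κ ℕ.* l₀)) (row (κ ℕ.* (l₀ ℕ.+ n₁))) (coefficient l₀ (proj₁ p∣D))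
        (trans (sym (ev-D l₀)) (coefficient-divisible p (proj₂ p∣D) l₀)))

self-conjugate∣n⇒∣h : ∀ {c ℓ} (R : CommutativeRing c ℓ) (domain : IntegralDomain R) (char0 : CharZero R)
  (n h : ℕ) {{_ : NonZero n}} {{_ : NonZero h}} (ζ : CommutativeRing.Carrier R)
  (ζ^h≈1 : CommutativeRing._≈_ R (RingProperties._^_ R ζ h) (CommutativeRing.1# R))
  (H : Fin n → Fin n → Fin h) → IsBH R n h ζ H →
  ∀ K → IntegralDomainProperties.DiscreteRoots R domain char0 h ζ ζ^h≈1 K →
  ∀ {p} → Prime p → SelfConjPrime p (lcm n h) → p ℕ.∣ n → ¬ ¬ p ℕ.∣ h
self-conjugate∣n⇒∣h R domain char0 n h ζ ζ^h≈1 H bh K disc {p} pr sc (divides n₁ n≡) p∤h with p ℕ.∣? n₁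
... | no p∤n₁ = Unramified.RowSum.impossible R domain char0 n h ζ ζ^h≈1 H bh K disc pr J 1≤J h∣
                  n₁ (≡.trans n≡ (ℕ.*-comm n₁ p)) p∤n₁
  where
  J = proj₁ (selfConj-exponent pr sc)
  1≤J = proj₁ (proj₂ (selfConj-exponent pr sc))
  h∣ = proj₂ (proj₂ (selfConj-exponent pr sc)) h (n∣lcm[m,n] n h) p∤h
... | yes (divides n₂ n₁≡) = Unramified.Cosets.impossible R domain char0 n h ζ ζ^h≈1 H bh K disc pr J 1≤J
                  (∣1+p^J h (n∣lcm[m,n] n h) p∤h) A n′ n₁ n₂ (≡.trans n≡ (ℕ.*-comm n₁ p)) (≡.trans n₁≡ (ℕ.*-comm n₂ p)) n₁≡p^A*n′
                  (∣1+p^J n′ (ℕ.∣-trans (divides (p ℕ.^ A) n₁≡p^A*n′) (ℕ.∣-trans (ℕ.divides p (≡.trans n≡ (ℕ.*-comm n₁ p))) (m∣lcm[m,n] n h))) p∤n′)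
  where
  J = proj₁ (selfConj-exponent pr sc)
  1≤J = proj₁ (proj₂ (selfConj-exponent pr sc))
  ∣1+p^J = proj₂ (proj₂ (selfConj-exponent pr sc))
  n₁≢0 : NonZero n₁
  n₁≢0 = ℕ.≢-nonZero λ { ≡.refl → ℕ.≢-nonZero⁻¹ n n≡ }
  extracted = extract-prime pr n₁ {{n₁≢0}}
  A = proj₁ extracted
  n′ = proj₁ (proj₂ extracted)
  n₁≡p^A*n′ = proj₁ (proj₂ (proj₂ extracted))
  p∤n′ = proj₂ (proj₂ (proj₂ extracted))

-- Cyclicity of the p-part

module CyclicPowers {c ℓ : Level} (R : CommutativeRing c ℓ) where
  open CommutativeRing R hiding (zero)
  open RingProperties R
  open Relation.Binary.Reasoning.Setoid setoid

  ^-multiple : ∀ x m {k} → x ^ m ≈ 1# → m ℕ.∣ k → x ^ k ≈ 1#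
  ^-multiple x m e (divides q ≡.refl) = trans (^-congʳ x (ℕ.*-comm q m)) (trans (sym (^-assocʳ x m q)) (trans (^-congˡ q e) (1^ q)))

  ^-power : ∀ {x} y k → x ≈ y ^ k → ∀ m → x ^ m ≈ y ^ (k ℕ.* m)
  ^-power y k e m = trans (^-congˡ m e) (^-assocʳ y k m)

  power-of-coprime : ∀ {x y} N M K i → Coprime N M → x ^ M ≈ 1# → x ^ N ≈ y ^ i → y ^ suc K ≈ 1# → ∃[ k ] x ≈ y ^ k
  power-of-coprime {x} {y} N M K i cop x^M x^N y^K with coprime-Bézout cop
  ... | Bézout.+- a b eq = i ℕ.* a , (begin
    x                           ≈⟨ *-identityʳ x ⟨
    x * 1#                      ≈⟨ *-congˡ (^-multiple x M x^M (divides b ≡.refl)) ⟨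
    x ^ (1 ℕ.+ b ℕ.* M)         ≡⟨ ≡.cong (x ^_) (≡.trans eq (ℕ.*-comm a N)) ⟩
    x ^ (N ℕ.* a)               ≈⟨ ^-assocʳ x N a ⟨
    (x ^ N) ^ a                 ≈⟨ ^-power y i x^N a ⟩
    y ^ (i ℕ.* a)               ∎)
  -- Here x equals an inverse power of y; since y^(K+1) = 1, the power y^(K j) is the inverse of
  -- y^j.
  ... | Bézout.-+ a b eq = K ℕ.* j , (begin
    x                                       ≈⟨ *-identityʳ x ⟨
    x * 1#                                  ≈⟨ *-congˡ (^-multiple y (suc K) y^K (divides j (ℕ.*-comm (suc K) j))) ⟨
    x * y ^ (j ℕ.+ K ℕ.* j)                 ≈⟨ *-congˡ (^-homo-* y j (K ℕ.* j)) ⟩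
    x * (y ^ j * y ^ (K ℕ.* j))             ≈⟨ *-assoc x _ _ ⟨
    x * y ^ j * y ^ (K ℕ.* j)               ≈⟨ *-congʳ (*-congˡ (^-power y i x^N a)) ⟨
    x * (x ^ N) ^ a * y ^ (K ℕ.* j)         ≈⟨ *-congʳ (*-congˡ (trans (^-assocʳ x N a) (^-congʳ x (ℕ.*-comm N a)))) ⟩
    x ^ (1 ℕ.+ a ℕ.* N) * y ^ (K ℕ.* j)     ≈⟨ *-congʳ (trans (^-congʳ x eq) (^-multiple x M x^M (divides b ≡.refl))) ⟩
    1# * y ^ (K ℕ.* j)                      ≈⟨ *-identityˡ _ ⟩
    y ^ (K ℕ.* j)                           ∎)
    where j = i ℕ.* a

  -- g₁ and g₂ have orders M₁ = m₁ d and M₂ = m₂ d, and g₁ ^ m₁ = g₂ ^ m₂.  If p ∤ m₂ then the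
  -- p-parts of g₁ and g₂ are powers of the p-part η = g₁ ^ M₁′ of g₁.
  module _ {p : ℕ} (pr : Prime p) {g₁ g₂ : Carrier} {d m₁ m₂ : ℕ} {K q : ℕ}
           (g₁-order : g₁ ^ (m₁ ℕ.* d) ≈ 1#) (g₂-order : g₂ ^ (m₂ ℕ.* d) ≈ 1#) (g₁^K≈1 : g₁ ^ suc K ≈ 1#)
           (g₂^m₂≈g₁^m₁ : g₂ ^ m₂ ≈ g₁ ^ m₁) (p∤m₂ : ¬ p ℕ.∣ m₂)
           {c₁ c₂ M₁′ M₂′ : ℕ} (M₁≡ : m₁ ℕ.* d ≡ p ℕ.^ c₁ ℕ.* M₁′) (M₂≡ : m₂ ℕ.* d ≡ p ℕ.^ c₂ ℕ.* M₂′)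
           (p∤M₁′ : ¬ p ℕ.∣ M₁′) (M₁′∣q : M₁′ ℕ.∣ q) (M₂′∣q : M₂′ ℕ.∣ q) where

    private
      η = g₁ ^ M₁′

    g₁^q-power : ∃[ k ] g₁ ^ q ≈ η ^ k
    g₁^q-power = ℕ.quotient M₁′∣q , trans (^-congʳ g₁ (≡.trans (ℕ._∣_.equality M₁′∣q) (ℕ.*-comm (ℕ.quotient M₁′∣q) M₁′))) (sym (^-assocʳ g₁ M₁′ _))

    private
      M₁′∣m₁M₂′ : M₁′ ℕ.∣ m₁ ℕ.* M₂′
      M₁′∣m₁M₂′ = coprime-^-divisor (∤⇒coprime pr p∤M₁′) c₂ _ (ℕ.∣-trans (divides (p ℕ.^ c₁) M₁≡)
        (ℕ.∣-trans (ℕ.*-monoʳ-∣ m₁ (ℕ.n∣m*n m₂ {d})) (ℕ.∣-reflexive (≡.trans (≡.cong (m₁ ℕ.*_) M₂≡) (shuffle m₁ (p ℕ.^ c₂) M₂′)))))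
        where
        shuffle : ∀ a b c → a ℕ.* (b ℕ.* c) ≡ b ℕ.* (a ℕ.* c)
        shuffle = solve-∀

      -- The element g₂^M₂′ has p-power order, prime to m₂. Its m₂-th power is g₁^(m₁ M₂′), a power
      -- of η because M₁′ ∣ m₁ M₂′; `power-of-coprime` then removes m₂.
      g₂^M₂′-power : ∃[ k ] g₂ ^ M₂′ ≈ η ^ k
      g₂^M₂′-power = power-of-coprime m₂ (p ℕ.^ c₂) K (ℕ.quotient M₁′∣m₁M₂′) (coprime-^ (∤⇒coprime pr p∤m₂) c₂)
        (trans (^-assocʳ g₂ M₂′ (p ℕ.^ c₂)) (trans (^-congʳ g₂ (≡.trans (ℕ.*-comm M₂′ _) (≡.sym M₂≡))) g₂-order))
        (begin
          (g₂ ^ M₂′) ^ m₂             ≈⟨ trans (^-assocʳ g₂ M₂′ m₂) (trans (^-congʳ g₂ (ℕ.*-comm M₂′ m₂)) (sym (^-assocʳ g₂ m₂ M₂′))) ⟩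
          (g₂ ^ m₂) ^ M₂′             ≈⟨ trans (^-congˡ M₂′ g₂^m₂≈g₁^m₁) (^-assocʳ g₁ m₁ M₂′) ⟩
          g₁ ^ (m₁ ℕ.* M₂′)           ≡⟨ ≡.cong (g₁ ^_) (≡.trans (ℕ._∣_.equality M₁′∣m₁M₂′) (ℕ.*-comm (ℕ.quotient M₁′∣m₁M₂′) M₁′)) ⟩
          g₁ ^ (M₁′ ℕ.* ℕ.quotient M₁′∣m₁M₂′)            ≈⟨ ^-assocʳ g₁ M₁′ _ ⟨
          η ^ ℕ.quotient M₁′∣m₁M₂′    ∎)
        (trans (^-assocʳ g₁ M₁′ (suc K)) (trans (^-congʳ g₁ (ℕ.*-comm M₁′ (suc K))) (trans (sym (^-assocʳ g₁ (suc K) M₁′)) (trans (^-congˡ M₁′ g₁^K≈1) (1^ M₁′)))))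

    g₂^q-power : ∃[ k ] g₂ ^ q ≈ η ^ k
    g₂^q-power = proj₁ g₂^M₂′-power ℕ.* ℕ.quotient M₂′∣q , trans
      (trans (^-congʳ g₂ (≡.trans (ℕ._∣_.equality M₂′∣q) (ℕ.*-comm (ℕ.quotient M₂′∣q) M₂′))) (sym (^-assocʳ g₂ M₂′ _)))
      (^-power η (proj₁ g₂^M₂′-power) (proj₂ g₂^M₂′-power) (ℕ.quotient M₂′∣q))

-- The ring with x^N = ζ^h₁ and the bound w ≤ d

module Ramified {c ℓ : Level} (R : CommutativeRing c ℓ) (domain : IntegralDomain R) (char0 : CharZero R)
  (n h : ℕ) {{_ : NonZero n}} {{_ : NonZero h}} (ζ : CommutativeRing.Carrier R) (prim : PrimitiveRoot R h ζ)
  (H : Fin n → Fin n → Fin h) (bh : IsBH R n h ζ H)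
  (d h₁ N : ℕ) (h≡ : h ≡ h₁ ℕ.* d) (n≡ : n ≡ N ℕ.* d) where
  open CommutativeRing R hiding (zero)
  open RingProperties R
  open Evaluation R
  open IntegralDomainProperties R domain char0

  private
    ζ^h≈1 : ζ ^ h ≈ 1#
    ζ^h≈1 = proj₁ prim

    instance
      N≢0 : NonZero N
      N≢0 = ℕ.≢-nonZero λ { ≡.refl → ℕ.≢-nonZero⁻¹ n n≡ }

  open RootOfUnity R h ζ ζ^h≈1
  open FromBH R n h ζ ζ^h≈1 H bh hiding (autocorrelation)

  private
    twist : ∀ {l} → Dec (N ℕ.∣ l) → FormalSum ℕ
    twist (yes (divides q _)) = ⟨ h₁ ℕ.* q ⟩
    twist (no _)              = 𝟘

  -- The functional with x^(qN) ↦ ζ^(h₁ q), and 0 on the other powers of x, reads off the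
  -- coefficient of 1 in the basis 1, ..., x^(N-1) of ℤ[ζ][x] / (x^N - ζ^h₁).
  T : ℕ → FormalSum ℕ
  T l = twist (N ℕ.∣? l)

  private
    τ : ℕ → Carrier
    τ l = ev (ζ ^_) (T l)

    T-yes : ∀ {l} q → l ≡ q ℕ.* N → T l ≡ ⟨ h₁ ℕ.* q ⟩
    T-yes {l} q e with N ℕ.∣? l
    ... | yes (divides q′ e′) = ≡.cong (λ x → ⟨ h₁ ℕ.* x ⟩) (ℕ.*-cancelʳ-≡ q′ q N (≡.trans (≡.sym e′) e))
    ... | no ¬d               = ⊥-elim (¬d (divides q e))

    T-no : ∀ {l} → ¬ N ℕ.∣ l → T l ≡ 𝟘
    T-no {l} ¬d with N ℕ.∣? l
    ... | yes d′ = ⊥-elim (¬d d′)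
    ... | no _   = ≡.refl

    shift : ℕ → FormalSum ℕ → FormalSum ℕ
    shift k P = bind P (λ e → ⟨ k ℕ.+ e ⟩)

    size-shift : ∀ k P → size (shift k P) ≡ size P
    size-shift k P = ≡.trans (size-bind 1 (λ _ → ≡.refl) P) (ℕ.*-identityʳ _)

    T-shift : ∀ l → T (l ℕ.+ N) ≡ shift h₁ (T l)
    T-shift l with N ℕ.∣? l
    ... | yes (divides q e) = ≡.trans (T-yes (suc q) (≡.trans (ℕ.+-comm l N) (≡.cong (N ℕ.+_) e))) (≡.cong ⟨_⟩ (ℕ.*-suc h₁ q))
    ... | no ¬d             = T-no (λ d′ → ¬d (ℕ.∣m+n∣m⇒∣n (≡.subst (N ℕ.∣_) (ℕ.+-comm l N) d′) ℕ.∣-refl))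

    size-T-shift : ∀ l → size (T (l ℕ.+ N)) ≡ size (T l)
    size-T-shift l = ≡.trans (≡.cong size (T-shift l)) (size-shift h₁ (T l))

    τ-shift : ∀ l → τ (l ℕ.+ N) ≈ ζ ^ h₁ * τ l
    τ-shift l = trans (reflexive (≡.cong (ev (ζ ^_)) (T-shift l)))
      (trans (ev-bind (ζ ^_) _ (T l)) (trans (ev-cong (λ e → ^-homo-* ζ h₁ e) (T l)) (ev-*ˡ (ζ ^ h₁) (ζ ^_) (T l))))

    τ-shifts : ∀ j l → τ (l ℕ.+ j ℕ.* N) ≈ ζ ^ (j ℕ.* h₁) * τ l
    τ-shifts zero    l = trans (reflexive (≡.cong τ (ℕ.+-identityʳ l))) (sym (*-identityˡ _))
    τ-shifts (suc j) l = begin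
      τ (l ℕ.+ (N ℕ.+ j ℕ.* N))               ≡⟨ ≡.cong τ (shuffle l N (j ℕ.* N)) ⟩
      τ (l ℕ.+ j ℕ.* N ℕ.+ N)                 ≈⟨ τ-shift (l ℕ.+ j ℕ.* N) ⟩
      ζ ^ h₁ * τ (l ℕ.+ j ℕ.* N)              ≈⟨ *-congˡ (τ-shifts j l) ⟩
      ζ ^ h₁ * (ζ ^ (j ℕ.* h₁) * τ l)         ≈⟨ *-assoc _ _ _ ⟨
      ζ ^ h₁ * ζ ^ (j ℕ.* h₁) * τ l           ≈⟨ *-congʳ (^-homo-* ζ h₁ (j ℕ.* h₁)) ⟨
      ζ ^ (h₁ ℕ.+ j ℕ.* h₁) * τ l             ∎
      where
      open Relation.Binary.Reasoning.Setoid setoid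
      shuffle : ∀ l n m → l ℕ.+ (n ℕ.+ m) ≡ l ℕ.+ m ℕ.+ n
      shuffle = solve-∀

    τ-periodic : ∀ l → τ (l ℕ.+ n) ≈ τ l
    τ-periodic l = trans (reflexive (≡.cong (λ x → τ (l ℕ.+ x)) (≡.trans n≡ (ℕ.*-comm N d)))) (trans (τ-shifts d l)
      (trans (*-congʳ (trans (^-congʳ ζ (≡.trans (ℕ.*-comm d h₁) (≡.sym h≡))) ζ^h≈1)) (*-identityˡ _)))

  open TwistedRingProperties R torsionFree n h ζ ζ^h≈1 T τ-periodic
  private
    module B where
      open CommutativeRing twistedRing public
      open RingProperties twistedRing public
    module Hᴿ = CommutativeRing halfRing
  open Conjugation conjugation
  open Descent twistedRing conjugation using (Descends; descends-product)
  open Geometric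

  private
    z x : FormalSum (ℕ × ℕ)
    z = ⟨ 1 , 0 ⟩
    x = ⟨ 0 , 1 ⟩

    z^ : ∀ k → z B.^ k B.≈ ⟨ k , 0 ⟩
    z^ k = B.trans (mono-^ (1 , 0) k) (B.reflexive (≡.cong₂ (λ i l → ⟨ i , l ⟩) (ℕ.*-identityʳ k) (ℕ.*-zeroʳ k)))

    x^ : ∀ k → x B.^ k B.≈ ⟨ 0 , k ⟩
    x^ k = B.trans (mono-^ (0 , 1) k) (B.reflexive (≡.cong₂ (λ i l → ⟨ i , l ⟩) (ℕ.*-zeroʳ k) (ℕ.*-identityʳ k)))

    x^N≈z^h₁ : x B.^ N B.≈ z B.^ h₁
    x^N≈z^h₁ = B.trans (x^ N) (B.trans (half-mono {0 , N} {h₁ , 0} (half-intro λ i l → begin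
        ζ ^ (i ℕ.+ 0) * τ (l ℕ.+ N)       ≈⟨ *-cong (^-congʳ ζ (ℕ.+-identityʳ i)) (τ-shift l) ⟩
        ζ ^ i * (ζ ^ h₁ * τ l)            ≈⟨ *-assoc _ _ _ ⟨
        ζ ^ i * ζ ^ h₁ * τ l              ≈⟨ *-cong (sym (^-homo-* ζ i h₁)) (reflexive (≡.cong τ (≡.sym (ℕ.+-identityʳ l)))) ⟩
        ζ ^ (i ℕ.+ h₁) * τ (l ℕ.+ 0)      ∎)) (B.sym (z^ h₁)))
      where open Relation.Binary.Reasoning.Setoid setoid

    z^h≈1 : z B.^ (h₁ ℕ.* d) B.≈ B.1#
    z^h≈1 = B.trans (z^ (h₁ ℕ.* d)) (B.trans (B.reflexive (≡.cong (λ i → ⟨ i , 0 ⟩) (≡.sym h≡))) ζ-mono-period)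

    x^n≈1 : x B.^ (N ℕ.* d) B.≈ B.1#
    x^n≈1 = B.trans (B.sym (B.^-assocʳ x N d)) (B.trans (B.^-congˡ d x^N≈z^h₁) (B.trans (B.^-assocʳ z h₁ d) z^h≈1))

    z^κ≈1 : z B.^ suc κ B.≈ B.1#
    z^κ≈1 = B.trans (mono-^ (1 , 0) (suc κ)) (mono-period (1 , 0))

    x^κ≈1 : x B.^ suc κ B.≈ B.1#
    x^κ≈1 = B.trans (mono-^ (0 , 1) (suc κ)) (mono-period (0 , 1))

    powers-from-generators : ∀ q η → ∃[ k ] z B.^ q B.≈ η B.^ k → ∃[ k ] x B.^ q B.≈ η B.^ k →
                             ∀ g → ∃[ k ] ⟨ q ⋆ g ⟩ B.≈ η B.^ k
    powers-from-generators q η (k₁ , e₁) (k₂ , e₂) (i , l) = k₁ ℕ.* i ℕ.+ k₂ ℕ.* l , (begin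
      ⟨ q ℕ.* i , q ℕ.* l ⟩                       ≡⟨ ≡.cong (λ j → ⟨ j , q ℕ.* l ⟩) (≡.sym (ℕ.+-identityʳ _)) ⟩
      ⟨ (q ℕ.* i , 0) ⊹ (0 , q ℕ.* l) ⟩           ≈⟨ mono-⊛ (q ℕ.* i , 0) (0 , q ℕ.* l) ⟨
      ⟨ q ℕ.* i , 0 ⟩ B.* ⟨ 0 , q ℕ.* l ⟩         ≈⟨ B.*-cong (z^ (q ℕ.* i)) (x^ (q ℕ.* l)) ⟨
      z B.^ (q ℕ.* i) B.* x B.^ (q ℕ.* l)         ≈⟨ B.*-cong (B.^-assocʳ z q i) (B.^-assocʳ x q l) ⟨
      (z B.^ q) B.^ i B.* (x B.^ q) B.^ l         ≈⟨ B.*-cong (^-power η k₁ e₁ i) (^-power η k₂ e₂ l) ⟩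
      η B.^ (k₁ ℕ.* i) B.* η B.^ (k₂ ℕ.* l)       ≈⟨ B.^-homo-* η (k₁ ℕ.* i) (k₂ ℕ.* l) ⟨
      η B.^ (k₁ ℕ.* i ℕ.+ k₂ ℕ.* l)               ∎)
      where
      open Relation.Binary.Reasoning.Setoid B.setoid
      open CyclicPowers twistedRing using (^-power)

    ev-geometric : ∀ m e i l → ev (λ g → s ((i , l) ⊹ g)) (geometric halfRing m ⟨ e , 0 ⟩) ≈ s (i , l) * geometric R m (ζ ^ e)
    ev-geometric zero    e i l = sym (zeroʳ _)
    ev-geometric (suc m) e i l = begin
      s ((i , l) ⊹ (0 , 0)) + ev (λ g → s ((i , l) ⊹ g)) (⟨ e , 0 ⟩ ⊛ G)
        ≈⟨ +-cong (reflexive (≡.cong s (≡.cong₂ _,_ (ℕ.+-identityʳ i) (ℕ.+-identityʳ l))))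
             (trans (ev-convolve _⊹_ _ ⟨ e , 0 ⟩ G) (ev-cong (λ g → reflexive (≡.cong s (≡.sym (⊹-assoc (i , l) (e , 0) g)))) G)) ⟩
      s (i , l) + ev (λ g → s ((i ℕ.+ e , l ℕ.+ 0) ⊹ g)) G
        ≈⟨ +-congˡ (ev-geometric m e (i ℕ.+ e) (l ℕ.+ 0)) ⟩
      s (i , l) + ζ ^ (i ℕ.+ e) * τ (l ℕ.+ 0) * G′
        ≈⟨ +-congˡ (*-congʳ (*-cong (^-homo-* ζ i e) (reflexive (≡.cong τ (ℕ.+-identityʳ l))))) ⟩
      ζ ^ i * τ l + ζ ^ i * ζ ^ e * τ l * G′
        ≈⟨ solve 4 (λ a b t g → a :* t :+ a :* b :* t :* g := a :* t :* (:1 :+ b :* g)) refl (ζ ^ i) (ζ ^ e) (τ l) G′ ⟩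
      s (i , l) * (1# + ζ ^ e * G′) ∎
      where
      open Relation.Binary.Reasoning.Setoid setoid
      G = geometric halfRing m ⟨ e , 0 ⟩
      G′ = geometric R m (ζ ^ e)

  module _ {p : ℕ} (pr : Prime p) (p∣d : p ℕ.∣ d) (J : ℕ) (1≤J : 1 ℕ.≤ J)
           (∣1+p^J : ∀ x → x ℕ.∣ n ⊎ x ℕ.∣ h → ¬ p ℕ.∣ x → x ℕ.∣ suc (p ℕ.^ J)) where
    private
      instance
        p≢0 : NonZero p
        p≢0 = prime⇒nonZero pr

      -- Since 0 < h/p < h and ζ has exact order h, ζ^(h/p) is a p-th root of unity other than 1,
      -- and in a domain the sum of its powers vanishes.
      geometric-ζ : ∀ hp → h ≡ p ℕ.* hp → geometric twistedRing p ⟨ hp , 0 ⟩ B.≈ B.0#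
      geometric-ζ hp h≡p*hp = ≡.subst (λ m → geometric halfRing m ⟨ hp , 0 ⟩ Hᴿ.≈ Hᴿ.0# → geometric twistedRing m ⟨ hp , 0 ⟩ B.≈ B.0#)
          (ℕ.suc-pred p) (geometric-both (ℕ.pred p) (hp , 0))
          (half-intro λ i l → trans (ev-geometric p hp i l) (trans (*-congˡ (geometric-root p (ζ ^ hp)
            (trans (^-assocʳ ζ hp p) (trans (^-congʳ ζ (≡.trans (ℕ.*-comm hp p) (≡.sym h≡p*hp))) ζ^h≈1))
            (proj₂ prim hp 0<hp hp<h))) (zeroʳ _)))
        where
        hp≢0 : NonZero hp
        hp≢0 = ℕ.≢-nonZero λ { ≡.refl → ℕ.≢-nonZero⁻¹ h (≡.trans h≡p*hp (ℕ.*-zeroʳ p)) }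
        0<hp = ℕ.>-nonZero⁻¹ hp {{hp≢0}}
        hp<h : hp ℕ.< h
        hp<h = ≡.subst (hp ℕ.<_) (≡.sym (≡.trans h≡p*hp (ℕ.*-comm p hp))) (ℕ.m<m*n hp p {{hp≢0}} (ℕ.nonTrivial⇒n>1 p {{prime⇒nonTrivial pr}}))

      record Extraction (m : ℕ) : Set where
        field
          A m′ : ℕ
          m≡ : m ≡ p ℕ.^ suc A ℕ.* m′
          p∤m′ : ¬ p ℕ.∣ m′
        part : m ≡ p ℕ.* (p ℕ.^ A ℕ.* m′)
        part = ≡.trans m≡ (ℕ.*-assoc p (p ℕ.^ A) m′)
        m′∣m : m′ ℕ.∣ m
        m′∣m = divides (p ℕ.^ suc A) m≡

      extraction : ∀ m → .{{NonZero m}} → p ℕ.∣ m → Extraction m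
      extraction m p∣m with extract-prime pr m
      ... | zero  , m′ , e , p∤m′ = ⊥-elim (p∤m′ (≡.subst (p ℕ.∣_) (≡.trans e (ℕ.*-identityˡ m′)) p∣m))
      ... | suc A , m′ , e , p∤m′ = record { A = A ; m′ = m′ ; m≡ = e ; p∤m′ = p∤m′ }

      module Eh = Extraction (extraction h (ℕ.∣-trans p∣d (divides h₁ h≡)))
      module En = Extraction (extraction n (ℕ.∣-trans p∣d (divides N n≡)))

      h′∣q = ∣1+p^J Eh.m′ (inj₂ Eh.m′∣m) Eh.p∤m′
      n′∣q = ∣1+p^J En.m′ (inj₁ En.m′∣m) En.p∤m′

      module CP = CyclicPowers twistedRing

    -- The monomials are generated by z and x subject to x^N = z^h₁. If p ∤ N, the p-part of z
    -- generates the p-part of the whole group; if p ∤ h₁, the p-part of x does.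
    descends-p : ¬ p ℕ.∣ h₁ ⊎ ¬ p ℕ.∣ N → Descends p
    descends-p (inj₂ p∤N) = descendsRing pr J 1≤J (Eh.m′ , 0) Eh.A
      (B.trans (geometric-cong twistedRing p (B.trans (mono-^ (Eh.m′ , 0) (p ℕ.^ Eh.A))
         (B.reflexive (≡.cong (λ l → ⟨ p ℕ.^ Eh.A ℕ.* Eh.m′ , l ⟩) (ℕ.*-zeroʳ (p ℕ.^ Eh.A)))))) (geometric-ζ _ Eh.part))
      (λ g → proj₁ (powers g) , B.trans (proj₂ (powers g)) (B.^-congˡ (proj₁ (powers g)) (z^ Eh.m′)))
      where
      powers = powers-from-generators (suc (p ℕ.^ J)) (z B.^ Eh.m′)
        (CP.g₁^q-power pr {z} {x} {d} {h₁} {N} {κ} z^h≈1 x^n≈1 z^κ≈1 x^N≈z^h₁ p∤N {suc Eh.A} {suc En.A}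
          (≡.trans (≡.sym h≡) Eh.m≡) (≡.trans (≡.sym n≡) En.m≡) Eh.p∤m′ h′∣q n′∣q)
        (CP.g₂^q-power pr {z} {x} {d} {h₁} {N} {κ} z^h≈1 x^n≈1 z^κ≈1 x^N≈z^h₁ p∤N {suc Eh.A} {suc En.A}
          (≡.trans (≡.sym h≡) Eh.m≡) (≡.trans (≡.sym n≡) En.m≡) Eh.p∤m′ h′∣q n′∣q)
    descends-p (inj₁ p∤h₁) = descendsRing pr J 1≤J (0 , En.m′) En.A
      (B.trans (geometric-cong twistedRing p part≈) (geometric-ζ _ h≡p*hp))
      (λ g → proj₁ (powers g) , B.trans (proj₂ (powers g)) (B.^-congˡ (proj₁ (powers g)) (x^ En.m′)))
      where
      d₁ = ℕ.quotient p∣d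
      d≡ : d ≡ d₁ ℕ.* p
      d≡ = ℕ._∣_.equality p∣d
      h≡p*hp : h ≡ p ℕ.* (h₁ ℕ.* d₁)
      h≡p*hp = ≡.trans h≡ (≡.trans (≡.cong (h₁ ℕ.*_) d≡) (shuffle h₁ d₁ p))
        where
        shuffle : ∀ a b c → a ℕ.* (b ℕ.* c) ≡ c ℕ.* (a ℕ.* b)
        shuffle = solve-∀
      np≡ : p ℕ.^ En.A ℕ.* En.m′ ≡ N ℕ.* d₁
      np≡ = ℕ.*-cancelˡ-≡ _ _ p (≡.trans (≡.sym En.part) (≡.trans n≡ (≡.trans (≡.cong (N ℕ.*_) d≡) (shuffle N d₁ p))))
        where
        shuffle : ∀ a b c → a ℕ.* (b ℕ.* c) ≡ c ℕ.* (a ℕ.* b)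
        shuffle = solve-∀
      -- Because p ∣ d, x^(n/p) = (x^N)^(d/p) = z^(h/p), so the p-th root of unity is the same as in
      -- the other case.
      part≈ : ⟨ 0 , En.m′ ⟩ B.^ (p ℕ.^ En.A) B.≈ ⟨ h₁ ℕ.* d₁ , 0 ⟩
      part≈ = begin
        ⟨ 0 , En.m′ ⟩ B.^ (p ℕ.^ En.A)      ≈⟨ mono-^ (0 , En.m′) (p ℕ.^ En.A) ⟩
        ⟨ p ℕ.^ En.A ⋆ (0 , En.m′) ⟩        ≡⟨ ≡.cong₂ (λ i l → ⟨ i , l ⟩) (ℕ.*-zeroʳ (p ℕ.^ En.A)) np≡ ⟩
        ⟨ 0 , N ℕ.* d₁ ⟩                    ≈⟨ x^ (N ℕ.* d₁) ⟨
        x B.^ (N ℕ.* d₁)                    ≈⟨ B.^-assocʳ x N d₁ ⟨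
        (x B.^ N) B.^ d₁                    ≈⟨ CP.^-power z h₁ x^N≈z^h₁ d₁ ⟩
        z B.^ (h₁ ℕ.* d₁)                   ≈⟨ z^ (h₁ ℕ.* d₁) ⟩
        ⟨ h₁ ℕ.* d₁ , 0 ⟩                   ∎
        where open Relation.Binary.Reasoning.Setoid B.setoid
      powers = powers-from-generators (suc (p ℕ.^ J)) (x B.^ En.m′)
        (CP.g₂^q-power pr {x} {z} {d} {N} {h₁} {κ} x^n≈1 z^h≈1 x^κ≈1 (B.sym x^N≈z^h₁) p∤h₁ {suc En.A} {suc Eh.A}
          (≡.trans (≡.sym n≡) En.m≡) (≡.trans (≡.sym h≡) Eh.m≡) En.p∤m′ n′∣q h′∣q)
        (CP.g₁^q-power pr {x} {z} {d} {N} {h₁} {κ} x^n≈1 z^h≈1 x^κ≈1 (B.sym x^N≈z^h₁) p∤h₁ {suc En.A} {suc Eh.A}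
          (≡.trans (≡.sym n≡) En.m≡) (≡.trans (≡.sym h≡) Eh.m≡) En.p∤m′ n′∣q h′∣q)

  private
    module ΣN = RangeSum ℕ.+-0-commutativeMonoid
    open Algebra.Properties.CommutativeMonoid.Sum ℕ.+-0-commutativeMonoid using (sum)

    size-row : ∀ {n} (F : Fin n → ℕ × ℕ) (σ : ℕ × ℕ → FormalSum ℕ) →
               size (bind (⨁ (λ k → ⟨ F k ⟩)) σ) ≡ sum (λ k → size (σ (F k)))
    size-row {zero}  F σ = ≡.refl
    size-row {suc n} F σ = ≡.cong (size (σ (F zero)) ℕ.+_) (size-row (λ k → F (suc k)) σ)

    size-T-blocks : ∀ m → ΣN.Σ< (m ℕ.* N) (λ k → size (T k)) ≡ m
    size-T-blocks zero    = ≡.refl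
    size-T-blocks (suc m) = ≡.trans (ΣN.Σ<-+ N (m ℕ.* N) (λ k → size (T k))) (≡.cong₂ ℕ._+_
      (≡.trans (ΣN.Σ<-first N (λ k → size (T k)) (λ k 0<k k<N → ≡.cong size (T-no (λ d → ℕ.<⇒≱ k<N (ℕ.∣⇒≤ {{ℕ.>-nonZero 0<k}} d)))))
               (≡.cong size (T-yes 0 ≡.refl)))
      (≡.trans (ΣN.Σ<-cong (m ℕ.* N) (λ k → ≡.trans (≡.cong (λ i → size (T i)) (ℕ.+-comm N k)) (size-T-shift k))) (size-T-blocks m)))

    size-T-periodic : ∀ k → size (T (k ℕ.+ n)) ≡ size (T k)
    size-T-periodic k = ≡.trans (≡.cong (λ x → size (T (k ℕ.+ x))) (≡.trans n≡ (ℕ.*-comm N d))) (go d k)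
      where
      go : ∀ j k → size (T (k ℕ.+ j ℕ.* N)) ≡ size (T k)
      go zero    k = ≡.cong (λ x → size (T x)) (ℕ.+-identityʳ k)
      go (suc j) k = ≡.trans (≡.cong (λ x → size (T x)) (≡.sym (ℕ.+-assoc k N (j ℕ.* N)))) (≡.trans (go j (k ℕ.+ N)) (size-T-shift k))

  size-coefficient : ∀ l₀ → size (coefficient l₀ (D row)) ≡ d
  size-coefficient l₀ = begin
    size (coefficient l₀ (D row))                 ≡⟨ size-row {n} (λ k → row (toℕ k) , toℕ k) _ ⟩
    ΣN.Σ< n (λ k → size (shift (row k) (T (l₀ ℕ.+ k))))
      ≡⟨ ΣN.Σ<-cong n (λ k → ≡.trans (size-shift (row k) (T (l₀ ℕ.+ k))) (≡.cong (λ x → size (T x)) (ℕ.+-comm l₀ k))) ⟩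
    ΣN.Σ< n (λ k → size (T (k ℕ.+ l₀)))           ≡⟨ ΣN.Σ<-shift n (λ k → size (T k)) size-T-periodic l₀ ⟩
    ΣN.Σ< n (λ k → size (T k))                    ≡⟨ ≡.cong (λ m → ΣN.Σ< m (λ k → size (T k))) (≡.trans n≡ (ℕ.*-comm N d)) ⟩
    ΣN.Σ< (d ℕ.* N) (λ k → size (T k))            ≡⟨ size-T-blocks d ⟩
    d                                             ∎
    where open ≡.≡-Reasoning

  module _ (w : ℕ) {{_ : NonZero w}} (w²∣n : w ℕ.* w ℕ.∣ n) (descends-w : ∀ {p} → Prime p → p ℕ.∣ w → Descends p) where
    private
      open PrimeFactorisation (factorise w) using (isFactorisation; factorsPrime) renaming (factors to ps)

      factor-descends : ∀ qs → (∀ {q} → Prime q → q ℕ.∣ product qs → q ℕ.∣ w) → All Prime qs → All (λ q → NonZero q × Descends q) qs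
      factor-descends []       d []         = []
      factor-descends (q ∷ qs) d (pr ∷ prs) = (prime⇒nonZero pr , descends-w pr (d pr (ℕ.m∣m*n (product qs)))) ∷
        factor-descends qs (λ pr′ q′∣ → d pr′ (ℕ.∣-trans q′∣ (ℕ.n∣m*n q))) prs

      w∣D : B.fromℕ# (product ps) B.∣ D row
      w∣D = descends-product (λ m → torsionFreeRing m) ps
        (factor-descends ps (λ _ q∣ → ≡.subst (_ ℕ.∣_) (≡.sym isFactorisation) q∣) factorsPrime) (D row) (B.fromℕ# m)
        (B.trans (DD̄ row (entry-periodic 0) autocorrelation-0 autocorrelation-l)
          (B.trans (B.reflexive (≡.cong B.fromℕ# n≡ps)) (B.trans (B.fromℕ#-* (product ps ℕ.* product ps) m)
            (B.*-congʳ {B.fromℕ# m} (B.fromℕ#-* (product ps) (product ps))))))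
        where
        m = ℕ.quotient w²∣n
        n≡ps : n ≡ product ps ℕ.* product ps ℕ.* m
        n≡ps = ≡.trans (ℕ._∣_.equality w²∣n) (≡.trans (ℕ.*-comm m (w ℕ.* w)) (≡.cong (λ v → v ℕ.* v ℕ.* m) isFactorisation))

    w≤d : ∀ K → DiscreteRoots h ζ ζ^h≈1 K → ¬ d ℕ.< w
    w≤d K disc d<w = D-nonzero row (entry-periodic 0) autocorrelation-0 autocorrelation-l
      (λ z → 1≉0 (trans (sym (trans (reflexive (≡.cong (ev (ζ ^_)) (T-yes 0 ≡.refl))) (^-congʳ ζ (ℕ.*-zeroʳ h₁)))) z))
      λ l₀ → indivisible h ζ ζ^h≈1 {K} disc (coefficient l₀ (D row)) (coefficient l₀ (proj₁ w∣D)) w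
        (≡.subst (ℕ._< w) (≡.sym (size-coefficient l₀)) d<w)
        (trans (coefficient-divisible (product ps) (proj₂ w∣D) l₀) (×-congˡ (≡.sym isFactorisation)))

-- Prime divisors, totients and the stated inequalities

open import Data.Nat using (_+_; _*_; _^_; _≤_)
open import Data.Nat.Divisibility using (_∣_)

length-filter-∷ʳ : ∀ {ℓ} {P : Pred ℕ ℓ} (P? : Decidable P) xs x →
                   length (filter P? (xs ∷ʳ x)) ≡ length (filter P? xs) ℕ.+ length (filter P? (x ∷ []))
length-filter-∷ʳ P? xs x = ≡.trans (≡.cong length (filter-++ P? xs (x ∷ []))) (length-++ (filter P? xs))

length-filter-mono : ∀ {ℓ} {P Q : Pred ℕ ℓ} (P? : Decidable P) (Q? : Decidable Q) → (∀ {x} → P x → Q x) →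
                     ∀ xs → length (filter P? xs) ℕ.≤ length (filter Q? xs)
length-filter-mono P? Q? P⊆Q []       = ℕ.z≤n
length-filter-mono P? Q? P⊆Q (x ∷ xs) with P? x | Q? x
... | yes _  | yes _  = ℕ.s≤s (length-filter-mono P? Q? P⊆Q xs)
... | yes Px | no ¬Qx = ⊥-elim (¬Qx (P⊆Q Px))
... | no _   | yes _  = ℕ.m≤n⇒m≤1+n (length-filter-mono P? Q? P⊆Q xs)
... | no _   | no _   = length-filter-mono P? Q? P⊆Q xs

filter-singleton-no : ∀ {ℓ} {P : Pred ℕ ℓ} (P? : Decidable P) {x} → ¬ P x → length (filter P? (x ∷ [])) ≡ 0
filter-singleton-no P? {x} ¬Px with P? x
... | yes Px = ⊥-elim (¬Px Px)
... | no _   = ≡.refl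

module _ {ℓ} {P : Pred ℕ ℓ} (P? : Decidable P) where

  count< : ℕ → ℕ
  count< n = length (filter P? (upTo n))

  count<-suc : ∀ n → count< (suc n) ≡ count< n ℕ.+ length (filter P? (n ∷ []))
  count<-suc n = ≡.trans (≡.cong (λ xs → length (filter P? xs)) (≡.sym (upTo-∷ʳ n))) (length-filter-∷ʳ P? (upTo n) n)

  count<-extend : ∀ n j → count< n ℕ.≤ count< (j ℕ.+ n)
  count<-extend n zero    = ℕ.≤-refl
  count<-extend n (suc j) = ℕ.≤-trans (count<-extend n j) (ℕ.≤-trans (ℕ.m≤m+n _ _) (ℕ.≤-reflexive (≡.sym (count<-suc (j ℕ.+ n)))))

  count<-stable : ∀ n → (∀ {x} → P x → x ℕ.< n) → ∀ j → count< (j ℕ.+ n) ≡ count< n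
  count<-stable n b zero    = ≡.refl
  count<-stable n b (suc j) = ≡.trans (count<-suc (j ℕ.+ n)) (≡.trans (≡.cong₂ ℕ._+_ (count<-stable n b j)
    (filter-singleton-no P? (λ Px → ℕ.<⇒≱ (b Px) (ℕ.m≤n+m n j)))) (ℕ.+-identityʳ _))

-- The counts run over different ranges, so both are moved to the common range below h + k + 1. The
-- count for h does not change there, as divisors of h are at most h.
ω-mono : ∀ k h .{{_ : NonZero h}} → (∀ {p} → Prime p → p ∣ k → p ∣ h) → ω k ≤ ω h
ω-mono k h imp = begin
  count< (Q? k) (suc k)               ≤⟨ count<-extend (Q? k) (suc k) h ⟩
  count< (Q? k) (h ℕ.+ suc k)         ≤⟨ length-filter-mono (Q? k) (Q? h) (λ (pr , d) → pr , imp pr d) (upTo (h ℕ.+ suc k)) ⟩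
  count< (Q? h) (h ℕ.+ suc k)         ≡⟨ ≡.cong (count< (Q? h)) (≡.trans (ℕ.+-suc h k) (≡.trans (≡.cong suc (ℕ.+-comm h k)) (≡.sym (ℕ.+-suc k h)))) ⟩
  count< (Q? h) (k ℕ.+ suc h)         ≡⟨ count<-stable (Q? h) (suc h) (λ (_ , d) → ℕ.s≤s (ℕ.∣⇒≤ d)) k ⟩
  count< (Q? h) (suc h)               ∎
  where
  open ℕ.≤-Reasoning
  Q? : ∀ m → Decidable (λ p → Prime p × p ∣ m)
  Q? m p = prime? p ×-dec p ℕ.∣? m

φ≤ : ∀ k → φ k ≤ k
φ≤ k = ℕ.≤-trans (length-filter (λ i → coprime? i k) (map suc (upTo k)))
         (ℕ.≤-reflexive (≡.trans (length-map suc (upTo k)) (length-upTo k)))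

-- In each pair 2i + 1, 2i + 2 the even member shares the factor 2 with k, so at most half of the
-- numbers up to k are counted.
φ-even : ∀ k → 2 ∣ k → φ k * 2 ≤ k
φ-even k 2∣k@(divides j k≡) = ℕ.≤-trans (ℕ.*-monoˡ-≤ 2 (≡.subst (λ m → F m ≤ j) (≡.sym k≡) (half j))) (ℕ.≤-reflexive (≡.sym k≡))
  where
  F : ℕ → ℕ
  F n = length (filter (λ i → coprime? i k) (map suc (upTo n)))
  one : ℕ → ℕ
  one i = length (filter (λ i → coprime? i k) (i ∷ []))
  F-suc : ∀ n → F (suc n) ≡ F n + one (suc n)
  F-suc n = ≡.trans (≡.cong (λ xs → length (filter (λ i → coprime? i k) xs))
      (≡.trans (≡.cong (map suc) (≡.sym (upTo-∷ʳ n))) (map-++ suc (upTo n) (n ∷ []))))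
    (length-filter-∷ʳ (λ i → coprime? i k) (map suc (upTo n)) (suc n))
  even-one : ∀ i → one (suc i * 2) ≡ 0
  even-one i = filter-singleton-no (λ i → coprime? i k) {suc i * 2} λ cop → ℕ.1+n≢n {1} (cop (divides (suc i) ≡.refl , 2∣k))
  half : ∀ j → F (j * 2) ≤ j
  half zero    = ℕ.z≤n
  half (suc j) = begin
    F (suc (suc (j * 2)))                              ≡⟨ F-suc (suc (j * 2)) ⟩
    F (suc (j * 2)) + one (suc j * 2)                  ≡⟨ ≡.cong (F (suc (j * 2)) +_) (even-one j) ⟩
    F (suc (j * 2)) + 0                                ≡⟨ ℕ.+-identityʳ _ ⟩
    F (suc (j * 2))                                    ≡⟨ F-suc (j * 2) ⟩
    F (j * 2) + one (suc (j * 2))                      ≤⟨ ℕ.+-mono-≤ (half j) (length-filter (λ i → coprime? i k) (suc (j * 2) ∷ [])) ⟩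
    j + 1                                              ≡⟨ ℕ.+-comm j 1 ⟩
    suc j                                              ∎
    where open ℕ.≤-Reasoning

-- The bound is squared and cleared of denominators, so the powers of 2 become powers of 4. For r <
-- t there is room for the exponent r + 1; for r = t the term δ supplies it.
bound-odd : ∀ {w d k f r t} → w ≤ d → f ≤ k → r ≤ t → w * w * f * 4 ^ (r + 1) ≤ 4 ^ (t + δ r t) * (d * d) * k
bound-odd {w} {d} {k} {f} {r} {t} w≤d f≤k r≤t = begin
  w * w * f * 4 ^ (r + 1)           ≤⟨ ℕ.*-mono-≤ (ℕ.*-mono-≤ (ℕ.*-mono-≤ w≤d w≤d) f≤k) (ℕ.^-monoʳ-≤ 4 exponents) ⟩
  d * d * k * 4 ^ (t + δ r t)       ≡⟨ shuffle (d * d) k (4 ^ (t + δ r t)) ⟩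
  4 ^ (t + δ r t) * (d * d) * k     ∎
  where
  open ℕ.≤-Reasoning
  shuffle : ∀ a b c → a * b * c ≡ c * a * b
  shuffle = solve-∀
  exponents : r + 1 ≤ t + δ r t
  exponents with r ℕ.≟ t
  ... | yes ≡.refl = ℕ.≤-refl
  ... | no r≢t     = ℕ.≤-trans (ℕ.≤-reflexive (ℕ.+-comm r 1)) (ℕ.≤-trans (ℕ.≤∧≢⇒< r≤t r≢t) (ℕ.m≤m+n t 0))

-- The extra factor 4 is split: one 2 is absorbed by f * 2 ≤ k, the other is the 2 of 2 * k.
bound-even : ∀ {w d k f r t} → w ≤ d → f * 2 ≤ k → r ≤ t → w * w * f * 4 ^ (r + 1) ≤ 4 ^ t * (d * d) * (2 * k)
bound-even {w} {d} {k} {f} {r} {t} w≤d 2f≤k r≤t = begin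
  w * w * f * 4 ^ (r + 1)           ≡⟨ ≡.cong (w * w * f *_) (≡.cong (4 ^_) (ℕ.+-comm r 1)) ⟩
  w * w * f * (4 * 4 ^ r)           ≡⟨ left (w * w) f (4 ^ r) ⟩
  w * w * (f * 2) * (2 * 4 ^ r)     ≤⟨ ℕ.*-mono-≤ (ℕ.*-mono-≤ (ℕ.*-mono-≤ w≤d w≤d) 2f≤k) (ℕ.*-monoʳ-≤ 2 (ℕ.^-monoʳ-≤ 4 r≤t)) ⟩
  d * d * k * (2 * 4 ^ t)           ≡⟨ right (d * d) k (4 ^ t) ⟩
  4 ^ t * (d * d) * (2 * k)         ∎
  where
  open ℕ.≤-Reasoning
  left : ∀ a f x → a * f * (4 * x) ≡ a * (f * 2) * (2 * x)
  left = solve-∀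
  right : ∀ a k x → a * k * (2 * x) ≡ x * a * (2 * k)
  right = solve-∀

-- Maximality of u and the bound w ≤ gcd(h,u)

module Bound {c ℓ : Level} (R : CommutativeRing c ℓ) (domain : IntegralDomain R) (char0 : CharZero R)
  (n h : ℕ) {{_ : NonZero n}} {{_ : NonZero h}} (ζ : CommutativeRing.Carrier R) (prim : PrimitiveRoot R h ζ)
  (exists : BHExists R n h ζ) (u w : ℕ) (u∣n : u ∣ n) (sc : SelfConj u (lcm n h))
  (maximal : ∀ d → d ∣ n → SelfConj d (lcm n h) → d ≤ u) where

  open IntegralDomainProperties R domain char0 using (discreteRoots)

  prime∣u⇒∣h : ∀ {p} → Prime p → p ∣ u → p ∣ h
  prime∣u⇒∣h {p} pr p∣u = decidable-stable (p ℕ.∣? h) λ p∤h → discreteRoots h ζ (proj₁ prim) λ (K , disc) →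
    self-conjugate∣n⇒∣h R domain char0 n h ζ (proj₁ prim) (proj₁ exists) (proj₂ exists) K disc pr
      (proj₂ sc p pr p∣u) (ℕ.∣-trans p∣u u∣n) p∤h

  private
    d = gcd h u
    h₁ = ℕ.quotient (gcd[m,n]∣m h u)
    u₁ = ℕ.quotient (gcd[m,n]∣n h u)
    q = ℕ.quotient u∣n
    N = q * u₁
    h≡ : h ≡ h₁ * d
    h≡ = ℕ._∣_.equality (gcd[m,n]∣m h u)
    u≡ : u ≡ u₁ * d
    u≡ = ℕ._∣_.equality (gcd[m,n]∣n h u)
    n≡ : n ≡ N * d
    n≡ = ≡.trans (ℕ._∣_.equality u∣n) (≡.trans (≡.cong (q *_) u≡) (≡.sym (ℕ.*-assoc q u₁ d)))

    instance
      u≢0 : NonZero u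
      u≢0 = ℕ.>-nonZero (proj₁ sc)
      d≢0 : NonZero d
      d≢0 = ℕ.≢-nonZero (gcd[m,n]≢0 h u (inj₁ (ℕ.≢-nonZero⁻¹ h)))

    open Ramified R domain char0 n h ζ prim (proj₁ exists) (proj₂ exists) d h₁ N h≡ n≡ using (descends-p) renaming (w≤d to w≮d)

  -- Otherwise u * p would be a larger divisor of n with the same prime divisors as u, hence
  -- self-conjugate as well.
  prime∣u⇒∤n/u : ∀ {p} → Prime p → p ∣ u → ¬ p ∣ q
  prime∣u⇒∤n/u {p} pr p∣u (divides q′ q≡) = ℕ.<⇒≱ (ℕ.m<m*n u p (ℕ.nonTrivial⇒n>1 p {{prime⇒nonTrivial pr}}))
    (maximal (u * p) (divides q′ (≡.trans (ℕ._∣_.equality u∣n) (≡.trans (≡.cong (_* u) q≡) (shuffle q′ p u))))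
      (ℕ.>-nonZero⁻¹ (u * p) {{ℕ.m*n≢0 u p {{u≢0}} {{prime⇒nonZero pr}}}} , λ p′ pr′ p′∣up → sc-factor pr′ (euclidsLemma u p pr′ p′∣up)))
    where
    shuffle : ∀ a b c → a * b * c ≡ a * (c * b)
    shuffle = solve-∀
    sc-factor : ∀ {p′} → Prime p′ → p′ ∣ u ⊎ p′ ∣ p → SelfConjPrime p′ (lcm n h)
    sc-factor pr′ (inj₁ p′∣u) = proj₂ sc _ pr′ p′∣u
    sc-factor pr′ (inj₂ p′∣p) = proj₂ sc _ pr′ (ℕ.∣-trans p′∣p p∣u)

  -- Here N = (n/u)(u/d). Maximality of u excludes p from n/u, and h/d and u/d have no common prime
  -- because d is the gcd.
  prime∤h₁⊎∤N : ∀ {p} → Prime p → p ∣ u → ¬ p ∣ h₁ ⊎ ¬ p ∣ N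
  prime∤h₁⊎∤N {p} pr p∣u with p ℕ.∣? h₁
  ... | no p∤h₁  = inj₁ p∤h₁
  ... | yes p∣h₁ = inj₂ λ p∣N → case (euclidsLemma q u₁ pr p∣N)
    where
    case : p ∣ q ⊎ p ∣ u₁ → ⊥
    case (inj₁ p∣q)  = prime∣u⇒∤n/u pr p∣u p∣q
    case (inj₂ p∣u₁) = ℕ.<⇒≱ (ℕ.m<m*n d p (ℕ.nonTrivial⇒n>1 p {{prime⇒nonTrivial pr}}))
      (ℕ.≤-trans (ℕ.≤-reflexive (ℕ.*-comm d p)) (ℕ.∣⇒≤ (gcd-greatest
        (≡.subst (p * d ∣_) (≡.sym h≡) (ℕ.*-monoˡ-∣ d p∣h₁)) (≡.subst (p * d ∣_) (≡.sym u≡) (ℕ.*-monoˡ-∣ d p∣u₁)))))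

  w≤gcd : ∀ {k} → u ≡ w * w * k → w ≤ gcd h u
  w≤gcd {k} u≡w²k = decidable-stable (w ℕ.≤? d) λ w≰d → discreteRoots h ζ (proj₁ prim) λ (K , disc) →
    w≮d w {{w≢0}} (ℕ.∣-trans (divides k (≡.trans u≡w²k (ℕ.*-comm (w * w) k))) u∣n)
      (λ {p} pr p∣w → descends-prime pr (ℕ.∣-trans p∣w w∣u)) K disc (ℕ.≰⇒> w≰d)
    where
    w∣u : w ∣ u
    w∣u = divides (w * k) (≡.trans u≡w²k (shuffle w k))
      where
      shuffle : ∀ w k → w * w * k ≡ w * k * w
      shuffle = solve-∀
    w≢0 : NonZero w
    w≢0 = ℕ.≢-nonZero λ { ≡.refl → ℕ.≢-nonZero⁻¹ u u≡w²k }
    descends-prime : ∀ {p} → Prime p → p ∣ u → _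
    descends-prime {p} pr p∣u = descends-p pr (gcd-greatest (prime∣u⇒∣h pr p∣u) p∣u)
      (proj₁ exponent) (proj₁ (proj₂ exponent))
      (λ { x (inj₁ x∣n) → proj₂ (proj₂ exponent) x (ℕ.∣-trans x∣n (m∣lcm[m,n] n h))
         ; x (inj₂ x∣h) → proj₂ (proj₂ exponent) x (ℕ.∣-trans x∣h (n∣lcm[m,n] n h)) })
      (prime∤h₁⊎∤N pr p∣u)
      where exponent = selfConj-exponent pr (proj₂ sc p pr p∣u)

theorem3p7 : {c ℓ : Level} (R : CommutativeRing c ℓ) → IntegralDomain R → CharZero R →
    (n h : ℕ) .{{_ : NonZero n}} .{{_ : NonZero h}} →
    (ζ : CommutativeRing.Carrier R) → PrimitiveRoot R h ζ → BHExists R n h ζ →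
    (u w k : ℕ) →
    u ∣ n → SelfConj u (lcm n h) → (∀ d → d ∣ n → SelfConj d (lcm n h) → d ≤ u) →
    IsSquareFreePart k u → u ≡ w * w * k →
    (¬ (2 ∣ k) →
      w * w * φ k * 4 ^ (ω k + 1) ≤ 4 ^ (ω h + δ (ω k) (ω h)) * (gcd h u * gcd h u) * k)
    × (2 ∣ k →
      w * w * φ k * 4 ^ (ω k + 1) ≤ 4 ^ (ω h) * (gcd h u * gcd h u) * (2 * k))
theorem3p7 R domain char0 n h ζ prim exists u w k u∣n sc maximal _ u≡ =
  (λ _ → bound-odd {w} {gcd h u} {k} {φ k} {ω k} {ω h} w≤gcd (φ≤ k) ωk≤ωh) ,
  (λ 2∣k → bound-even {w} {gcd h u} {k} {φ k} {ω k} {ω h} w≤gcd (φ-even k 2∣k) ωk≤ωh)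
  where
  n≢0 : NonZero n
  n≢0 = ℕ.≢-nonZero (ℕ.≢-nonZero⁻¹ n)
  h≢0 : NonZero h
  h≢0 = ℕ.≢-nonZero (ℕ.≢-nonZero⁻¹ h)
  module B = Bound R domain char0 n h {{n≢0}} {{h≢0}} ζ prim exists u w u∣n sc maximal
  w≤gcd : w ≤ gcd h u
  w≤gcd = B.w≤gcd {k} u≡
  ωk≤ωh : ω k ≤ ω h
  ωk≤ωh = ω-mono k h λ pr p∣k → B.prime∣u⇒∣h pr (ℕ.∣-trans p∣k (divides (w * w) u≡))
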